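{- Let $f\colon\{0,1\}^m\to\{0,1\}^n$ be a $d$-local function and let $1\le k\le n-1$ be an integer. Define $\gamma=k/n$. If $\mathsf{err}(\gamma,d)\ge\delta$ for some $\delta>0$, then $$\|f(\mathcal{U}^m)-\mathcal{D}_k\|\ge 1-4\sqrt{2n}\cdot\exp\{ -n\cdot\delta^{40d}\}.$$
   Context: $\mathcal{U}^m$ is uniform on $\{0,1\}^m$. $\mathcal{D}_k$ is the uniform distribution over strings in $\{0,1\}^n$ of Hamming weight exactly $k$. A function $f$ is $d$-local if each output bit depends on at most $d$ input bits. $\mathsf{err}(\gamma,t)$ is the minimum distance of $\gamma$ to an integer multiple of $2^{ -t}$. $\|\cdot\|$ is total variation distance.
   Formalization: The locality d is assumed to be at least 1; for d = 0 the claim fails (f constant at a weight-1 string, k = 1, n = 10, δ = 1/10 gives distance 9/10, below the claimed bound). -}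

module Defs where

open import Data.Bool.Base using (Bool; true; false; if_then_else_)
import Data.Bool.Properties as Bool
open import Data.Fin.Base using (Fin)
open import Data.Fin.Subset as Subset using (Subset)
import Data.Integer.Base as ℤ
open import Data.Integer.Base using (ℤ; +_)
import Data.Integer.DivMod as ℤ
import Data.Integer.Properties as ℤ
open import Data.List.Base using (List; []; _∷_; _++_; map; foldr; filter; length)
open import Data.Nat.Base as ℕ using (ℕ; zero; suc; z≤n; s≤s)
import Data.Nat.Properties as ℕ
open import Data.Product.Base using (∃; _×_; _,_; proj₁; proj₂)
open import Data.Rational.Base
open import Data.Rational.Properties
import Data.Rational.Unnormalised.Base as ℚᵘ
import Data.Rational.Unnormalised.Properties as ℚᵘ
open import Data.Rational.Solver using (module +-*-Solver)
open import Data.Sum.Base using (_⊎_; inj₁; inj₂; [_,_]′)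
open import Data.Vec.Base as Vec using (Vec; []; _∷_; lookup)
import Data.Vec.Properties as Vec
open import Relation.Binary.Definitions using (DecidableEquality)
open import Relation.Binary.PropositionalEquality
  using (_≡_; refl; sym; trans; cong; cong₂; subst)
open import Relation.Nullary using (Dec; yes; no; does)
open import Relation.Unary using (Pred; Decidable)
open import Relation.Unary.Properties using (U?)

open +-*-Solver using (solve; _:=_; _:+_; _:*_; :-_; _:-_; con)

private

  nn : ∀ {p} → 0ℚ ≤ p → NonNegative p
  nn = nonNegative

  *-mono₂ : ∀ {a b c d} → 0ℚ ≤ a → 0ℚ ≤ d → a ≤ b → c ≤ d → a * c ≤ b * d
  *-mono₂ {a} {b} {c} {d} 0≤a 0≤d a≤b c≤d =
    ≤-trans (*-monoˡ-≤-nonNeg a {{nn 0≤a}} c≤d) (*-monoʳ-≤-nonNeg d {{nn 0≤d}} a≤b)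

  0≤* : ∀ {a b} → 0ℚ ≤ a → 0ℚ ≤ b → 0ℚ ≤ a * b
  0≤* {a} {b} p q = subst (_≤ a * b) (*-zeroʳ a) (*-monoˡ-≤-nonNeg a {{nn p}} q)

  0≤+ : ∀ {a b} → 0ℚ ≤ a → 0ℚ ≤ b → 0ℚ ≤ a + b
  0≤+ p q = +-mono-≤ p q

  0<* : ∀ {a b} → 0ℚ < a → 0ℚ < b → 0ℚ < a * b
  0<* {a} {b} p q = positive⁻¹ (a * b) {{pos*pos⇒pos a {{positive p}} b {{positive q}}}}

  0<½ : 0ℚ < ½
  0<½ = positive⁻¹ ½

  half : ∀ {ε} → 0ℚ < ε → 0ℚ < ½ * ε
  half = 0<* 0<½

  half+half : ∀ ε → ½ * ε + ½ * ε ≡ ε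
  half+half = solve 1 (λ e → con ½ :* e :+ con ½ :* e := e) refl

  unscale : ∀ B → 0ℚ < B → ∀ ε → 0ℚ < ε → ∃ λ δ → 0ℚ < δ × B * δ ≡ ε
  unscale B 0<B ε 0<ε = (1/ B) {{nz}} * ε , 0<* 0<1/B 0<ε , eq
    where
    nz = pos⇒nonZero B {{positive 0<B}}
    0<1/B : 0ℚ < (1/ B) {{nz}}
    0<1/B = positive⁻¹ _ {{1/pos⇒pos B {{positive 0<B}}}}
    eq : B * ((1/ B) {{nz}} * ε) ≡ ε
    eq = trans (sym (*-assoc B _ ε))
         (trans (cong (_* ε) (*-inverseʳ B {{nz}})) (*-identityˡ ε))

  ∣-∣-sym : ∀ p q → ∣ p - q ∣ ≡ ∣ q - p ∣
  ∣-∣-sym p q = trans (cong ∣_∣ (solve 2 (λ p q → p :- q := :- (q :- p)) refl p q))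
                      (∣-p∣≡∣p∣ (q - p))

  ∣-∣-split : ∀ p q r → ∣ p - r ∣ ≤ ∣ p - q ∣ + ∣ q - r ∣
  ∣-∣-split p q r = subst (λ s → ∣ s ∣ ≤ ∣ p - q ∣ + ∣ q - r ∣)
    (solve 3 (λ p q r → (p :- q) :+ (q :- r) := p :- r) refl p q r)
    (∣p+q∣≤∣p∣+∣q∣ (p - q) (q - r))

  p≤∣p∣ : ∀ p → p ≤ ∣ p ∣
  p≤∣p∣ p with ≤-total 0ℚ p
  ... | inj₁ 0≤p = ≤-reflexive (sym (0≤p⇒∣p∣≡p 0≤p))
  ... | inj₂ p≤0 = ≤-trans p≤0 (0≤∣p∣ p)

  0≤-⇒≤ : ∀ {p q} → 0ℚ ≤ q - p → p ≤ q
  0≤-⇒≤ {p} {q} h = subst₂′ (+-identityˡ p)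
    (solve 2 (λ p q → (q :- p) :+ p := q) refl p q) (+-monoˡ-≤ p h)
    where
    subst₂′ : ∀ {a b c d} → a ≡ b → c ≡ d → a ≤ c → b ≤ d
    subst₂′ refl refl x = x

  ≤⇒0≤- : ∀ {p q} → p ≤ q → 0ℚ ≤ q - p
  ≤⇒0≤- {p} {q} h = subst (_≤ q - p) (+-inverseʳ p) (+-monoˡ-≤ (- p) h)

  ∣-∣-ordered : ∀ {p q} → p ≤ q → ∣ q - p ∣ ≡ q - p
  ∣-∣-ordered h = 0≤p⇒∣p∣≡p (≤⇒0≤- h)

  /-≤ : ∀ z b w c .{{_ : ℕ.NonZero b}} .{{_ : ℕ.NonZero c}} →
        z ℤ.* + c ℤ.≤ w ℤ.* + b → z / b ≤ w / c
  /-≤ z b@(suc b′) w c@(suc c′) h = toℚᵘ-cancel-≤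
    (ℚᵘ.≤-respˡ-≃ (ℚᵘ.≃-sym (toℚᵘ-fromℚᵘ (ℚᵘ.mkℚᵘ z b′)))
    (ℚᵘ.≤-respʳ-≃ (ℚᵘ.≃-sym (toℚᵘ-fromℚᵘ (ℚᵘ.mkℚᵘ w c′)))
    (ℚᵘ.*≤* h)))

  ≤⇒/1≤ : ∀ {m n} → m ℕ.≤ n → + m / 1 ≤ + n / 1
  ≤⇒/1≤ {m} {n} h = /-≤ (+ m) 1 (+ n) 1 (ℤ.*-monoʳ-≤-nonNeg (+ 1) (ℤ.+≤+ h))

  archimedean : ∀ p → ∃ λ J → p ≤ + J / 1
  archimedean p@(mkℚ n d-1 c) = ℤ.∣ n ∣ , subst (_≤ + ℤ.∣ n ∣ / 1) (↥p/↧p≡p p)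
    (/-≤ n (suc d-1) (+ ℤ.∣ n ∣) 1 (go n))
    where
    go : ∀ n → n ℤ.* + 1 ℤ.≤ + ℤ.∣ n ∣ ℤ.* + suc d-1
    go (+ m) rewrite ℤ.*-identityʳ (+ m) | sym (ℤ.pos-* m (suc d-1)) =
      ℤ.+≤+ (ℕ.m≤m*n m (suc d-1))
    go (ℤ.-[1+ m ]) = ℤ.-≤+

  suc/ : ∀ q j → + suc q / suc j ≡ + q / suc j + + 1 / suc j
  suc/ q j = sym (toℚᵘ-injective (ℚᵘ.≃-trans (toℚᵘ-homo-+ (+ q / suc j) (+ 1 / suc j))
    (ℚᵘ.≃-trans (ℚᵘ.+-cong (toℚᵘ-fromℚᵘ (ℚᵘ.mkℚᵘ (+ q) j))
                           (toℚᵘ-fromℚᵘ (ℚᵘ.mkℚᵘ (+ 1) j)))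
    (ℚᵘ.≃-trans (ℚᵘ.*≡* eq)
      (ℚᵘ.≃-sym (toℚᵘ-fromℚᵘ (ℚᵘ.mkℚᵘ (+ suc q) j)))))))
    where
    J = + suc j
    eq : (+ q ℤ.* J ℤ.+ + 1 ℤ.* J) ℤ.* J ≡ + suc q ℤ.* (+ (suc j ℕ.* suc j))
    eq = trans (cong (ℤ._* J) (trans (sym (ℤ.*-distribʳ-+ J (+ q) (+ 1)))
           (cong (λ z → + z ℤ.* J) (ℕ.+-comm q 1))))
         (trans (ℤ.*-assoc (+ suc q) J J)
           (cong (+ suc q ℤ.*_) (sym (ℤ.pos-* (suc j) (suc j)))))

  suc/1 : ∀ j → + suc j / 1 ≡ + j / 1 + 1ℚ
  suc/1 j = suc/ j 0

  suc/1-pos : ∀ j → 0ℚ < + suc j / 1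
  suc/1-pos j = positive⁻¹ _ {{normalize-pos (suc j) 1}}

  1/suc-nonneg : ∀ k → 0ℚ ≤ + 1 / suc k
  1/suc-nonneg k = nonNegative⁻¹ _ {{normalize-nonNeg 1 (suc k)}}

  1/suc*suc : ∀ k → + suc k / 1 * (+ 1 / suc k) ≡ 1ℚ
  1/suc*suc k = toℚᵘ-injective (ℚᵘ.≃-trans (toℚᵘ-homo-* (+ suc k / 1) (+ 1 / suc k))
    (ℚᵘ.≃-trans (ℚᵘ.*-cong (toℚᵘ-fromℚᵘ (ℚᵘ.mkℚᵘ (+ suc k) 0))
                           (toℚᵘ-fromℚᵘ (ℚᵘ.mkℚᵘ (+ 1) k)))
      (ℚᵘ.*≡* (trans (cong (ℤ._* + 1) (ℤ.*-identityʳ (+ suc k)))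
         (trans (ℤ.*-identityʳ (+ suc k))
           (sym (trans (ℤ.*-identityˡ _) (ℤ.*-identityˡ (+ suc k)))))))))

  0≤1 : 0ℚ ≤ 1ℚ
  0≤1 = nonNegative⁻¹ 1ℚ

  0<1 : 0ℚ < 1ℚ
  0<1 = positive⁻¹ 1ℚ

-- Real numbers are Cauchy sequences of rationals with a modulus, unquotiented:
-- x and y are the same real when x ≤ᴿ y and y ≤ᴿ x.

record ℝ : Set where
  constructor mkℝ
  field
    seq    : ℕ → ℚ
    cauchy : ∀ ε → 0ℚ < ε → ∃ λ N → ∀ i j → N ℕ.≤ i → N ℕ.≤ j →
             ∣ seq i - seq j ∣ ≤ ε
open ℝ public

infix  4 _≤ᴿ_ _<ᴿ_
infixl 6 _+ᴿ_ _-ᴿ_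
infixl 7 _*ᴿ_
infix  8 -ᴿ_
infixr 9 _^ᴿ_

_≤ᴿ_ : ℝ → ℝ → Set
x ≤ᴿ y = ∀ ε → 0ℚ < ε → ∃ λ N → ∀ i → N ℕ.≤ i → seq x i ≤ seq y i + ε

_<ᴿ_ : ℝ → ℝ → Set
x <ᴿ y = ∃ λ ε → 0ℚ < ε × ∃ λ N → ∀ i → N ℕ.≤ i → seq x i + ε ≤ seq y i

fromℚ : ℚ → ℝ
fromℚ q = mkℝ (λ _ → q) λ ε 0<ε → 0 , λ _ _ _ _ →
  ≤-trans (≤-reflexive (cong ∣_∣ (+-inverseʳ q))) (<⇒≤ 0<ε)

fromℕ : ℕ → ℝ
fromℕ n = fromℚ (+ n / 1)

_+ᴿ_ : ℝ → ℝ → ℝ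
x +ᴿ y = mkℝ (λ i → seq x i + seq y i) c
  where
  c : ∀ ε → 0ℚ < ε → ∃ λ N → ∀ i j → N ℕ.≤ i → N ℕ.≤ j →
      ∣ (seq x i + seq y i) - (seq x j + seq y j) ∣ ≤ ε
  c ε 0<ε = M ℕ.⊔ N , λ i j p q →
    let px = hx i j (ℕ.m⊔n≤o⇒m≤o M N p) (ℕ.m⊔n≤o⇒m≤o M N q)
        py = hy i j (ℕ.m⊔n≤o⇒n≤o M N p) (ℕ.m⊔n≤o⇒n≤o M N q)
    in begin
      ∣ (seq x i + seq y i) - (seq x j + seq y j) ∣
        ≡⟨ cong ∣_∣ (solve 4 (λ a b c d → (a :+ b) :- (c :+ d) := (a :- c) :+ (b :- d))
             refl (seq x i) (seq y i) (seq x j) (seq y j)) ⟩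
      ∣ (seq x i - seq x j) + (seq y i - seq y j) ∣
        ≤⟨ ∣p+q∣≤∣p∣+∣q∣ (seq x i - seq x j) (seq y i - seq y j) ⟩
      ∣ seq x i - seq x j ∣ + ∣ seq y i - seq y j ∣
        ≤⟨ +-mono-≤ px py ⟩
      ½ * ε + ½ * ε
        ≡⟨ half+half ε ⟩
      ε ∎
    where
    open ≤-Reasoning
    M  = proj₁ (cauchy x (½ * ε) (half 0<ε))
    hx = proj₂ (cauchy x (½ * ε) (half 0<ε))
    N  = proj₁ (cauchy y (½ * ε) (half 0<ε))
    hy = proj₂ (cauchy y (½ * ε) (half 0<ε))

-ᴿ_ : ℝ → ℝ
-ᴿ x = mkℝ (λ i → - seq x i) λ ε 0<ε → proj₁ (cauchy x ε 0<ε) , λ i j p q →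
  ≤-trans (≤-reflexive (trans
    (cong ∣_∣ (solve 2 (λ a b → (:- a) :- (:- b) := :- (a :- b)) refl (seq x i) (seq x j)))
    (∣-p∣≡∣p∣ (seq x i - seq x j))))
    (proj₂ (cauchy x ε 0<ε) i j p q)

_-ᴿ_ : ℝ → ℝ → ℝ
x -ᴿ y = x +ᴿ (-ᴿ y)

private
  eventuallyBounded : ∀ x → ∃ λ B → 0ℚ < B × ∃ λ N → ∀ i → N ℕ.≤ i → ∣ seq x i ∣ ≤ B
  eventuallyBounded x = 1ℚ + ∣ seq x N ∣ , +-mono-<-≤ 0<1 (0≤∣p∣ (seq x N)) , N , λ i p →
    begin
      ∣ seq x i ∣
        ≡⟨ cong ∣_∣ (solve 2 (λ a b → a := (a :- b) :+ b) refl (seq x i) (seq x N)) ⟩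
      ∣ (seq x i - seq x N) + seq x N ∣
        ≤⟨ ∣p+q∣≤∣p∣+∣q∣ (seq x i - seq x N) (seq x N) ⟩
      ∣ seq x i - seq x N ∣ + ∣ seq x N ∣
        ≤⟨ +-monoˡ-≤ ∣ seq x N ∣ (h i N p ℕ.≤-refl) ⟩
      1ℚ + ∣ seq x N ∣ ∎
    where
    open ≤-Reasoning
    N = proj₁ (cauchy x 1ℚ 0<1)
    h = proj₂ (cauchy x 1ℚ 0<1)

_*ᴿ_ : ℝ → ℝ → ℝ
x *ᴿ y = mkℝ (λ i → seq x i * seq y i) c
  where
  c : ∀ ε → 0ℚ < ε → ∃ λ N → ∀ i j → N ℕ.≤ i → N ℕ.≤ j →
      ∣ seq x i * seq y i - seq x j * seq y j ∣ ≤ ε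
  c ε 0<ε = go (eventuallyBounded x) (eventuallyBounded y)
    where
    open ≤-Reasoning
    go : (∃ λ A → 0ℚ < A × ∃ λ K → ∀ i → K ℕ.≤ i → ∣ seq x i ∣ ≤ A) →
         (∃ λ B → 0ℚ < B × ∃ λ L → ∀ i → L ℕ.≤ i → ∣ seq y i ∣ ≤ B) →
         ∃ λ N → ∀ i j → N ℕ.≤ i → N ℕ.≤ j →
         ∣ seq x i * seq y i - seq x j * seq y j ∣ ≤ ε
    go (A , 0<A , K , bx) (B , 0<B , L , by) = (K ℕ.⊔ L) ℕ.⊔ (M ℕ.⊔ N) , λ i j p q →
      let a  = seq x i ; b = seq y i ; a′ = seq x j ; b′ = seq y j
      in begin
        ∣ a * b - a′ * b′ ∣
          ≡⟨ cong ∣_∣ (solve 4 (λ a b c d →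
               a :* b :- c :* d := a :* (b :- d) :+ d :* (a :- c)) refl a b a′ b′) ⟩
        ∣ a * (b - b′) + b′ * (a - a′) ∣
          ≤⟨ ∣p+q∣≤∣p∣+∣q∣ (a * (b - b′)) (b′ * (a - a′)) ⟩
        ∣ a * (b - b′) ∣ + ∣ b′ * (a - a′) ∣
          ≡⟨ cong₂ _+_ (∣p*q∣≡∣p∣*∣q∣ a (b - b′)) (∣p*q∣≡∣p∣*∣q∣ b′ (a - a′)) ⟩
        ∣ a ∣ * ∣ b - b′ ∣ + ∣ b′ ∣ * ∣ a - a′ ∣
          ≤⟨ +-mono-≤
               (*-mono₂ (0≤∣p∣ a) (<⇒≤ 0<η) (bx i (ℕ.m⊔n≤o⇒m≤o K L (KL p)))
                 (hy i j (ℕ.m⊔n≤o⇒n≤o M N (MN p)) (ℕ.m⊔n≤o⇒n≤o M N (MN q))))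
               (*-mono₂ (0≤∣p∣ b′) (<⇒≤ 0<θ) (by j (ℕ.m⊔n≤o⇒n≤o K L (KL q)))
                 (hx i j (ℕ.m⊔n≤o⇒m≤o M N (MN p)) (ℕ.m⊔n≤o⇒m≤o M N (MN q)))) ⟩
        A * η + B * θ
          ≡⟨ cong₂ _+_ Aη Bθ ⟩
        ½ * ε + ½ * ε
          ≡⟨ half+half ε ⟩
        ε ∎
      where
      η-data = unscale A 0<A (½ * ε) (half 0<ε)
      θ-data = unscale B 0<B (½ * ε) (half 0<ε)
      η   = proj₁ η-data
      0<η = proj₁ (proj₂ η-data)
      Aη  = proj₂ (proj₂ η-data)
      θ   = proj₁ θ-data
      0<θ = proj₁ (proj₂ θ-data)
      Bθ  = proj₂ (proj₂ θ-data)
      M   = proj₁ (cauchy x θ 0<θ)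
      hx  = proj₂ (cauchy x θ 0<θ)
      N   = proj₁ (cauchy y η 0<η)
      hy  = proj₂ (cauchy y η 0<η)
      KL : ∀ {i} → (K ℕ.⊔ L) ℕ.⊔ (M ℕ.⊔ N) ℕ.≤ i → K ℕ.⊔ L ℕ.≤ i
      KL = ℕ.m⊔n≤o⇒m≤o (K ℕ.⊔ L) (M ℕ.⊔ N)
      MN : ∀ {i} → (K ℕ.⊔ L) ℕ.⊔ (M ℕ.⊔ N) ℕ.≤ i → M ℕ.⊔ N ℕ.≤ i
      MN = ℕ.m⊔n≤o⇒n≤o (K ℕ.⊔ L) (M ℕ.⊔ N)

_^ᴿ_ : ℝ → ℕ → ℝ
x ^ᴿ zero  = fromℕ 1
x ^ᴿ suc n = x *ᴿ x ^ᴿ n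

-- a ^ k / k !
expTerm : ℚ → ℕ → ℚ
expTerm a zero    = 1ℚ
expTerm a (suc k) = a * expTerm a k * (+ 1 / suc k)

-- the sum of a ^ k / k ! over 0 ≤ k ≤ n
expSum : ℚ → ℕ → ℚ
expSum a zero    = expTerm a zero
expSum a (suc n) = expSum a n + expTerm a (suc n)

private
  module _ (B : ℚ) (0≤B : 0ℚ ≤ B) where

    t T : ℕ → ℚ
    t = expTerm B
    T = expSum B

    t-nonneg : ∀ k → 0ℚ ≤ t k
    t-nonneg zero    = 0≤1
    t-nonneg (suc k) = 0≤* (0≤* 0≤B (t-nonneg k)) (1/suc-nonneg k)

    T-nonneg : ∀ n → 0ℚ ≤ T n
    T-nonneg zero    = 0≤1
    T-nonneg (suc n) = 0≤+ (T-nonneg n) (t-nonneg (suc n))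

    term-bound : ∀ a → ∣ a ∣ ≤ B → ∀ k → ∣ expTerm a k ∣ ≤ t k
    term-bound a h zero    = ≤-refl
    term-bound a h (suc k) = begin
      ∣ a * expTerm a k * r ∣      ≡⟨ ∣p*q∣≡∣p∣*∣q∣ (a * expTerm a k) r ⟩
      ∣ a * expTerm a k ∣ * ∣ r ∣  ≡⟨ cong₂ _*_ (∣p*q∣≡∣p∣*∣q∣ a (expTerm a k))
                                       (0≤p⇒∣p∣≡p (1/suc-nonneg k)) ⟩
      ∣ a ∣ * ∣ expTerm a k ∣ * r  ≤⟨ *-monoʳ-≤-nonNeg r {{nn (1/suc-nonneg k)}}
                                       (*-mono₂ (0≤∣p∣ a) (t-nonneg k) h (term-bound a h k)) ⟩
      B * t k * r ∎
      where
      open ≤-Reasoning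
      r = + 1 / suc k

    t-step : ∀ k → + suc k / 1 * t (suc k) ≡ B * t k
    t-step k = trans
      (solve 3 (λ s x r → s :* (x :* r) := (s :* r) :* x) refl
        (+ suc k / 1) (B * t k) (+ 1 / suc k))
      (trans (cong (_* (B * t k)) (1/suc*suc k)) (*-identityˡ (B * t k)))

    term-lipschitz : ∀ a b → ∣ a ∣ ≤ B → ∣ b ∣ ≤ B → ∀ k →
      ∣ expTerm a (suc k) - expTerm b (suc k) ∣ ≤ ∣ a - b ∣ * t k
    term-lipschitz a b ha hb zero = ≤-reflexive (trans
      (cong ∣_∣ (solve 2 (λ a b → a :* con 1ℚ :* con 1ℚ :- b :* con 1ℚ :* con 1ℚ := a :- b)
        refl a b))
      (sym (*-identityʳ ∣ a - b ∣)))
    term-lipschitz a b ha hb (suc k) = begin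
      ∣ a * u * r - b * v * r ∣
        ≡⟨ cong ∣_∣ (solve 5 (λ a b u v r →
             a :* u :* r :- b :* v :* r := ((a :- b) :* u :+ b :* (u :- v)) :* r)
             refl a b u v r) ⟩
      ∣ ((a - b) * u + b * (u - v)) * r ∣
        ≡⟨ ∣p*q∣≡∣p∣*∣q∣ ((a - b) * u + b * (u - v)) r ⟩
      ∣ (a - b) * u + b * (u - v) ∣ * ∣ r ∣
        ≡⟨ cong (∣ (a - b) * u + b * (u - v) ∣ *_) (0≤p⇒∣p∣≡p 0≤r) ⟩
      ∣ (a - b) * u + b * (u - v) ∣ * r
        ≤⟨ *-monoʳ-≤-nonNeg r {{nn 0≤r}} (∣p+q∣≤∣p∣+∣q∣ ((a - b) * u) (b * (u - v))) ⟩
      (∣ (a - b) * u ∣ + ∣ b * (u - v) ∣) * r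
        ≡⟨ cong (_* r) (cong₂ _+_ (∣p*q∣≡∣p∣*∣q∣ (a - b) u) (∣p*q∣≡∣p∣*∣q∣ b (u - v))) ⟩
      (D * ∣ u ∣ + ∣ b ∣ * ∣ u - v ∣) * r
        ≤⟨ *-monoʳ-≤-nonNeg r {{nn 0≤r}} (+-mono-≤
             (*-monoˡ-≤-nonNeg D {{nn 0≤D}} (term-bound a ha (suc k)))
             (*-mono₂ (0≤∣p∣ b) (0≤* 0≤D (t-nonneg k)) hb (term-lipschitz a b ha hb k))) ⟩
      (D * t (suc k) + B * (D * t k)) * r
        ≡⟨ solve 5 (λ D x B y r → (D :* x :+ B :* (D :* y)) :* r
             := D :* ((x :+ B :* y) :* r)) refl D (t (suc k)) B (t k) r ⟩
      D * ((t (suc k) + B * t k) * r)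
        ≡⟨ cong (λ z → D * ((t (suc k) + z) * r)) (sym (t-step k)) ⟩
      D * ((t (suc k) + s * t (suc k)) * r)
        ≡⟨ solve 4 (λ D x s r → D :* ((x :+ s :* x) :* r)
             := D :* (((s :+ con 1ℚ) :* r) :* x)) refl D (t (suc k)) s r ⟩
      D * (((s + 1ℚ) * r) * t (suc k))
        ≡⟨ cong (λ z → D * (z * t (suc k)))
             (trans (cong (_* r) (sym (suc/1 (suc k)))) (1/suc*suc (suc k))) ⟩
      D * (1ℚ * t (suc k))
        ≡⟨ cong (D *_) (*-identityˡ (t (suc k))) ⟩
      D * t (suc k) ∎
      where
      open ≤-Reasoning
      u = expTerm a (suc k)
      v = expTerm b (suc k)
      r = + 1 / suc (suc k)
      s = + suc k / 1
      D = ∣ a - b ∣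
      0≤r = 1/suc-nonneg (suc k)
      0≤D = 0≤∣p∣ (a - b)

    ∣sum-diff∣ : ∀ a b c d → ∣ (a + b) - (c + d) ∣ ≤ ∣ a - c ∣ + ∣ b - d ∣
    ∣sum-diff∣ a b c d = ≤-trans (≤-reflexive (cong ∣_∣
      (solve 4 (λ a b c d → (a :+ b) :- (c :+ d) := (a :- c) :+ (b :- d)) refl a b c d)))
      (∣p+q∣≤∣p∣+∣q∣ (a - c) (b - d))

    sum-lipschitz′ : ∀ a b → ∣ a ∣ ≤ B → ∣ b ∣ ≤ B → ∀ n →
      ∣ expSum a (suc n) - expSum b (suc n) ∣ ≤ ∣ a - b ∣ * T n
    sum-lipschitz′ a b ha hb zero = ≤-trans
      (≤-reflexive (cong ∣_∣ (solve 2 (λ u v → (con 1ℚ :+ u) :- (con 1ℚ :+ v) := u :- v)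
        refl (expTerm a 1) (expTerm b 1))))
      (term-lipschitz a b ha hb zero)
    sum-lipschitz′ a b ha hb (suc n) = ≤-trans
      (∣sum-diff∣ (expSum a (suc n)) (expTerm a (suc (suc n)))
                  (expSum b (suc n)) (expTerm b (suc (suc n))))
      (≤-trans (+-mono-≤ (sum-lipschitz′ a b ha hb n) (term-lipschitz a b ha hb (suc n)))
        (≤-reflexive (sym (*-distribˡ-+ ∣ a - b ∣ (T n) (t (suc n))))))

    sum-lipschitz : ∀ a b → ∣ a ∣ ≤ B → ∣ b ∣ ≤ B → ∀ n →
      ∣ expSum a n - expSum b n ∣ ≤ ∣ a - b ∣ * T n
    sum-lipschitz a b ha hb zero    = 0≤* (0≤∣p∣ (a - b)) 0≤1
    sum-lipschitz a b ha hb (suc n) = ≤-trans (sum-lipschitz′ a b ha hb n)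
      (*-monoˡ-≤-nonNeg ∣ a - b ∣ {{nn (0≤∣p∣ (a - b))}}
        (subst (_≤ T (suc n)) (+-identityʳ (T n)) (+-monoʳ-≤ (T n) (t-nonneg (suc n)))))

    sum-tail : ∀ a → ∣ a ∣ ≤ B → ∀ n j →
      ∣ expSum a (j ℕ.+ n) - expSum a n ∣ ≤ T (j ℕ.+ n) - T n
    sum-tail a h n zero = ≤-reflexive (trans (cong ∣_∣ (+-inverseʳ (expSum a n)))
      (sym (+-inverseʳ (T n))))
    sum-tail a h n (suc j) = begin
      ∣ (E + e) - E′ ∣             ≡⟨ cong ∣_∣ (solve 3 (λ x y z → (x :+ y) :- z
                                        := (x :- z) :+ y) refl E e E′) ⟩
      ∣ (E - E′) + e ∣             ≤⟨ ∣p+q∣≤∣p∣+∣q∣ (E - E′) e ⟩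
      ∣ E - E′ ∣ + ∣ e ∣           ≤⟨ +-mono-≤ (sum-tail a h n j)
                                        (term-bound a h (suc (j ℕ.+ n))) ⟩
      (T (j ℕ.+ n) - T n) + t (suc (j ℕ.+ n))
                                   ≡⟨ solve 3 (λ x y z → (x :- z) :+ y := (x :+ y) :- z)
                                        refl (T (j ℕ.+ n)) (t (suc (j ℕ.+ n))) (T n) ⟩
      T (suc j ℕ.+ n) - T n ∎
      where
      open ≤-Reasoning
      E  = expSum a (j ℕ.+ n)
      e  = expTerm a (suc (j ℕ.+ n))
      E′ = expSum a n

    module _ (K : ℕ) (hK : B ≤ ½ * (+ K / 1)) where

      t-halves : ∀ k → K ℕ.≤ k → t (suc k) ≤ ½ * t k
      t-halves k K≤k = *-cancelˡ-≤-pos (+ suc k / 1) {{positive (suc/1-pos k)}} (begin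
        + suc k / 1 * t (suc k)    ≡⟨ t-step k ⟩
        B * t k                    ≤⟨ *-monoʳ-≤-nonNeg (t k) {{nn (t-nonneg k)}} B≤ ⟩
        ½ * (+ suc k / 1) * t k    ≡⟨ solve 3 (λ h s x → h :* s :* x := s :* (h :* x))
                                       refl ½ (+ suc k / 1) (t k) ⟩
        + suc k / 1 * (½ * t k) ∎)
        where
        open ≤-Reasoning
        B≤ : B ≤ ½ * (+ suc k / 1)
        B≤ = ≤-trans hK (*-monoˡ-≤-nonNeg ½ (≤⇒/1≤ (ℕ.m≤n⇒m≤1+n K≤k)))

      T+t-step : ∀ k → K ℕ.≤ k → T (suc k) + t (suc k) ≤ T k + t k
      T+t-step k K≤k = begin
        (T k + t (suc k)) + t (suc k)  ≡⟨ +-assoc (T k) (t (suc k)) (t (suc k)) ⟩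
        T k + (t (suc k) + t (suc k))  ≤⟨ +-monoʳ-≤ (T k)
                                          (+-mono-≤ (t-halves k K≤k) (t-halves k K≤k)) ⟩
        T k + (½ * t k + ½ * t k)      ≡⟨ cong (λ z → T k + z) (half+half (t k)) ⟩
        T k + t k ∎
        where open ≤-Reasoning

      T+t-anti : ∀ k j → K ℕ.≤ k → T (j ℕ.+ k) + t (j ℕ.+ k) ≤ T k + t k
      T+t-anti k zero    K≤k = ≤-refl
      T+t-anti k (suc j) K≤k = ≤-trans
        (T+t-step (j ℕ.+ k) (ℕ.≤-trans K≤k (ℕ.m≤n+m k j))) (T+t-anti k j K≤k)

      T≤T+t : ∀ k j → K ℕ.≤ k → T (j ℕ.+ k) ≤ T k + t k
      T≤T+t k j K≤k = ≤-trans
        (subst (_≤ T (j ℕ.+ k) + t (j ℕ.+ k)) (+-identityʳ (T (j ℕ.+ k)))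
          (+-monoʳ-≤ (T (j ℕ.+ k)) (t-nonneg (j ℕ.+ k))))
        (T+t-anti k j K≤k)

      sum-tail-bound : ∀ a → ∣ a ∣ ≤ B → ∀ n j → K ℕ.≤ n →
        ∣ expSum a (j ℕ.+ n) - expSum a n ∣ ≤ t n
      sum-tail-bound a h n j K≤n = ≤-trans (sum-tail a h n j)
        (≤-trans (+-monoˡ-≤ (- T n) (T≤T+t n j K≤n))
          (≤-reflexive (solve 2 (λ x y → (x :+ y) :- x := y) refl (T n) (t n))))

      t-decay : ∀ j → + suc j / 1 * t (j ℕ.+ K) ≤ t K
      t-decay zero    = ≤-reflexive (*-identityˡ (t K))
      t-decay (suc j) = begin
        + suc (suc j) / 1 * t (suc (j ℕ.+ K))
          ≤⟨ *-monoˡ-≤-nonNeg (+ suc (suc j) / 1) {{nn (<⇒≤ (suc/1-pos (suc j)))}}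
               (t-halves (j ℕ.+ K) (ℕ.m≤n+m K j)) ⟩
        + suc (suc j) / 1 * (½ * t (j ℕ.+ K))
          ≡⟨ sym (*-assoc (+ suc (suc j) / 1) ½ (t (j ℕ.+ K))) ⟩
        + suc (suc j) / 1 * ½ * t (j ℕ.+ K)
          ≤⟨ *-monoʳ-≤-nonNeg (t (j ℕ.+ K)) {{nn (t-nonneg (j ℕ.+ K))}} step ⟩
        + suc j / 1 * t (j ℕ.+ K)
          ≤⟨ t-decay j ⟩
        t K ∎
        where
        open ≤-Reasoning
        s = + suc j / 1
        1≤s : 1ℚ ≤ s
        1≤s = ≤⇒/1≤ {1} {suc j} (s≤s z≤n)
        step : + suc (suc j) / 1 * ½ ≤ s
        step = begin
          + suc (suc j) / 1 * ½  ≡⟨ cong (_* ½) (suc/1 (suc j)) ⟩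
          (s + 1ℚ) * ½           ≤⟨ *-monoʳ-≤-nonNeg ½ (+-monoʳ-≤ s 1≤s) ⟩
          (s + s) * ½            ≡⟨ solve 1 (λ s → (s :+ s) :* con ½ := s) refl s ⟩
          s ∎

      t-small : ∀ ε → 0ℚ < ε → ∃ λ N → ∀ n → N ℕ.≤ n → t n ≤ ε
      t-small ε 0<ε = J ℕ.+ K , λ n le →
        subst (λ m → t m ≤ ε) (trans (ℕ.+-comm (n ℕ.∸ K) K)
            (ℕ.m+[n∸m]≡n (ℕ.≤-trans (ℕ.m≤n+m K J) le)))
          (go (n ℕ.∸ K) (subst (ℕ._≤ n ℕ.∸ K) (ℕ.m+n∸n≡m J K) (ℕ.∸-monoˡ-≤ K le)))
        where
        open ≤-Reasoning
        q-data = unscale ε 0<ε (1ℚ + t K) (+-mono-<-≤ 0<1 (t-nonneg K))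
        q   = proj₁ q-data
        εq  = proj₂ (proj₂ q-data)
        J   = proj₁ (archimedean q)
        q≤J = proj₂ (archimedean q)
        go : ∀ j → J ℕ.≤ j → t (j ℕ.+ K) ≤ ε
        go j J≤j = *-cancelˡ-≤-pos (+ suc j / 1) {{positive (suc/1-pos j)}} (begin
          + suc j / 1 * t (j ℕ.+ K)  ≤⟨ t-decay j ⟩
          t K                        ≡⟨ sym (+-identityˡ (t K)) ⟩
          0ℚ + t K                   ≤⟨ +-monoˡ-≤ (t K) 0≤1 ⟩
          1ℚ + t K                   ≡⟨ sym εq ⟩
          ε * q                      ≤⟨ *-monoˡ-≤-nonNeg ε {{nn (<⇒≤ 0<ε)}}
                                          (≤-trans q≤J (≤⇒/1≤ (ℕ.m≤n⇒m≤1+n J≤j))) ⟩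
          ε * (+ suc j / 1)          ≡⟨ *-comm ε (+ suc j / 1) ⟩
          + suc j / 1 * ε ∎)

-- the limit of expSum (seq x i) i, which is the sum of the exponential series at x
exp : ℝ → ℝ
exp x = mkℝ (λ i → expSum (seq x i) i) c
  where
  c : ∀ ε → 0ℚ < ε → ∃ λ N → ∀ i j → N ℕ.≤ i → N ℕ.≤ j →
      ∣ expSum (seq x i) i - expSum (seq x j) j ∣ ≤ ε
  c ε 0<ε = result
    where
    open ≤-Reasoning
    bounded = eventuallyBounded x
    B   = proj₁ bounded
    0<B = proj₁ (proj₂ bounded)
    L   = proj₁ (proj₂ (proj₂ bounded))
    bx  = proj₂ (proj₂ (proj₂ bounded))
    K    = proj₁ (archimedean (B + B))
    2B≤K = proj₂ (archimedean (B + B))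
    0≤B = <⇒≤ 0<B
    hK : B ≤ ½ * (+ K / 1)
    hK = ≤-trans (≤-reflexive (solve 1 (λ b → b := con ½ :* (b :+ b)) refl B))
                 (*-monoˡ-≤-nonNeg ½ 2B≤K)
    C = 1ℚ + (expSum B K + expTerm B K)
    0≤TK = 0≤+ (T-nonneg B 0≤B K) (t-nonneg B 0≤B K)
    0<C : 0ℚ < C
    0<C = +-mono-<-≤ 0<1 0≤TK
    T≤C : ∀ n → K ℕ.≤ n → expSum B n ≤ C
    T≤C n K≤n = ≤-trans
      (subst (λ m → expSum B m ≤ expSum B K + expTerm B K)
        (trans (ℕ.+-comm (n ℕ.∸ K) K) (ℕ.m+[n∸m]≡n K≤n))
        (T≤T+t B 0≤B K hK K (n ℕ.∸ K) ℕ.≤-refl))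
      (subst (_≤ C) (+-identityˡ _) (+-monoˡ-≤ (expSum B K + expTerm B K) 0≤1))

    η-data = unscale C 0<C (½ * ε) (half 0<ε)
    η = proj₁ η-data
    0<η = proj₁ (proj₂ η-data)
    Cη = proj₂ (proj₂ η-data)
    M = proj₁ (cauchy x η 0<η)
    hx = proj₂ (cauchy x η 0<η)
    small = t-small B 0≤B K hK (½ * ε) (half 0<ε)
    P = proj₁ small
    N = (L ℕ.⊔ K) ℕ.⊔ (M ℕ.⊔ P)

    ordered : ∀ i j → i ℕ.≤ j → N ℕ.≤ i →
      ∣ expSum (seq x i) i - expSum (seq x j) j ∣ ≤ ε
    ordered i j i≤j N≤i = begin
      ∣ expSum a i - expSum b j ∣
        ≤⟨ ∣-∣-split (expSum a i) (expSum b i) (expSum b j) ⟩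
      ∣ expSum a i - expSum b i ∣ + ∣ expSum b i - expSum b j ∣
        ≤⟨ +-mono-≤ first second ⟩
      ½ * ε + ½ * ε
        ≡⟨ half+half ε ⟩
      ε ∎
      where
      a = seq x i
      b = seq x j
      LK≤i = ℕ.m⊔n≤o⇒m≤o (L ℕ.⊔ K) (M ℕ.⊔ P) N≤i
      MP≤i = ℕ.m⊔n≤o⇒n≤o (L ℕ.⊔ K) (M ℕ.⊔ P) N≤i
      L≤i = ℕ.m⊔n≤o⇒m≤o L K LK≤i
      K≤i = ℕ.m⊔n≤o⇒n≤o L K LK≤i
      M≤i = ℕ.m⊔n≤o⇒m≤o M P MP≤i
      P≤i = ℕ.m⊔n≤o⇒n≤o M P MP≤i
      ha = bx i L≤i
      hb = bx j (ℕ.≤-trans L≤i i≤j)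
      first : ∣ expSum a i - expSum b i ∣ ≤ ½ * ε
      first = begin
        ∣ expSum a i - expSum b i ∣  ≤⟨ sum-lipschitz B 0≤B a b ha hb i ⟩
        ∣ a - b ∣ * expSum B i       ≤⟨ *-mono₂ (0≤∣p∣ (a - b)) (<⇒≤ 0<C)
                                          (hx i j M≤i (ℕ.≤-trans M≤i i≤j)) (T≤C i K≤i) ⟩
        η * C                        ≡⟨ *-comm η C ⟩
        C * η                        ≡⟨ Cη ⟩
        ½ * ε ∎
      second : ∣ expSum b i - expSum b j ∣ ≤ ½ * ε
      second = begin
        ∣ expSum b i - expSum b j ∣  ≡⟨ ∣-∣-sym (expSum b i) (expSum b j) ⟩
        ∣ expSum b j - expSum b i ∣  ≡⟨ cong (λ m → ∣ expSum b m - expSum b i ∣)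
                                          (sym (trans (ℕ.+-comm (j ℕ.∸ i) i)
                                            (ℕ.m+[n∸m]≡n i≤j))) ⟩
        ∣ expSum b ((j ℕ.∸ i) ℕ.+ i) - expSum b i ∣
                                     ≤⟨ sum-tail-bound B 0≤B K hK b hb i (j ℕ.∸ i) K≤i ⟩
        expTerm B i                  ≤⟨ proj₂ small i P≤i ⟩
        ½ * ε ∎

    result : ∃ λ N → ∀ i j → N ℕ.≤ i → N ℕ.≤ j →
      ∣ expSum (seq x i) i - expSum (seq x j) j ∣ ≤ ε
    result = N , go
      where
      go : ∀ i j → N ℕ.≤ i → N ℕ.≤ j →
        ∣ expSum (seq x i) i - expSum (seq x j) j ∣ ≤ ε
      go i j p q = [ (λ i≤j → ordered i j i≤j p)
                   , (λ j≤i → ≤-trans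
                       (≤-reflexive (∣-∣-sym (expSum (seq x i) i) (expSum (seq x j) j)))
                       (ordered j i j≤i q)) ]′ (ℕ.≤-total i j)

-- isqrt n is ⌊ √ n ⌋, see isqrt-spec
isqrt : ℕ → ℕ
isqrt zero    = zero
isqrt (suc n) with suc (isqrt n) ℕ.* suc (isqrt n) ℕ.≤? suc n
... | yes _ = suc (isqrt n)
... | no  _ = isqrt n

isqrt-spec : ∀ n → isqrt n ℕ.* isqrt n ℕ.≤ n × n ℕ.< suc (isqrt n) ℕ.* suc (isqrt n)
isqrt-spec zero    = z≤n , s≤s z≤n
isqrt-spec (suc n) with suc (isqrt n) ℕ.* suc (isqrt n) ℕ.≤? suc n
... | yes h = h , ℕ.≤-<-trans (proj₂ (isqrt-spec n))
                    (ℕ.*-mono-< (ℕ.n<1+n (suc (isqrt n))) (ℕ.n<1+n (suc (isqrt n))))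
... | no ¬h = ℕ.m≤n⇒m≤1+n (proj₁ (isqrt-spec n)) , ℕ.≰⇒> ¬h

-- the largest multiple of 1 / (1 + i) that is at most √ a
sqrtApprox : ℕ → ℕ → ℚ
sqrtApprox a i = + isqrt (a ℕ.* (suc i ℕ.* suc i)) / suc i

private
  module _ (a : ℕ) where

    cross : ∀ i j → let p = isqrt (a ℕ.* (suc i ℕ.* suc i))
                        q = isqrt (a ℕ.* (suc j ℕ.* suc j)) in
            p ℕ.* suc j ℕ.≤ suc q ℕ.* suc i
    cross i j = ℕ.≮⇒≥ λ lt → ℕ.<-irrefl refl (begin-strict
      (p ℕ.* J) ℕ.* (p ℕ.* J)          ≡⟨ sq p J ⟩
      (p ℕ.* p) ℕ.* (J ℕ.* J)          ≤⟨ ℕ.*-monoˡ-≤ (J ℕ.* J)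
                                            (proj₁ (isqrt-spec (a ℕ.* (I ℕ.* I)))) ⟩
      (a ℕ.* (I ℕ.* I)) ℕ.* (J ℕ.* J)  ≡⟨ NS.solve 3 (λ a i j → (a NS.:* i) NS.:* j
                                            NS.:= (a NS.:* j) NS.:* i) refl
                                            a (I ℕ.* I) (J ℕ.* J) ⟩
      (a ℕ.* (J ℕ.* J)) ℕ.* (I ℕ.* I)  ≤⟨ ℕ.*-monoˡ-≤ (I ℕ.* I)
                                            (ℕ.<⇒≤ (proj₂ (isqrt-spec (a ℕ.* (J ℕ.* J))))) ⟩
      (Q ℕ.* Q) ℕ.* (I ℕ.* I)          ≡⟨ sym (sq Q I) ⟩
      (Q ℕ.* I) ℕ.* (Q ℕ.* I)          <⟨ ℕ.*-mono-< lt lt ⟩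
      (p ℕ.* J) ℕ.* (p ℕ.* J) ∎)
      where
      open ℕ.≤-Reasoning
      import Data.Nat.Solver as S
      module NS = S.+-*-Solver
      I = suc i
      J = suc j
      p = isqrt (a ℕ.* (I ℕ.* I))
      Q = suc (isqrt (a ℕ.* (J ℕ.* J)))
      sq : ∀ x y → (x ℕ.* y) ℕ.* (x ℕ.* y) ≡ (x ℕ.* x) ℕ.* (y ℕ.* y)
      sq = NS.solve 2 (λ x y → (x NS.:* y) NS.:* (x NS.:* y)
             NS.:= (x NS.:* x) NS.:* (y NS.:* y)) refl

    approx-≤ : ∀ i j → sqrtApprox a i ≤ sqrtApprox a j + + 1 / suc j
    approx-≤ i j = ≤-trans
      (/-≤ (+ p) (suc i) (+ suc q) (suc j)
        (subst₂≤ (ℤ.pos-* p (suc j)) (ℤ.pos-* (suc q) (suc i)) (ℤ.+≤+ (cross i j))))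
      (≤-reflexive (suc/ q j))
      where
      p = isqrt (a ℕ.* (suc i ℕ.* suc i))
      q = isqrt (a ℕ.* (suc j ℕ.* suc j))
      subst₂≤ : ∀ {x y z w} → x ≡ y → z ≡ w → x ℤ.≤ z → y ℤ.≤ w
      subst₂≤ refl refl h = h

    approx-close : ∀ i j ε → + 1 / suc i ≤ ε → + 1 / suc j ≤ ε →
      ∣ sqrtApprox a i - sqrtApprox a j ∣ ≤ ε
    approx-close i j ε hi hj = [ (λ i≤j → ≤-trans
        (≤-reflexive (trans (∣-∣-sym x y) (∣-∣-ordered i≤j)))
        (≤-trans (gap (approx-≤ j i)) hi))
      , (λ j≤i → ≤-trans (≤-reflexive (∣-∣-ordered j≤i))
        (≤-trans (gap (approx-≤ i j)) hj)) ]′ (≤-total x y)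
      where
      x = sqrtApprox a i
      y = sqrtApprox a j
      gap : ∀ {u v w} → u ≤ v + w → u - v ≤ w
      gap {u} {v} {w} h = ≤-trans (+-monoˡ-≤ (- v) h)
        (≤-reflexive (solve 2 (λ x y → (x :+ y) :- x := y) refl v w))

√ : ℕ → ℝ
√ a = mkℝ (sqrtApprox a) c
  where
  c : ∀ ε → 0ℚ < ε → ∃ λ N → ∀ i j → N ℕ.≤ i → N ℕ.≤ j →
      ∣ sqrtApprox a i - sqrtApprox a j ∣ ≤ ε
  c ε 0<ε = N , λ i j p r → approx-close a i j ε (small i p) (small j r)
    where
    open ≤-Reasoning
    q-data = unscale ε 0<ε 1ℚ 0<1
    q   = proj₁ q-data
    εq  = proj₂ (proj₂ q-data)
    N   = proj₁ (archimedean q)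
    q≤N = proj₂ (archimedean q)
    small : ∀ i → N ℕ.≤ i → + 1 / suc i ≤ ε
    small i N≤i = *-cancelˡ-≤-pos (+ suc i / 1) {{positive (suc/1-pos i)}} (begin
      + suc i / 1 * (+ 1 / suc i)  ≡⟨ 1/suc*suc i ⟩
      1ℚ                           ≡⟨ sym εq ⟩
      ε * q                        ≤⟨ *-monoˡ-≤-nonNeg ε {{nn (<⇒≤ 0<ε)}}
                                        (≤-trans q≤N (≤⇒/1≤ (ℕ.m≤n⇒m≤1+n N≤i))) ⟩
      ε * (+ suc i / 1)            ≡⟨ *-comm ε (+ suc i / 1) ⟩
      + suc i / 1 * ε ∎)

Bits : ℕ → Set
Bits = Vec Bool

cube : ∀ n → List (Bits n)
cube zero    = [] ∷ []
cube (suc n) = map (false ∷_) (cube n) ++ map (true ∷_) (cube n)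

Σ[_] : ∀ {n} → (Bits n → ℚ) → ℚ
Σ[_] {n} g = foldr _+_ 0ℚ (map g (cube n))

-- a distribution is given by its probability mass function
Dist : ℕ → Set
Dist n = Bits n → ℚ

-- 1 / c, with the value 0 at c = 0, which uniformOn meets only for an empty event
recip : ℕ → ℚ
recip zero    = 0ℚ
recip (suc c) = + 1 / suc c

uniformOn : ∀ {n ℓ} {P : Pred (Bits n) ℓ} → Decidable P → Dist n
uniformOn {n} P? y = if does (P? y) then recip (length (filter P? (cube n))) else 0ℚ

𝒰 : ∀ m → Dist m
𝒰 m = uniformOn U?

weight : ∀ {n} → Bits n → ℕ
weight = Vec.count (Bool._≟ true)

𝒟 : ∀ n → ℕ → Dist n
𝒟 n k = uniformOn {n} (λ x → weight x ℕ.≟ k)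

_≟ᵇ_ : ∀ {n} → DecidableEquality (Bits n)
_≟ᵇ_ = Vec.≡-dec Bool._≟_

-- the distribution of f x for x drawn from P
pushforward : ∀ {m n} → (Bits m → Bits n) → Dist m → Dist n
pushforward f P y = Σ[ (λ x → if does (f x ≟ᵇ y) then P x else 0ℚ) ]

tv : ∀ {n} → Dist n → Dist n → ℚ
tv P Q = ½ * Σ[ (λ y → ∣ P y - Q y ∣) ]

IsLocal : ∀ {m n} → ℕ → (Bits m → Bits n) → Set
IsLocal {m} {n} d f = (i : Fin n) → ∃ λ (I : Subset m) →
  Subset.∣ I ∣ ℕ.≤ d ×
  (∀ x y → (∀ j → j Subset.∈ I → lookup x j ≡ lookup y j) →
    lookup (f x) i ≡ lookup (f y) i)

_/2^_ : ℤ → ℕ → ℚ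
z /2^ t = (z / (2 ℕ.^ t)) {{ℕ.m^n≢0 2 t}}

distTo : ℚ → ℕ → ℤ → ℚ
distTo γ t z = ∣ γ - z /2^ t ∣

-- The nearest multiple is one of the two around γ; err-attained and err-least
-- show that this is the minimum over all integers z.
err : ℚ → ℕ → ℚ
err γ t = distTo γ t s ⊓ distTo γ t (ℤ.suc s)
  where s = floor (γ * (+ (2 ℕ.^ t) / 1))

err-attained : ∀ γ t → ∃ λ z → err γ t ≡ distTo γ t z
err-attained γ t = [ (λ e → s , e) , (λ e → ℤ.suc s , e) ]′
  (⊓-sel (distTo γ t s) (distTo γ t (ℤ.suc s)))
  where s = floor (γ * (+ (2 ℕ.^ t) / 1))

private
  floor-≤ : ∀ p → floor p / 1 ≤ p
  floor-≤ p@(mkℚ n d-1 c) = subst (floor p / 1 ≤_) (↥p/↧p≡p p)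
    (/-≤ (floor p) 1 n (suc d-1)
      (ℤ.≤-trans (ℤ.[n/d]*d≤n n (+ suc d-1)) (ℤ.≤-reflexive (sym (ℤ.*-identityʳ n)))))

  ≤-suc-floor : ∀ p → p ≤ ℤ.suc (floor p) / 1
  ≤-suc-floor p@(mkℚ n d-1 c) = subst (_≤ ℤ.suc (floor p) / 1) (↥p/↧p≡p p)
    (/-≤ n (suc d-1) (ℤ.suc (floor p)) 1
      (ℤ.≤-trans (ℤ.≤-reflexive (ℤ.*-identityʳ n))
        (ℤ.<⇒≤ (subst (λ q → n ℤ.< ℤ.suc q ℤ.* + suc d-1)
          (sym (ℤ.div-pos-is-/ℕ n (suc d-1))) (ℤ.n<s[n/ℕd]*d n (suc d-1))))))

  /c*c : ∀ z c .{{_ : ℕ.NonZero c}} → (z / c) * (+ c / 1) ≡ z / 1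
  /c*c z c@(suc c′) = toℚᵘ-injective (ℚᵘ.≃-trans (toℚᵘ-homo-* (z / c) (+ c / 1))
    (ℚᵘ.≃-trans (ℚᵘ.*-cong (toℚᵘ-fromℚᵘ (ℚᵘ.mkℚᵘ z c′))
                           (toℚᵘ-fromℚᵘ (ℚᵘ.mkℚᵘ (+ c) 0)))
    (ℚᵘ.≃-trans (ℚᵘ.*≡* (trans (ℤ.*-identityʳ (z ℤ.* + c))
        (cong (λ w → z ℤ.* + w) (sym (ℕ.*-identityʳ c)))))
      (ℚᵘ.≃-sym (toℚᵘ-fromℚᵘ (ℚᵘ.mkℚᵘ z 0))))))

err-least : ∀ γ t z → err γ t ≤ distTo γ t z
err-least γ t z = [ below , above ]′ (ℤ.≤-total z s)
  where
  c = 2 ℕ.^ t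
  instance
    c≢0 : ℕ.NonZero c
    c≢0 = ℕ.m^n≢0 2 t
  p = γ * (+ c / 1)
  s = floor p
  c>0 : Positive (+ c / 1)
  c>0 = normalize-pos c 1
  mono : ∀ {z w} → z ℤ.≤ w → z /2^ t ≤ w /2^ t
  mono {z} {w} h = /-≤ z c w c (ℤ.*-monoʳ-≤-nonNeg (+ c) h)
  s≤γ : s /2^ t ≤ γ
  s≤γ = *-cancelʳ-≤-pos (+ c / 1) {{c>0}}
    (≤-trans (≤-reflexive (/c*c s c)) (floor-≤ p))
  γ≤s+1 : γ ≤ ℤ.suc s /2^ t
  γ≤s+1 = *-cancelʳ-≤-pos (+ c / 1) {{c>0}}
    (≤-trans (≤-suc-floor p) (≤-reflexive (sym (/c*c (ℤ.suc s) c))))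
  antitone : ∀ {u v} → u ≤ v → - v ≤ - u
  antitone = neg-antimono-≤
  farther : ∀ {u v} → u ≤ v → v ≤ γ → ∣ γ - v ∣ ≤ ∣ γ - u ∣
  farther {u} {v} u≤v v≤γ = ≤-trans (≤-reflexive (∣-∣-ordered v≤γ))
    (≤-trans (+-monoʳ-≤ γ (antitone u≤v)) (p≤∣p∣ (γ - u)))
  farther′ : ∀ {u v} → γ ≤ u → u ≤ v → ∣ γ - u ∣ ≤ ∣ γ - v ∣
  farther′ {u} {v} γ≤u u≤v = ≤-trans
    (≤-reflexive (trans (∣-∣-sym γ u) (∣-∣-ordered γ≤u)))
    (≤-trans (+-monoˡ-≤ (- γ) u≤v)
      (≤-trans (p≤∣p∣ (v - γ)) (≤-reflexive (∣-∣-sym v γ))))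
  below : z ℤ.≤ s → err γ t ≤ distTo γ t z
  below z≤s = ≤-trans (p⊓q≤p (distTo γ t s) (distTo γ t (ℤ.suc s)))
    (farther (mono z≤s) s≤γ)
  above : s ℤ.≤ z → err γ t ≤ distTo γ t z
  above s≤z = [ (λ s<z → ≤-trans (p⊓q≤q (distTo γ t s) (distTo γ t (ℤ.suc s)))
                  (farther′ γ≤s+1 (mono s<z)))
              , (λ z≤s → below z≤s) ]′ (split (z ℤ.≤? s))
    where
    split : Dec (z ℤ.≤ s) → (ℤ.suc s ℤ.≤ z) ⊎ (z ℤ.≤ s)
    split (yes h) = inj₂ h
    split (no ¬h) = inj₁ (ℤ.i<j⇒suc[i]≤j (ℤ.≰⇒> ¬h))

module Submission where

-- Fix the inputs in a set S for which many outputs R read pairwise disjoint sets of the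
-- remaining inputs. Under every assignment to S the outputs in R are independent, and
-- their means are multiples of 2^-d, hence at distance at least e = err γ d from γ = k / n.
-- Under n independent bits of mean γ, whose law dominates 𝒟 n k / (n + 1) because k is the
-- mode of the binomial, they are independent of mean γ. A product test shows that two such
-- laws share mass at most β^|R| with β = 1 - e²/16, so the image of f and 𝒟 n k share at most
-- 2^|S| (n + 2) β^|R|. Greedy packing achieves |R| ≥ K (|S| + w), where β^K ≤ ½ and w is
-- about n e^(11 d), so this is at most (n + 2) 2^-w. As w is much larger than n δ^(40 d), the
-- number u = exp (- n δ^(40 d)) satisfies 2^-w ≤ 4 u², and (n + 2) 2^-w ≤ (4 √(2n) u)²,
-- which is enough since the claim is trivial if 4 √(2n) u ≥ 1.

open import Defs
import Algebra.Properties.Semiring.Exp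
open import Algebra.Bundles using (CommutativeRing)
open import Data.Bool.Base using (Bool; true; false; if_then_else_)
import Data.Bool.Properties as Bool
open import Data.Fin.Base using (Fin; zero; suc)
import Data.Fin.Properties as Fin
open import Data.Fin.Subset as Subset using (Subset; _∈_; _∉_; _∪_; _∩_; _─_; ⊥; ⁅_⁆; Nonempty; Empty)
import Data.Fin.Subset.Properties as Subset
import Data.Integer.Base as ℤ
open import Data.Integer.Base using (+_; -[1+_])
import Data.Integer.Properties as ℤ
open import Data.List.Base using (List; []; _∷_; _++_; map; foldr; filter; length; allFin)
import Data.List.Properties as List
open import Data.List.Membership.Propositional using (find) renaming (_∈_ to _∈ₗ_)
open import Data.List.Membership.Propositional.Properties using (∈-allFin)
open import Data.List.Relation.Unary.All as All using (All; []; _∷_)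
open import Data.List.Relation.Unary.All.Properties using (¬Any⇒All¬)
open import Data.List.Relation.Unary.AllPairs as AllPairs using (AllPairs; []; _∷_)
open import Data.List.Relation.Unary.Any using (Any; here; there; any?)
open import Data.List.Relation.Unary.Unique.Propositional.Properties using (allFin⁺)
open import Data.Nat.Base as ℕ using (ℕ; zero; suc; z≤n; s≤s)
import Data.Nat.DivMod as ℕ
import Data.Nat.Properties as ℕ
import Data.Nat.Solver
open import Data.Product.Base using (∃; _×_; _,_; proj₁; proj₂)
open import Data.Rational.Base
open import Data.Rational.Properties
open import Data.Rational.Solver using (module +-*-Solver)
import Data.Rational.Unnormalised.Base as ℚᵘ
import Data.Rational.Unnormalised.Properties as ℚᵘ
open import Data.Sum.Base using (_⊎_; inj₁; inj₂)
open import Data.Vec.Base using ([]; _∷_; lookup; here; there)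
open import Data.Vec.Properties using (count≤n)
open import Function.Base using (_∘_)
open import Relation.Binary.Definitions using (Reflexive) renaming (Decidable to Decidable₂)
open import Relation.Binary.PropositionalEquality
  using (_≡_; refl; sym; trans; cong; cong₂; subst; subst₂; module ≡-Reasoning)
open import Relation.Nullary using (¬_; Dec; does; yes; no; _⊎-dec_)
open import Relation.Unary using (Pred; Decidable)
open import Relation.Unary.Properties using (U?)

open +-*-Solver using (solve; _:=_; _:+_; _:*_; :-_; _:-_; con)
open Algebra.Properties.Semiring.Exp (CommutativeRing.semiring +-*-commutativeRing)
  using (_^_; ^-homo-*; ^-assocʳ)

private module ℕ-Solver = Data.Nat.Solver.+-*-Solver

-- Packing outputs with disjoint supports

-- Conditioning turns the image of `f` into a mixture of 2^|S| laws, and bounding its overlap by the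
-- sum over the components costs that whole factor. It is not enough that R is large: |R| has to
-- beat |S| by the factor K, and this demand forces the exponential dependence on d. Locality enters
-- twice: it ends the search for R after at most d enlargements of S, and it makes every conditional
-- mean dyadic, whatever the assignment. The real number δ is at most e only up to arbitrarily small
-- errors, so its approximations are merely bounded by 2 e from some index on. The numerical part
-- therefore estimates (2 e)^(40 d), for which 2 e ≤ 2^-d leaves ample room. The partial sums of the
-- exponential are evaluated at these moving approximations, so they must be bounded below on a
-- whole interval at once. The case d = 0 has to be excluded: for a constant f with a value of
-- weight k = 1 the distance is 1 - 1 / n, whereas δ^0 = 1 would demand 1 - 4 √(2n) exp (- n), which
-- is false for large n.

∣p∪q∣≤∣p∣+∣q∣ : ∀ {m} (p q : Subset m) → Subset.∣ p ∪ q ∣ ℕ.≤ Subset.∣ p ∣ ℕ.+ Subset.∣ q ∣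
∣p∪q∣≤∣p∣+∣q∣ []          []          = z≤n
∣p∪q∣≤∣p∣+∣q∣ (false ∷ p) (false ∷ q) = ∣p∪q∣≤∣p∣+∣q∣ p q
∣p∪q∣≤∣p∣+∣q∣ (false ∷ p) (true ∷ q)  =
  ℕ.≤-trans (s≤s (∣p∪q∣≤∣p∣+∣q∣ p q)) (ℕ.≤-reflexive (sym (ℕ.+-suc Subset.∣ p ∣ Subset.∣ q ∣)))
∣p∪q∣≤∣p∣+∣q∣ (true ∷ p)  (false ∷ q) = s≤s (∣p∪q∣≤∣p∣+∣q∣ p q)
∣p∪q∣≤∣p∣+∣q∣ (true ∷ p)  (true ∷ q)  =
  s≤s (ℕ.≤-trans (∣p∪q∣≤∣p∣+∣q∣ p q) (ℕ.+-monoʳ-≤ Subset.∣ p ∣ (ℕ.n≤1+n Subset.∣ q ∣)))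

-- Greedy choice: an element is kept unless it conflicts with one already kept. A rejected element
-- is hit by the cause of its rejection, a kept one by itself, which is where reflexivity enters.
maximalFree : ∀ {a ℓ} {A : Set a} {C : A → A → Set ℓ} → Reflexive C → Decidable₂ C →
  (xs : List A) → ∃ λ R → AllPairs (λ x y → ¬ C x y) R × All (λ x → Any (C x) R) xs
maximalFree rfl C? []       = [] , [] , []
maximalFree rfl C? (x ∷ xs) with maximalFree rfl C? xs
... | R , free , hit with any? (C? x) R
...   | yes h = R , free , h ∷ hit
...   | no ¬h = x ∷ R , ¬Any⇒All¬ R ¬h ∷ free , here rfl ∷ All.map there hit

module _ {m n : ℕ} (I : Fin n → Subset m) where

  -- The clause `i ≡ r` matters when `I i ─ S` is empty. It keeps the relation reflexive, and it
  -- makes the outputs of a free family distinct, as independence under the product law of mean γ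
  -- requires.
  Meet : Subset m → Fin n → Fin n → Set
  Meet S i r = i ≡ r ⊎ Nonempty ((I i ─ S) ∩ (I r ─ S))

  meet? : ∀ S → Decidable₂ (Meet S)
  meet? S i r = (i Fin.≟ r) ⊎-dec Subset.nonempty? ((I i ─ S) ∩ (I r ─ S))

  ⋃ : List (Fin n) → Subset m
  ⋃ = foldr (λ r T → I r ∪ T) ⊥

  I⊆⋃ : ∀ {r R} → r ∈ₗ R → I r Subset.⊆ ⋃ R
  I⊆⋃ {R = r ∷ R} (here refl) h = Subset.x∈p∪q⁺ (inj₁ h)
  I⊆⋃ {R = r ∷ R} (there e)   h = Subset.x∈p∪q⁺ (inj₂ (I⊆⋃ e h))

  ∣⋃∣≤ : ∀ {d} → (∀ i → Subset.∣ I i ∣ ℕ.≤ d) → ∀ R → Subset.∣ ⋃ R ∣ ℕ.≤ length R ℕ.* d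
  ∣⋃∣≤ hd []      = ℕ.≤-reflexive (Subset.∣⊥∣≡0 m)
  ∣⋃∣≤ hd (r ∷ R) = ℕ.≤-trans (∣p∪q∣≤∣p∣+∣q∣ (I r) (⋃ R)) (ℕ.+-mono-≤ (hd r) (∣⋃∣≤ hd R))

  empty⇒∣∣≡0 : ∀ {p : Subset m} → Empty p → Subset.∣ p ∣ ≡ 0
  empty⇒∣∣≡0 e = trans (cong Subset.∣_∣ (Subset.Empty-unique e)) (Subset.∣⊥∣≡0 m)

  -- If `⋃ R` contains an input of `I i ─ S`, that input is now removed and the count drops.
  -- Otherwise `I i ─ S` must be empty, because the output of `R` that `i` meets would put one of
  -- its elements into `⋃ R`.
  shrink : ∀ {j} S R i → Any (Meet S i) R → Subset.∣ I i ─ S ∣ ℕ.≤ suc j →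
    Subset.∣ I i ─ (S ∪ ⋃ R) ∣ ℕ.≤ j
  shrink {j} S R i hit h rewrite sym (Subset.p─q─r≡p─q∪r (I i) S (⋃ R))
    with Subset.nonempty? ((I i ─ S) ∩ ⋃ R)
  ... | yes ne = ℕ.≤-pred (ℕ.≤-trans (Subset.p∩q≢∅⇒∣p─q∣<∣p∣ (I i ─ S) (⋃ R) ne) h)
  ... | no ¬ne = ℕ.≤-trans (Subset.∣p─q∣≤∣p∣ (I i ─ S) (⋃ R))
                   (ℕ.≤-trans (ℕ.≤-reflexive (empty⇒∣∣≡0 (isEmpty hit))) z≤n)
    where
    isEmpty : Any (Meet S i) R → Empty (I i ─ S)
    isEmpty hit (x , hx) with find hit
    ... | r , r∈R , inj₁ refl = ¬ne (x , Subset.x∈p∩q⁺ (hx ,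
            I⊆⋃ r∈R (Subset.p─q⊆p (I r) S hx)))
    ... | r , r∈R , inj₂ (y , hy) with Subset.x∈p∩q⁻ (I i ─ S) (I r ─ S) hy
    ...   | hi , hr = ¬ne (y , Subset.x∈p∩q⁺ (hi , I⊆⋃ r∈R (Subset.p─q⊆p (I r) S hr)))

  -- Fixing the inputs read by a maximal disjoint family of outputs lowers the
  -- width j of every output, so that only width many rounds can fail.
  packing : ∀ {d} K w → (∀ i → Subset.∣ I i ∣ ℕ.≤ d) →
    ∀ j S → (∀ i → Subset.∣ I i ─ S ∣ ℕ.≤ j) →
    K ℕ.* ((1 ℕ.+ d ℕ.* K) ℕ.^ j ℕ.* (Subset.∣ S ∣ ℕ.+ w)) ℕ.≤ n →
    ∃ λ S → ∃ λ R → AllPairs (λ i r → ¬ Meet S i r) R × K ℕ.* (Subset.∣ S ∣ ℕ.+ w) ℕ.≤ length R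
  -- At width 0 no output reads anything outside `S`, so all n outputs form a free family, and the
  -- remaining budget is exactly the size demanded of it.
  packing K w hd zero S hS hn = S , allFin n ,
    AllPairs.map (λ {i} {r} i≢r → λ { (inj₁ i≡r) → i≢r i≡r
                                    ; (inj₂ (x , hx)) → noElem i (proj₁ (Subset.x∈p∩q⁻ (I i ─ S) (I r ─ S) hx)) })
      (allFin⁺ n) ,
    subst₂ ℕ._≤_ (cong (K ℕ.*_) (ℕ.*-identityˡ (Subset.∣ S ∣ ℕ.+ w)))
      (sym (List.length-tabulate (λ (i : Fin n) → i))) hn
    where
    noElem : ∀ i {x} → ¬ x Subset.∈ I i ─ S
    noElem i {x} hx = ℕ.<-irrefl refl (ℕ.≤-trans (Subset.x∈p⇒∣p-x∣<∣p∣ hx) (ℕ.≤-trans (hS i) z≤n))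
  packing {d} K w hd (suc j) S hS hn
    with maximalFree {C = Meet S} (inj₁ refl) (meet? S) (allFin n)
  ... | R , free , hit with K ℕ.* (Subset.∣ S ∣ ℕ.+ w) ℕ.≤? length R
  ...   | yes big = S , R , free , big
  -- A failed round fixes at most K (|S| + w) d further inputs, so |S| + w grows at most by the
  -- factor 1 + d K, and one such factor of the budget is spent.
  ...   | no ¬big = packing K w hd j (S ∪ ⋃ R)
            (λ i → shrink S R i (All.lookup hit (∈-allFin i)) (hS i))
            (ℕ.≤-trans (ℕ.*-monoʳ-≤ K (ℕ.≤-trans (ℕ.*-monoʳ-≤ ((1 ℕ.+ d ℕ.* K) ℕ.^ j) grow)
              (ℕ.≤-reflexive (rearrange ((1 ℕ.+ d ℕ.* K) ℕ.^ j) (1 ℕ.+ d ℕ.* K) (Subset.∣ S ∣ ℕ.+ w))))) hn)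
    where
    rearrange : ∀ a b c → a ℕ.* (b ℕ.* c) ≡ b ℕ.* a ℕ.* c
    rearrange a b c = trans (sym (ℕ.*-assoc a b c)) (cong (ℕ._* c) (ℕ.*-comm a b))
    grow : Subset.∣ S ∪ ⋃ R ∣ ℕ.+ w ℕ.≤ (1 ℕ.+ d ℕ.* K) ℕ.* (Subset.∣ S ∣ ℕ.+ w)
    grow = begin
      Subset.∣ S ∪ ⋃ R ∣ ℕ.+ w
        ≤⟨ ℕ.+-monoˡ-≤ w (∣p∪q∣≤∣p∣+∣q∣ S (⋃ R)) ⟩
      Subset.∣ S ∣ ℕ.+ Subset.∣ ⋃ R ∣ ℕ.+ w
        ≤⟨ ℕ.+-monoˡ-≤ w (ℕ.+-monoʳ-≤ Subset.∣ S ∣ (ℕ.≤-trans (∣⋃∣≤ hd R)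
             (ℕ.*-monoˡ-≤ d (ℕ.<⇒≤ (ℕ.≰⇒> ¬big))))) ⟩
      Subset.∣ S ∣ ℕ.+ K ℕ.* (Subset.∣ S ∣ ℕ.+ w) ℕ.* d ℕ.+ w
        ≡⟨ ℕ-Solver.solve 4 (λ s k w d →
             s ℕ-Solver.:+ k ℕ-Solver.:* (s ℕ-Solver.:+ w) ℕ-Solver.:* d ℕ-Solver.:+ w ℕ-Solver.:=
             (ℕ-Solver.con 1 ℕ-Solver.:+ d ℕ-Solver.:* k) ℕ-Solver.:* (s ℕ-Solver.:+ w))
             refl Subset.∣ S ∣ K w d ⟩
      (1 ℕ.+ d ℕ.* K) ℕ.* (Subset.∣ S ∣ ℕ.+ w) ∎
      where open ℕ.≤-Reasoning

-- Order lemmas for ℚ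

0≤* : ∀ {a b} → 0ℚ ≤ a → 0ℚ ≤ b → 0ℚ ≤ a * b
0≤* {a} {b} p q = subst (_≤ a * b) (*-zeroʳ a) (*-monoˡ-≤-nonNeg a {{nonNegative p}} q)

*-mono-≤₀ : ∀ {a b c d} → 0ℚ ≤ a → 0ℚ ≤ d → a ≤ b → c ≤ d → a * c ≤ b * d
*-mono-≤₀ {a} {b} {c} {d} 0≤a 0≤d a≤b c≤d =
  ≤-trans (*-monoˡ-≤-nonNeg a {{nonNegative 0≤a}} c≤d) (*-monoʳ-≤-nonNeg d {{nonNegative 0≤d}} a≤b)

0≤1 : 0ℚ ≤ 1ℚ
0≤1 = nonNegative⁻¹ 1ℚ

0≤½ : 0ℚ ≤ ½
0≤½ = nonNegative⁻¹ ½

0≤+ : ∀ {a b} → 0ℚ ≤ a → 0ℚ ≤ b → 0ℚ ≤ a + b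
0≤+ p q = +-mono-≤ p q

p≤p+q : ∀ {p q} → 0ℚ ≤ q → p ≤ p + q
p≤p+q {p} {q} h = subst (_≤ p + q) (+-identityʳ p) (+-monoʳ-≤ p h)

p≤q+p : ∀ {p q} → 0ℚ ≤ q → p ≤ q + p
p≤q+p {p} {q} h = subst (_≤ q + p) (+-identityˡ p) (+-monoˡ-≤ p h)

0≤q-p⇒p≤q : ∀ {p q} → 0ℚ ≤ q - p → p ≤ q
0≤q-p⇒p≤q {p} {q} h = subst₂ _≤_ (+-identityˡ p)
  (solve 2 (λ p q → (q :- p) :+ p := q) refl p q) (+-monoˡ-≤ p h)

p≤q⇒0≤q-p : ∀ {p q} → p ≤ q → 0ℚ ≤ q - p
p≤q⇒0≤q-p {p} {q} h = subst (_≤ q - p) (+-inverseʳ p) (+-monoˡ-≤ (- p) h)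

p-q≤r⇒p≤r+q : ∀ {p q r} → p - q ≤ r → p ≤ r + q
p-q≤r⇒p≤r+q {p} {q} {r} h = subst (_≤ r + q) (solve 2 (λ p q → p :- q :+ q := p) refl p q) (+-monoˡ-≤ q h)

p≤r+q⇒p-q≤r : ∀ {p q r} → p ≤ r + q → p - q ≤ r
p≤r+q⇒p-q≤r {p} {q} {r} h = subst (p - q ≤_) (solve 2 (λ r q → r :+ q :- q := r) refl r q) (+-monoˡ-≤ (- q) h)

0≤p² : ∀ p → 0ℚ ≤ p * p
0≤p² p with ≤-total 0ℚ p
... | inj₁ 0≤p = 0≤* 0≤p 0≤p
... | inj₂ p≤0 = subst (0ℚ ≤_) (solve 1 (λ p → (:- p) :* (:- p) := p :* p) refl p)
                   (0≤* (neg-antimono-≤ p≤0) (neg-antimono-≤ p≤0))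

p≤∣p∣ : ∀ p → p ≤ ∣ p ∣
p≤∣p∣ p with ≤-total 0ℚ p
... | inj₁ 0≤p = ≤-reflexive (sym (0≤p⇒∣p∣≡p 0≤p))
... | inj₂ p≤0 = ≤-trans p≤0 (0≤∣p∣ p)

-p≤∣p∣ : ∀ p → - p ≤ ∣ p ∣
-p≤∣p∣ p = subst (- p ≤_) (∣-p∣≡∣p∣ p) (p≤∣p∣ (- p))

^-nonneg : ∀ {p} → 0ℚ ≤ p → ∀ n → 0ℚ ≤ p ^ n
^-nonneg h zero    = 0≤1
^-nonneg h (suc n) = 0≤* h (^-nonneg h n)

^-mono-≤ : ∀ {p q} → 0ℚ ≤ p → p ≤ q → ∀ n → p ^ n ≤ q ^ n
^-mono-≤ 0≤p p≤q zero    = ≤-refl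
^-mono-≤ 0≤p p≤q (suc n) =
  *-mono-≤₀ 0≤p (^-nonneg (≤-trans 0≤p p≤q) n) p≤q (^-mono-≤ 0≤p p≤q n)

1^n≡1 : ∀ n → 1ℚ ^ n ≡ 1ℚ
1^n≡1 zero    = refl
1^n≡1 (suc n) = trans (*-identityˡ (1ℚ ^ n)) (1^n≡1 n)

^-≤1 : ∀ {p} → 0ℚ ≤ p → p ≤ 1ℚ → ∀ n → p ^ n ≤ 1ℚ
^-≤1 {p} 0≤p p≤1 n = subst (p ^ n ≤_) (1^n≡1 n) (^-mono-≤ 0≤p p≤1 n)

^-anti-≤ : ∀ {p} → 0ℚ ≤ p → p ≤ 1ℚ → ∀ {m n} → m ℕ.≤ n → p ^ n ≤ p ^ m
^-anti-≤ 0≤p p≤1 {n = n} ℕ.z≤n = ^-≤1 0≤p p≤1 n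
^-anti-≤ {p} 0≤p p≤1 (ℕ.s≤s h) = *-monoˡ-≤-nonNeg p {{nonNegative 0≤p}} (^-anti-≤ 0≤p p≤1 h)

^-distrib-* : ∀ p q n → (p * q) ^ n ≡ p ^ n * q ^ n
^-distrib-* p q zero    = refl
^-distrib-* p q (suc n) = trans (cong (p * q *_) (^-distrib-* p q n))
  (solve 4 (λ p q x y → p :* q :* (x :* y) := p :* x :* (q :* y)) refl p q (p ^ n) (q ^ n))

-- Sums over the cube

foldr-++ : ∀ xs ys → foldr _+_ 0ℚ (xs ++ ys) ≡ foldr _+_ 0ℚ xs + foldr _+_ 0ℚ ys
foldr-++ []       ys = sym (+-identityˡ _)
foldr-++ (x ∷ xs) ys = trans (cong (λ z → x + z) (foldr-++ xs ys)) (sym (+-assoc x _ _))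

Σ-suc : ∀ {n} (g : Bits (suc n) → ℚ) →
  Σ[ g ] ≡ Σ[ g ∘ (false ∷_) ] + Σ[ g ∘ (true ∷_) ]
Σ-suc {n} g = begin
  foldr _+_ 0ℚ (map g (map (false ∷_) (cube n) ++ map (true ∷_) (cube n)))
    ≡⟨ cong (foldr _+_ 0ℚ) (List.map-++ g (map (false ∷_) (cube n)) (map (true ∷_) (cube n))) ⟩
  foldr _+_ 0ℚ (map g (map (false ∷_) (cube n)) ++ map g (map (true ∷_) (cube n)))
    ≡⟨ foldr-++ (map g (map (false ∷_) (cube n))) (map g (map (true ∷_) (cube n))) ⟩
  foldr _+_ 0ℚ (map g (map (false ∷_) (cube n))) + foldr _+_ 0ℚ (map g (map (true ∷_) (cube n)))
    ≡⟨ cong₂ (λ xs ys → foldr _+_ 0ℚ xs + foldr _+_ 0ℚ ys)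
         (sym (List.map-∘ (cube n))) (sym (List.map-∘ (cube n))) ⟩
  Σ[ g ∘ (false ∷_) ] + Σ[ g ∘ (true ∷_) ] ∎
  where open ≡-Reasoning

Σ-cong : ∀ {n} {g h : Bits n → ℚ} → (∀ x → g x ≡ h x) → Σ[ g ] ≡ Σ[ h ]
Σ-cong {n} e = cong (foldr _+_ 0ℚ) (List.map-cong e (cube n))

Σ-mono : ∀ {n} {g h : Bits n → ℚ} → (∀ x → g x ≤ h x) → Σ[ g ] ≤ Σ[ h ]
Σ-mono {n} {g} {h} le = go (cube n)
  where
  go : ∀ xs → foldr _+_ 0ℚ (map g xs) ≤ foldr _+_ 0ℚ (map h xs)
  go []       = ≤-refl
  go (x ∷ xs) = +-mono-≤ (le x) (go xs)

Σ-+ : ∀ {n} (g h : Bits n → ℚ) → Σ[ (λ x → g x + h x) ] ≡ Σ[ g ] + Σ[ h ]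
Σ-+ {n} g h = go (cube n)
  where
  go : ∀ xs → foldr _+_ 0ℚ (map (λ x → g x + h x) xs) ≡
              foldr _+_ 0ℚ (map g xs) + foldr _+_ 0ℚ (map h xs)
  go []       = refl
  go (x ∷ xs) = trans (cong (λ z → g x + h x + z) (go xs))
    (solve 4 (λ a b c d → a :+ b :+ (c :+ d) := a :+ c :+ (b :+ d)) refl (g x) (h x) _ _)

Σ-*ˡ : ∀ {n} c (g : Bits n → ℚ) → Σ[ (λ x → c * g x) ] ≡ c * Σ[ g ]
Σ-*ˡ {n} c g = go (cube n)
  where
  go : ∀ xs → foldr _+_ 0ℚ (map (λ x → c * g x) xs) ≡ c * foldr _+_ 0ℚ (map g xs)
  go []       = sym (*-zeroʳ c)
  go (x ∷ xs) = trans (cong (λ z → c * g x + z) (go xs)) (sym (*-distribˡ-+ c (g x) _))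

-- Expectation under n independent bits of mean `p`: `½` gives the uniform inputs, γ the product law
-- that dominates the slice. The mass function itself appears only in `𝔼-bernoulli`.
𝔼 : ∀ {n} → ℚ → (Bits n → ℚ) → ℚ
𝔼 {zero}  p g = g []
𝔼 {suc n} p g = p * 𝔼 p (g ∘ (true ∷_)) + (1ℚ - p) * 𝔼 p (g ∘ (false ∷_))

𝔼-cong : ∀ {n} p {g h : Bits n → ℚ} → (∀ x → g x ≡ h x) → 𝔼 p g ≡ 𝔼 p h
𝔼-cong {zero}  p e = e []
𝔼-cong {suc n} p e = cong₂ (λ a b → p * a + (1ℚ - p) * b)
  (𝔼-cong p (λ x → e (true ∷ x))) (𝔼-cong p (λ x → e (false ∷ x)))

𝔼-mono : ∀ {n p} → 0ℚ ≤ p → p ≤ 1ℚ → {g h : Bits n → ℚ} → (∀ x → g x ≤ h x) → 𝔼 p g ≤ 𝔼 p h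
𝔼-mono {zero}      0≤p p≤1 le = le []
𝔼-mono {suc n} {p} 0≤p p≤1 le = +-mono-≤
  (*-monoˡ-≤-nonNeg p {{nonNegative 0≤p}} (𝔼-mono 0≤p p≤1 (λ x → le (true ∷ x))))
  (*-monoˡ-≤-nonNeg (1ℚ - p) {{nonNegative (p≤q⇒0≤q-p p≤1)}}
    (𝔼-mono 0≤p p≤1 (λ x → le (false ∷ x))))

𝔼-+ : ∀ {n} p (g h : Bits n → ℚ) → 𝔼 p (λ x → g x + h x) ≡ 𝔼 p g + 𝔼 p h
𝔼-+ {zero}  p g h = refl
𝔼-+ {suc n} p g h = trans
  (cong₂ (λ a b → p * a + (1ℚ - p) * b)
    (𝔼-+ p (g ∘ (true ∷_)) (h ∘ (true ∷_))) (𝔼-+ p (g ∘ (false ∷_)) (h ∘ (false ∷_))))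
  (solve 5 (λ p a b c d → p :* (a :+ b) :+ (con 1ℚ :- p) :* (c :+ d) :=
      p :* a :+ (con 1ℚ :- p) :* c :+ (p :* b :+ (con 1ℚ :- p) :* d)) refl p _ _ _ _)

𝔼-*ˡ : ∀ {n} p c (g : Bits n → ℚ) → 𝔼 p (λ x → c * g x) ≡ c * 𝔼 p g
𝔼-*ˡ {zero}  p c g = refl
𝔼-*ˡ {suc n} p c g = trans
  (cong₂ (λ a b → p * a + (1ℚ - p) * b) (𝔼-*ˡ p c (g ∘ (true ∷_))) (𝔼-*ˡ p c (g ∘ (false ∷_))))
  (solve 4 (λ p c a b → p :* (c :* a) :+ (con 1ℚ :- p) :* (c :* b) :=
      c :* (p :* a :+ (con 1ℚ :- p) :* b)) refl p c _ _)

𝔼-const : ∀ {n} p c → 𝔼 {n} p (λ _ → c) ≡ c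
𝔼-const {zero}  p c = refl
𝔼-const {suc n} p c = trans
  (cong₂ (λ a b → p * a + (1ℚ - p) * b) (𝔼-const {n} p c) (𝔼-const {n} p c))
  (solve 2 (λ p c → p :* c :+ (con 1ℚ :- p) :* c := c) refl p c)

𝔼-Σ : ∀ {m n} p (G : Bits m → Bits n → ℚ) →
  Σ[ (λ y → 𝔼 p (λ x → G x y)) ] ≡ 𝔼 p (λ x → Σ[ G x ])
𝔼-Σ {zero}  p G = refl
𝔼-Σ {suc m} p G = begin
  Σ[ (λ y → p * 𝔼 p (λ x → G (true ∷ x) y) + (1ℚ - p) * 𝔼 p (λ x → G (false ∷ x) y)) ]
    ≡⟨ Σ-+ (λ y → p * 𝔼 p (λ x → G (true ∷ x) y)) (λ y → (1ℚ - p) * 𝔼 p (λ x → G (false ∷ x) y)) ⟩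
  Σ[ (λ y → p * 𝔼 p (λ x → G (true ∷ x) y)) ] + Σ[ (λ y → (1ℚ - p) * 𝔼 p (λ x → G (false ∷ x) y)) ]
    ≡⟨ cong₂ _+_ (Σ-*ˡ p (λ y → 𝔼 p (λ x → G (true ∷ x) y)))
                 (Σ-*ˡ (1ℚ - p) (λ y → 𝔼 p (λ x → G (false ∷ x) y))) ⟩
  p * Σ[ (λ y → 𝔼 p (λ x → G (true ∷ x) y)) ] + (1ℚ - p) * Σ[ (λ y → 𝔼 p (λ x → G (false ∷ x) y)) ]
    ≡⟨ cong₂ (λ a b → p * a + (1ℚ - p) * b)
         (𝔼-Σ p (λ x → G (true ∷ x))) (𝔼-Σ p (λ x → G (false ∷ x))) ⟩
  p * 𝔼 p (λ x → Σ[ G (true ∷ x) ]) + (1ℚ - p) * 𝔼 p (λ x → Σ[ G (false ∷ x) ]) ∎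
  where open ≡-Reasoning

-- Independence of functions of disjoint sets of bits

DependsOn : ∀ {m} {A : Set} → Subset m → (Bits m → A) → Set
DependsOn I g = ∀ x y → (∀ j → j ∈ I → lookup x j ≡ lookup y j) → g x ≡ g y

dependsOn-tail : ∀ {m} {A : Set} {b I} {g : Bits (suc m) → A} → DependsOn (b ∷ I) g →
  ∀ c → DependsOn I (g ∘ (c ∷_))
dependsOn-tail dep c x y e = dep (c ∷ x) (c ∷ y) λ where
  zero    _         → refl
  (suc j) (there h) → e j h

dependsOn-head : ∀ {m} {A : Set} {I} {g : Bits (suc m) → A} → DependsOn (false ∷ I) g →
  ∀ b c x → g (b ∷ x) ≡ g (c ∷ x)
dependsOn-head dep b c x = dep (b ∷ x) (c ∷ x) λ where
  (suc j) (there h) → refl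

-- As `h` ignores the leading bit, its conditional expectations given that bit coincide and factor
-- out of the average over it.
𝔼-indep-step : ∀ {m} p {g h : Bits (suc m) → ℚ} → (∀ x → h (false ∷ x) ≡ h (true ∷ x)) →
  (∀ b → 𝔼 p (λ x → g (b ∷ x) * h (b ∷ x)) ≡ 𝔼 p (g ∘ (b ∷_)) * 𝔼 p (h ∘ (b ∷_))) →
  𝔼 p (λ x → g x * h x) ≡ 𝔼 p g * 𝔼 p h
𝔼-indep-step p {g} {h} const ih = begin
  p * 𝔼 p (λ x → g (true ∷ x) * h (true ∷ x)) + (1ℚ - p) * 𝔼 p (λ x → g (false ∷ x) * h (false ∷ x))
    ≡⟨ cong₂ (λ a b → p * a + (1ℚ - p) * b) (ih true) (ih false) ⟩
  p * (𝔼 p (g ∘ (true ∷_)) * 𝔼 p (h ∘ (true ∷_))) +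
    (1ℚ - p) * (𝔼 p (g ∘ (false ∷_)) * 𝔼 p (h ∘ (false ∷_)))
    ≡⟨ cong (λ z → p * (𝔼 p (g ∘ (true ∷_)) * 𝔼 p (h ∘ (true ∷_))) +
         (1ℚ - p) * (𝔼 p (g ∘ (false ∷_)) * z)) eq ⟩
  p * (𝔼 p (g ∘ (true ∷_)) * 𝔼 p (h ∘ (true ∷_))) +
    (1ℚ - p) * (𝔼 p (g ∘ (false ∷_)) * 𝔼 p (h ∘ (true ∷_)))
    ≡⟨ solve 4 (λ p a b c → p :* (a :* c) :+ (con 1ℚ :- p) :* (b :* c) :=
         (p :* a :+ (con 1ℚ :- p) :* b) :* (p :* c :+ (con 1ℚ :- p) :* c)) refl p _ _ _ ⟩
  𝔼 p g * (p * 𝔼 p (h ∘ (true ∷_)) + (1ℚ - p) * 𝔼 p (h ∘ (true ∷_)))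
    ≡⟨ cong (λ z → 𝔼 p g * (p * 𝔼 p (h ∘ (true ∷_)) + (1ℚ - p) * z)) (sym eq) ⟩
  𝔼 p g * 𝔼 p h ∎
  where
  open ≡-Reasoning
  eq : 𝔼 p (h ∘ (false ∷_)) ≡ 𝔼 p (h ∘ (true ∷_))
  eq = 𝔼-cong p const

-- The leading bit lies in at most one of `I` and `J`, so one of the factors ignores it; the two are
-- exchanged if that factor is `g`.
𝔼-indep : ∀ {m} p {I J} {g h : Bits m → ℚ} → DependsOn I g → DependsOn J h →
  (∀ j → j ∈ I → j ∉ J) → 𝔼 p (λ x → g x * h x) ≡ 𝔼 p g * 𝔼 p h
𝔼-indep {zero}  p dg dh disj = refl
𝔼-indep {suc m} p {b ∷ I} {c ∷ J} {g} {h} dg dh disj = go b c dg dh (disj zero)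
  where
  ih : ∀ b → 𝔼 p (λ x → g (b ∷ x) * h (b ∷ x)) ≡ 𝔼 p (g ∘ (b ∷_)) * 𝔼 p (h ∘ (b ∷_))
  ih b = 𝔼-indep p (dependsOn-tail dg b) (dependsOn-tail dh b)
    λ j hi hj → disj (suc j) (there hi) (there hj)
  go : ∀ b c → DependsOn (b ∷ I) g → DependsOn (c ∷ J) h → (zero ∈ b ∷ I → zero ∉ c ∷ J) →
    𝔼 p (λ x → g x * h x) ≡ 𝔼 p g * 𝔼 p h
  go b     false dg dh _ = 𝔼-indep-step p {g} {h} (dependsOn-head dh false true) ih
  go false true  dg dh _ = trans (𝔼-cong p (λ x → *-comm (g x) (h x)))
    (trans (𝔼-indep-step p {h} {g} (dependsOn-head dg false true)
      (λ b → trans (𝔼-cong p (λ x → *-comm (h (b ∷ x)) (g (b ∷ x)))) (trans (ih b) (*-comm (𝔼 p (g ∘ (b ∷_))) (𝔼 p (h ∘ (b ∷_)))))))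
      (*-comm (𝔼 p h) (𝔼 p g)))
  go true  true  dg dh disj with () ← disj here here

-- Embedding of the integers

/1-+ : ∀ z w → (z ℤ.+ w) / 1 ≡ z / 1 + w / 1
/1-+ z w = sym (toℚᵘ-injective (ℚᵘ.≃-trans (toℚᵘ-homo-+ (z / 1) (w / 1))
  (ℚᵘ.≃-trans (ℚᵘ.+-cong (toℚᵘ-fromℚᵘ (ℚᵘ.mkℚᵘ z 0)) (toℚᵘ-fromℚᵘ (ℚᵘ.mkℚᵘ w 0)))
  (ℚᵘ.≃-trans (ℚᵘ.*≡* (cong (ℤ._* + 1) (cong₂ ℤ._+_ (ℤ.*-identityʳ z) (ℤ.*-identityʳ w))))
    (ℚᵘ.≃-sym (toℚᵘ-fromℚᵘ (ℚᵘ.mkℚᵘ (z ℤ.+ w) 0)))))))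

/-*-cancel : ∀ z c .{{_ : ℕ.NonZero c}} → (z / c) * (+ c / 1) ≡ z / 1
/-*-cancel z c@(suc c′) = toℚᵘ-injective (ℚᵘ.≃-trans (toℚᵘ-homo-* (z / c) (+ c / 1))
  (ℚᵘ.≃-trans (ℚᵘ.*-cong (toℚᵘ-fromℚᵘ (ℚᵘ.mkℚᵘ z c′)) (toℚᵘ-fromℚᵘ (ℚᵘ.mkℚᵘ (+ c) 0)))
  (ℚᵘ.≃-trans (ℚᵘ.*≡* (trans (ℤ.*-identityʳ (z ℤ.* + c))
      (cong (λ w → z ℤ.* + w) (sym (ℕ.*-identityʳ c)))))
    (ℚᵘ.≃-sym (toℚᵘ-fromℚᵘ (ℚᵘ.mkℚᵘ z 0))))))

ι : ℕ → ℚ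
ι n = + n / 1

ι-+ : ∀ m n → ι (m ℕ.+ n) ≡ ι m + ι n
ι-+ m n = /1-+ (+ m) (+ n)

ι-suc : ∀ n → ι (suc n) ≡ 1ℚ + ι n
ι-suc n = ι-+ 1 n

ι-* : ∀ m n → ι (m ℕ.* n) ≡ ι m * ι n
ι-* zero    n = sym (*-zeroˡ (ι n))
ι-* (suc m) n = trans (ι-+ n (m ℕ.* n)) (trans (cong (λ z → ι n + z) (ι-* m n))
  (trans (solve 2 (λ m n → n :+ m :* n := (con 1ℚ :+ m) :* n) refl (ι m) (ι n))
    (cong (_* ι n) (sym (ι-suc m)))))

ι-^ : ∀ m n → ι (m ℕ.^ n) ≡ ι m ^ n
ι-^ m zero    = refl
ι-^ m (suc n) = trans (ι-* m (m ℕ.^ n)) (cong (ι m *_) (ι-^ m n))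

ι-nonneg : ∀ n → 0ℚ ≤ ι n
ι-nonneg n = nonNegative⁻¹ _ {{normalize-nonNeg n 1}}

ι-pos : ∀ n .{{_ : ℕ.NonZero n}} → 0ℚ < ι n
ι-pos n = positive⁻¹ _ {{normalize-pos n 1}}

ι-mono : ∀ {m n} → m ℕ.≤ n → ι m ≤ ι n
ι-mono {m} {n} h = subst (λ k → ι m ≤ ι k) (ℕ.m+[n∸m]≡n h)
  (subst (ι m ≤_) (sym (ι-+ m (n ℕ.∸ m))) (p≤p+q (ι-nonneg (n ℕ.∸ m))))

-- Uniform distributions as expectations

⟦_⟧ : Bool → ℚ
⟦ b ⟧ = if b then 1ℚ else 0ℚ

0≤⟦_⟧ : ∀ b → 0ℚ ≤ ⟦ b ⟧
0≤⟦ true  ⟧ = 0≤1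
0≤⟦ false ⟧ = ≤-refl

⟦_⟧≤1 : ∀ b → ⟦ b ⟧ ≤ 1ℚ
⟦ true  ⟧≤1 = ≤-refl
⟦ false ⟧≤1 = 0≤1

if-* : ∀ b c → (if b then c else 0ℚ) ≡ c * ⟦ b ⟧
if-* true  c = sym (*-identityʳ c)
if-* false c = sym (*-zeroʳ c)

ι-count : ∀ {n ℓ} {P : Pred (Bits n) ℓ} (P? : Decidable P) →
  ι (length (filter P? (cube n))) ≡ Σ[ (λ y → ⟦ does (P? y) ⟧) ]
ι-count {n} P? = go (cube n)
  where
  go : ∀ xs → ι (length (filter P? xs)) ≡ foldr _+_ 0ℚ (map (λ y → ⟦ does (P? y) ⟧) xs)
  go []       = refl
  go (x ∷ xs) with P? x
  ... | yes _ = trans (ι-suc (length (filter P? xs))) (cong (λ z → 1ℚ + z) (go xs))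
  ... | no  _ = trans (go xs) (sym (+-identityˡ _))

recip-* : ∀ c q → ι c ≡ q → 0ℚ < q → recip c * q ≡ 1ℚ
recip-* zero    q e 0<q with () ← <-irrefl e 0<q
recip-* (suc c) q e _ = trans (cong (recip (suc c) *_) (sym e)) (/-*-cancel (+ 1) (suc c))

recip-nonneg : ∀ c → 0ℚ ≤ recip c
recip-nonneg zero    = ≤-refl
recip-nonneg (suc c) = nonNegative⁻¹ _ {{normalize-nonNeg 1 (suc c)}}

Σ-𝔼½ : ∀ {n} (g : Bits n → ℚ) → Σ[ g ] ≡ ι 2 ^ n * 𝔼 ½ g
Σ-𝔼½ {zero}  g = trans (+-identityʳ (g [])) (sym (*-identityˡ (g [])))
Σ-𝔼½ {suc n} g = trans (Σ-suc g) (trans (cong₂ _+_ (Σ-𝔼½ (g ∘ (false ∷_))) (Σ-𝔼½ (g ∘ (true ∷_))))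
  (solve 3 (λ t a b → t :* a :+ t :* b :=
      con (ι 2) :* t :* (con ½ :* b :+ (con 1ℚ :- con ½) :* a)) refl
    (ι 2 ^ n) (𝔼 ½ (g ∘ (false ∷_))) (𝔼 ½ (g ∘ (true ∷_)))))

2^n-pos : ∀ n → 0ℚ < ι 2 ^ n
2^n-pos n = subst (0ℚ <_) (ι-^ 2 n) (ι-pos (2 ℕ.^ n) {{ℕ.m^n≢0 2 n}})

uniformOn-total : ∀ {n ℓ} {P : Pred (Bits n) ℓ} (P? : Decidable P) →
  0ℚ < Σ[ (λ y → ⟦ does (P? y) ⟧) ] → Σ[ uniformOn P? ] ≡ 1ℚ
uniformOn-total {n} P? pos = trans (Σ-cong (λ y → if-* (does (P? y)) r))
  (trans (Σ-*ˡ r (λ y → ⟦ does (P? y) ⟧)) (recip-* (length (filter P? (cube n))) _ (ι-count P?) pos))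
  where r = recip (length (filter P? (cube n)))

pushforward-𝒰 : ∀ {m n} (f : Bits m → Bits n) y →
  pushforward f (𝒰 m) y ≡ 𝔼 ½ (λ x → ⟦ does (f x ≟ᵇ y) ⟧)
pushforward-𝒰 {m} f y = begin
  Σ[ (λ x → if does (f x ≟ᵇ y) then r else 0ℚ) ]   ≡⟨ Σ-cong (λ x → if-* (does (f x ≟ᵇ y)) r) ⟩
  Σ[ (λ x → r * g x) ]                             ≡⟨ Σ-*ˡ r g ⟩
  r * Σ[ g ]                                       ≡⟨ cong (r *_) (Σ-𝔼½ g) ⟩
  r * (ι 2 ^ m * 𝔼 ½ g)                            ≡⟨ sym (*-assoc r (ι 2 ^ m) (𝔼 ½ g)) ⟩
  r * ι 2 ^ m * 𝔼 ½ g                              ≡⟨ cong (_* 𝔼 ½ g) r*2^m ⟩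
  1ℚ * 𝔼 ½ g                                       ≡⟨ *-identityˡ (𝔼 ½ g) ⟩
  𝔼 ½ g ∎
  where
  open ≡-Reasoning
  r = recip (length (filter U? (cube m)))
  g : Bits m → ℚ
  g x = ⟦ does (f x ≟ᵇ y) ⟧
  r*2^m : r * ι 2 ^ m ≡ 1ℚ
  r*2^m = recip-* (length (filter U? (cube m))) _ (trans (ι-count {m} U?) (trans (Σ-𝔼½ {m} (λ _ → 1ℚ))
    (trans (cong (ι 2 ^ m *_) (𝔼-const {m} ½ 1ℚ)) (*-identityʳ (ι 2 ^ m))))) (2^n-pos m)

Σ-zero : ∀ {n} (g : Bits n → ℚ) → (∀ x → g x ≡ 0ℚ) → Σ[ g ] ≡ 0ℚ
Σ-zero {n} g e = trans (Σ-cong (λ x → trans (e x) (sym (*-zeroˡ 0ℚ)))) (trans (Σ-*ˡ {n} 0ℚ (λ _ → 0ℚ)) (*-zeroˡ (Σ[_] {n} (λ _ → 0ℚ))))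

Σ-point : ∀ {n} (a : Bits n) (φ : Bits n → ℚ) → Σ[ (λ y → ⟦ does (a ≟ᵇ y) ⟧ * φ y) ] ≡ φ a
Σ-point []          φ = trans (+-identityʳ _) (*-identityˡ (φ []))
Σ-point (true ∷ a)  φ = trans (Σ-suc (λ y → ⟦ does ((true ∷ a) ≟ᵇ y) ⟧ * φ y))
  (trans (cong₂ _+_ (Σ-zero _ (λ y → *-zeroˡ (φ (false ∷ y)))) (Σ-point a (φ ∘ (true ∷_))))
    (+-identityˡ _))
Σ-point (false ∷ a) φ = trans (Σ-suc (λ y → ⟦ does ((false ∷ a) ≟ᵇ y) ⟧ * φ y))
  (trans (cong₂ _+_ (Σ-point a (φ ∘ (false ∷_))) (Σ-zero _ (λ y → *-zeroˡ (φ (true ∷ y)))))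
    (+-identityʳ _))

-- Change of variables: after the sum over y is exchanged with the expectation, the indicator
-- selects y = F x.
Σ-law : ∀ {m n} p (F : Bits m → Bits n) (φ : Bits n → ℚ) →
  Σ[ (λ y → 𝔼 p (λ x → ⟦ does (F x ≟ᵇ y) ⟧) * φ y) ] ≡ 𝔼 p (φ ∘ F)
Σ-law p F φ = begin
  Σ[ (λ y → 𝔼 p (λ x → ⟦ does (F x ≟ᵇ y) ⟧) * φ y) ]
    ≡⟨ Σ-cong (λ y → trans (*-comm _ (φ y)) (sym (𝔼-*ˡ p (φ y) (λ x → ⟦ does (F x ≟ᵇ y) ⟧)))) ⟩
  Σ[ (λ y → 𝔼 p (λ x → φ y * ⟦ does (F x ≟ᵇ y) ⟧)) ]
    ≡⟨ 𝔼-Σ p (λ x y → φ y * ⟦ does (F x ≟ᵇ y) ⟧) ⟩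
  𝔼 p (λ x → Σ[ (λ y → φ y * ⟦ does (F x ≟ᵇ y) ⟧) ])
    ≡⟨ 𝔼-cong p (λ x → trans (Σ-cong (λ y → *-comm (φ y) _)) (Σ-point (F x) φ)) ⟩
  𝔼 p (φ ∘ F) ∎
  where open ≡-Reasoning

pushforward-total : ∀ {m n} (f : Bits m → Bits n) → Σ[ pushforward f (𝒰 m) ] ≡ 1ℚ
pushforward-total {m} f = trans
  (Σ-cong (λ y → trans (pushforward-𝒰 f y) (sym (*-identityʳ _))))
  (trans (Σ-law ½ f (λ _ → 1ℚ)) (𝔼-const {m} ½ 1ℚ))

-- The binomial distribution

-- The binomial probability of j successes in n trials. As an expectation it inherits Pascal's rule
-- from the recursion of `𝔼`, so that no binomial coefficients occur.
W : ∀ n → ℚ → ℕ → ℚ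
W n p j = 𝔼 {n} p (λ y → ⟦ does (weight y ℕ.≟ j) ⟧)

W-nonneg : ∀ n {p} → 0ℚ ≤ p → p ≤ 1ℚ → ∀ j → 0ℚ ≤ W n p j
W-nonneg n {p} 0≤p p≤1 j = subst (_≤ W n p j) (𝔼-const {n} p 0ℚ)
  (𝔼-mono {n} 0≤p p≤1 (λ y → 0≤⟦ does (weight y ℕ.≟ j) ⟧))

W-suc-zero : ∀ n p → W (suc n) p 0 ≡ (1ℚ - p) * W n p 0
W-suc-zero n p = trans (cong (λ z → p * z + (1ℚ - p) * W n p 0) (𝔼-const {n} p 0ℚ))
  (solve 2 (λ p w → p :* con 0ℚ :+ w := w) refl p ((1ℚ - p) * W n p 0))

-- The ratio of consecutive binomial probabilities, without division. For n + 1 trials, Pascal's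
-- rule and the induction hypothesis reduce both sides to q p (n + 1) W n p j.
W-recurrence : ∀ n p j → ι (suc j) * ((1ℚ - p) * W n p (suc j)) ≡ (ι n - ι j) * (p * W n p j)
W-recurrence zero p zero    = solve 1 (λ p → con (ι 1) :* ((con 1ℚ :- p) :* con 0ℚ) :=
  (con 0ℚ :- con 0ℚ) :* (p :* con 1ℚ)) refl p
W-recurrence zero p (suc j) = solve 3 (λ p a b → a :* ((con 1ℚ :- p) :* con 0ℚ) :=
  (con 0ℚ :- b) :* (p :* con 0ℚ)) refl p (ι (suc (suc j))) (ι (suc j))
W-recurrence (suc n) p j = trans lhs (sym (rhs j))
  where
  open ≡-Reasoning
  q = 1ℚ - p
  common : ℕ → ℚ
  common j = q * p * (ι (suc n) * W n p j)
  lhs : ι (suc j) * (q * W (suc n) p (suc j)) ≡ common j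
  lhs = begin
    ι (suc j) * (q * (p * W n p j + q * W n p (suc j)))
      ≡⟨ solve 5 (λ J q p a b → J :* (q :* (p :* a :+ q :* b)) :=
           q :* p :* (J :* a) :+ q :* (J :* (q :* b))) refl (ι (suc j)) q p (W n p j) (W n p (suc j)) ⟩
    q * p * (ι (suc j) * W n p j) + q * (ι (suc j) * (q * W n p (suc j)))
      ≡⟨ cong₂ (λ x y → q * p * (x * W n p j) + q * y) (ι-suc j) (W-recurrence n p j) ⟩
    q * p * ((1ℚ + ι j) * W n p j) + q * ((ι n - ι j) * (p * W n p j))
      ≡⟨ solve 5 (λ J q p a N → q :* p :* ((con 1ℚ :+ J) :* a) :+ q :* ((N :- J) :* (p :* a)) :=
           q :* p :* ((con 1ℚ :+ N) :* a)) refl (ι j) q p (W n p j) (ι n) ⟩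
    q * p * ((1ℚ + ι n) * W n p j)
      ≡⟨ cong (λ x → q * p * (x * W n p j)) (sym (ι-suc n)) ⟩
    common j ∎
  rhs : ∀ j → (ι (suc n) - ι j) * (p * W (suc n) p j) ≡ common j
  rhs zero = trans (cong (λ w → (ι (suc n) - 0ℚ) * (p * w)) (W-suc-zero n p))
    (solve 4 (λ N q p a → (N :- con 0ℚ) :* (p :* (q :* a)) := q :* p :* (N :* a))
      refl (ι (suc n)) q p (W n p 0))
  rhs (suc j) = begin
    (ι (suc n) - ι (suc j)) * (p * (p * W n p j + q * W n p (suc j)))
      ≡⟨ cong₂ (λ x y → (x - y) * (p * (p * W n p j + q * W n p (suc j)))) (ι-suc n) (ι-suc j) ⟩
    (1ℚ + ι n - (1ℚ + ι j)) * (p * (p * W n p j + q * W n p (suc j)))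
      ≡⟨ solve 6 (λ N J q p a b → (con 1ℚ :+ N :- (con 1ℚ :+ J)) :* (p :* (p :* a :+ q :* b)) :=
           p :* ((N :- J) :* (p :* a)) :+ (N :- J) :* (p :* (q :* b)))
           refl (ι n) (ι j) q p (W n p j) (W n p (suc j)) ⟩
    p * ((ι n - ι j) * (p * W n p j)) + (ι n - ι j) * (p * (q * W n p (suc j)))
      ≡⟨ cong (λ x → p * x + (ι n - ι j) * (p * (q * W n p (suc j)))) (sym (W-recurrence n p j)) ⟩
    p * (ι (suc j) * (q * W n p (suc j))) + (ι n - ι j) * (p * (q * W n p (suc j)))
      ≡⟨ cong (λ x → p * (x * (q * W n p (suc j))) + (ι n - ι j) * (p * (q * W n p (suc j)))) (ι-suc j) ⟩
    p * ((1ℚ + ι j) * (q * W n p (suc j))) + (ι n - ι j) * (p * (q * W n p (suc j)))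
      ≡⟨ solve 5 (λ N J q p b → p :* ((con 1ℚ :+ J) :* (q :* b)) :+ (N :- J) :* (p :* (q :* b)) :=
           q :* p :* ((con 1ℚ :+ N) :* b)) refl (ι n) (ι j) q p (W n p (suc j)) ⟩
    q * p * ((1ℚ + ι n) * W n p (suc j))
      ≡⟨ cong (λ x → q * p * (x * W n p (suc j))) (sym (ι-suc n)) ⟩
    common (suc j) ∎

sumTo : (ℕ → ℚ) → ℕ → ℚ
sumTo w zero    = 0ℚ
sumTo w (suc J) = w 0 + sumTo (w ∘ suc) J

sumTo-≤ : ∀ {w T} → (∀ j → w j ≤ T) → ∀ J → sumTo w J ≤ ι J * T
sumTo-≤ {T = T} h zero    = ≤-reflexive (sym (*-zeroˡ T))
sumTo-≤ {w} {T} h (suc J) = ≤-trans (+-mono-≤ (h 0) (sumTo-≤ (λ j → h (suc j)) J))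
  (≤-reflexive (trans (solve 2 (λ j t → t :+ j :* t := (con 1ℚ :+ j) :* t) refl (ι J) T)
    (cong (_* T) (sym (ι-suc J)))))

sumTo-zip : ∀ a b u v J →
  sumTo (λ j → a * u j + b * v j) J ≡ a * sumTo u J + b * sumTo v J
sumTo-zip a b u v zero    = solve 2 (λ a b → con 0ℚ := a :* con 0ℚ :+ b :* con 0ℚ) refl a b
sumTo-zip a b u v (suc J) = trans
  (cong (λ z → a * u 0 + b * v 0 + z) (sumTo-zip a b (u ∘ suc) (v ∘ suc) J))
  (solve 6 (λ a b c d e f → a :* c :+ b :* d :+ (a :* e :+ b :* f) :=
     a :* (c :+ e) :+ b :* (d :+ f)) refl a b (u 0) (v 0) _ _)

-- The extra `k` lengthens the sum by vanishing terms. The induction needs it, because Pascal's rule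
-- produces two sums of different lengths over the same law.
W-total : ∀ n p k → sumTo (W n p) (suc (n ℕ.+ k)) ≡ 1ℚ
W-total zero p k = trans (cong (λ z → 1ℚ + z) (zeros k)) (+-identityʳ 1ℚ)
  where
  zeros : ∀ k → sumTo (λ _ → 0ℚ) k ≡ 0ℚ
  zeros zero    = refl
  zeros (suc k) = trans (+-identityˡ _) (zeros k)
W-total (suc n) p k = begin
  W (suc n) p 0 + sumTo (λ j → p * W n p j + (1ℚ - p) * W n p (suc j)) (suc n ℕ.+ k)
    ≡⟨ cong₂ _+_ (W-suc-zero n p) (sumTo-zip p (1ℚ - p) (W n p) (W n p ∘ suc) (suc n ℕ.+ k)) ⟩
  (1ℚ - p) * W n p 0 + (p * sumTo (W n p) (suc n ℕ.+ k) + (1ℚ - p) * sumTo (W n p ∘ suc) (suc n ℕ.+ k))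
    ≡⟨ solve 4 (λ p a b c → (con 1ℚ :- p) :* a :+ (p :* b :+ (con 1ℚ :- p) :* c) :=
         p :* b :+ (con 1ℚ :- p) :* (a :+ c)) refl p (W n p 0) _ _ ⟩
  p * sumTo (W n p) (suc n ℕ.+ k) + (1ℚ - p) * sumTo (W n p) (suc (suc n ℕ.+ k))
    ≡⟨ cong₂ (λ a b → p * a + (1ℚ - p) * b) (W-total n p k)
         (trans (cong (λ l → sumTo (W n p) (suc l)) (sym (ℕ.+-suc n k))) (W-total n p (suc k))) ⟩
  p * 1ℚ + (1ℚ - p) * 1ℚ
    ≡⟨ solve 1 (λ p → p :* con 1ℚ :+ (con 1ℚ :- p) :* con 1ℚ := con 1ℚ) refl p ⟩
  1ℚ ∎
  where open ≡-Reasoning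

ascending : ∀ {w : ℕ → ℚ} {j} k → (∀ {i} → j ℕ.≤ i → i ℕ.< k → w i ≤ w (suc i)) →
  j ℕ.≤ k → w j ≤ w k
ascending {w} {j} zero    up h rewrite ℕ.n≤0⇒n≡0 h = ≤-refl
ascending {w} {j} (suc k) up h with ℕ.m≤n⇒m<n∨m≡n h
... | inj₁ (s≤s j≤k) = ≤-trans (ascending {w} k (λ a b → up a (ℕ.m≤n⇒m≤1+n b)) j≤k) (up j≤k ℕ.≤-refl)
... | inj₂ refl      = ≤-refl

module _ (n k : ℕ) (p : ℚ) (pn≡k : p * ι n ≡ ι k) (0≤p : 0ℚ ≤ p) (p<1 : p < 1ℚ) where

  private
    q = 1ℚ - p

    p≤1 : p ≤ 1ℚ
    p≤1 = <⇒≤ p<1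

    0<q : 0ℚ < q
    0<q = subst (_< q) (+-inverseʳ p) (+-monoˡ-< (- p) p<1)

    0<sucq : ∀ j → 0ℚ < ι (suc j) * q
    0<sucq j = positive⁻¹ _ {{pos*pos⇒pos (ι (suc j)) {{positive (ι-pos (suc j))}} q {{positive 0<q}}}}

    w : ℕ → ℚ
    w = W n p

    -- As p n = k, the comparison of w (j + 1) with w j is governed by the sign of k - (j + 1) + p.
    -- This is nonnegative for j < k and, as p < 1, negative for j ≥ k, so `w` rises up to `k` and
    -- falls afterwards.
    w-step : ∀ j → ι (suc j) * q * w (suc j) ≡ (ι (suc j) * q + (ι k - ι (suc j) + p)) * w j
    w-step j = begin
      ι (suc j) * q * w (suc j)    ≡⟨ *-assoc (ι (suc j)) q (w (suc j)) ⟩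
      ι (suc j) * (q * w (suc j))  ≡⟨ W-recurrence n p j ⟩
      (ι n - ι j) * (p * w j)      ≡⟨ solve 4 (λ N J p w → (N :- J) :* (p :* w) :=
        ((con 1ℚ :+ J) :* (con 1ℚ :- p) :+ (p :* N :- (con 1ℚ :+ J) :+ p)) :* w) refl (ι n) (ι j) p (w j) ⟩
      ((1ℚ + ι j) * q + (p * ι n - (1ℚ + ι j) + p)) * w j
        ≡⟨ cong₂ (λ x y → (x * q + (y - x + p)) * w j) (sym (ι-suc j)) pn≡k ⟩
      (ι (suc j) * q + (ι k - ι (suc j) + p)) * w j ∎
      where open ≡-Reasoning

    0≤w : ∀ j → 0ℚ ≤ w j
    0≤w = W-nonneg n 0≤p p≤1

    w-up : ∀ j → j ℕ.< k → w j ≤ w (suc j)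
    w-up j j<k = *-cancelˡ-≤-pos (ι (suc j) * q) {{positive (0<sucq j)}}
      (subst (ι (suc j) * q * w j ≤_) (sym (w-step j))
        (*-monoʳ-≤-nonNeg (w j) {{nonNegative (0≤w j)}}
          (p≤p+q {ι (suc j) * q} (0≤+ (p≤q⇒0≤q-p (ι-mono j<k)) 0≤p))))

    w-down : ∀ j → k ℕ.≤ j → w (suc j) ≤ w j
    w-down j k≤j = *-cancelˡ-≤-pos (ι (suc j) * q) {{positive (0<sucq j)}}
      (subst (_≤ ι (suc j) * q * w j) (sym (w-step j))
        (*-monoʳ-≤-nonNeg (w j) {{nonNegative (0≤w j)}}
          (0≤q-p⇒p≤q {ι (suc j) * q + (ι k - ι (suc j) + p)} {ι (suc j) * q} (subst (0ℚ ≤_) (trans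
              (solve 4 (λ a b k p → (b :- k) :+ (con 1ℚ :- p) := a :- (a :+ (k :- (con 1ℚ :+ b) :+ p)))
                refl (ι (suc j) * q) (ι j) (ι k) p)
              (cong (λ x → ι (suc j) * q - (ι (suc j) * q + (ι k - x + p))) (sym (ι-suc j))))
            (0≤+ (p≤q⇒0≤q-p (ι-mono k≤j)) (<⇒≤ 0<q))))))

  W-mode : ∀ j → W n p j ≤ W n p k
  W-mode j with ℕ.≤-total j k
  ... | inj₁ j≤k = ascending {w} k (λ {i} _ i<k → w-up i i<k) j≤k
  ... | inj₂ k≤j = neg-cancel (ascending {λ i → - w i} j (λ {i} k≤i _ → neg-antimono-≤ (w-down i k≤i)) k≤j)
    where
    neg-neg : ∀ a → - (- a) ≡ a
    neg-neg = solve 1 (λ a → :- (:- a) := a) refl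
    neg-cancel : ∀ {a b} → - a ≤ - b → b ≤ a
    neg-cancel {a} {b} h = subst₂ _≤_ (neg-neg b) (neg-neg a) (neg-antimono-≤ h)

  -- The n + 1 weights sum to 1 and none exceeds the one at `k`. This crude count takes the place of
  -- Stirling's estimate.
  1≤[1+n]*W : 1ℚ ≤ ι (suc n) * W n p k
  1≤[1+n]*W = subst₂ _≤_ (W-total n p 0) (cong (λ m → ι (suc m) * W n p k) (ℕ.+-identityʳ n))
    (sumTo-≤ W-mode (suc (n ℕ.+ 0)))

bernoulli : ∀ {n} → ℚ → Bits n → ℚ
bernoulli {n} p y = p ^ weight y * (1ℚ - p) ^ (n ℕ.∸ weight y)

𝔼-bernoulli : ∀ {n} p (g : Bits n → ℚ) → 𝔼 p g ≡ Σ[ (λ y → bernoulli p y * g y) ]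
𝔼-bernoulli {zero}  p g = sym (trans (+-identityʳ _) (*-identityˡ (g [])))
𝔼-bernoulli {suc n} p g = begin
  p * 𝔼 p (g ∘ (true ∷_)) + q * 𝔼 p (g ∘ (false ∷_))
    ≡⟨ +-comm (p * 𝔼 p (g ∘ (true ∷_))) (q * 𝔼 p (g ∘ (false ∷_))) ⟩
  q * 𝔼 p (g ∘ (false ∷_)) + p * 𝔼 p (g ∘ (true ∷_))
    ≡⟨ cong₂ (λ a b → q * a + p * b) (𝔼-bernoulli p (g ∘ (false ∷_))) (𝔼-bernoulli p (g ∘ (true ∷_))) ⟩
  q * Σ[ (λ y → bernoulli p y * g (false ∷ y)) ] + p * Σ[ (λ y → bernoulli p y * g (true ∷ y)) ]
    ≡⟨ cong₂ _+_ (sym (Σ-*ˡ q (λ y → bernoulli p y * g (false ∷ y))))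
                 (sym (Σ-*ˡ p (λ y → bernoulli p y * g (true ∷ y)))) ⟩
  Σ[ (λ y → q * (bernoulli p y * g (false ∷ y))) ] + Σ[ (λ y → p * (bernoulli p y * g (true ∷ y))) ]
    ≡⟨ cong₂ _+_ (Σ-cong falses) (Σ-cong trues) ⟩
  Σ[ (λ y → bernoulli p (false ∷ y) * g (false ∷ y)) ] + Σ[ (λ y → bernoulli p (true ∷ y) * g (true ∷ y)) ]
    ≡⟨ sym (Σ-suc (λ y → bernoulli p y * g y)) ⟩
  Σ[ (λ y → bernoulli p y * g y) ] ∎
  where
  open ≡-Reasoning
  q = 1ℚ - p
  falses : ∀ y → q * (bernoulli p y * g (false ∷ y)) ≡ bernoulli p (false ∷ y) * g (false ∷ y)
  falses y = trans
    (solve 4 (λ q a b g → q :* (a :* b :* g) := a :* (q :* b) :* g) refl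
      q (p ^ weight y) (q ^ (n ℕ.∸ weight y)) (g (false ∷ y)))
    (cong (λ e → p ^ weight y * q ^ e * g (false ∷ y))
      (sym (ℕ.+-∸-assoc 1 (count≤n (Bool._≟ true) y))))
  trues : ∀ y → p * (bernoulli p y * g (true ∷ y)) ≡ bernoulli p (true ∷ y) * g (true ∷ y)
  trues y = solve 4 (λ p a b g → p :* (a :* b :* g) := p :* a :* b :* g) refl
    p (p ^ weight y) (q ^ (n ℕ.∸ weight y)) (g (true ∷ y))

on-event : ∀ {P : Set} (P? : Dec P) {a b g} → (P → a ≡ b) →
  a * (⟦ does P? ⟧ * g) ≡ b * (⟦ does P? ⟧ * g)
on-event (yes h)         e = cong (_* _) (e h)
on-event (no _)  {a} {b} {g} e = solve 3 (λ a b g → a :* (con 0ℚ :* g) := b :* (con 0ℚ :* g)) refl a b g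

-- All strings of weight `k` have the same mass under the product law.
𝔼-slice : ∀ {n} p k (g : Bits n → ℚ) →
  𝔼 p (λ y → ⟦ does (weight y ℕ.≟ k) ⟧ * g y) ≡
  p ^ k * (1ℚ - p) ^ (n ℕ.∸ k) * Σ[ (λ y → ⟦ does (weight y ℕ.≟ k) ⟧ * g y) ]
𝔼-slice {n} p k g = trans (𝔼-bernoulli p (λ y → ⟦ does (weight y ℕ.≟ k) ⟧ * g y))
  (trans (Σ-cong onSlice) (Σ-*ˡ b (λ y → ⟦ does (weight y ℕ.≟ k) ⟧ * g y)))
  where
  b = p ^ k * (1ℚ - p) ^ (n ℕ.∸ k)
  onSlice : ∀ y → bernoulli p y * (⟦ does (weight y ℕ.≟ k) ⟧ * g y) ≡ b * (⟦ does (weight y ℕ.≟ k) ⟧ * g y)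
  onSlice y = on-event (weight y ℕ.≟ k)
    λ e → cong (λ j → p ^ j * (1ℚ - p) ^ (n ℕ.∸ j)) e

module _ {n k : ℕ} {p : ℚ} (pn≡k : p * ι n ≡ ι k) (0≤p : 0ℚ ≤ p) (p<1 : p < 1ℚ) where

  private
    b N : ℚ
    b = p ^ k * (1ℚ - p) ^ (n ℕ.∸ k)
    N = Σ[ (λ (y : Bits n) → ⟦ does (weight y ℕ.≟ k) ⟧) ]
    r : ℚ
    r = recip (length (filter (λ x → weight x ℕ.≟ k) (cube n)))

    0≤q : 0ℚ ≤ 1ℚ - p
    0≤q = p≤q⇒0≤q-p (<⇒≤ p<1)

    0≤b : 0ℚ ≤ b
    0≤b = 0≤* (^-nonneg 0≤p k) (^-nonneg 0≤q (n ℕ.∸ k))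

    W≡bN : W n p k ≡ b * N
    W≡bN = trans (𝔼-cong {n} p (λ y → sym (*-identityʳ ⟦ does (weight y ℕ.≟ k) ⟧)))
      (trans (𝔼-slice {n} p k (λ _ → 1ℚ))
        (cong (b *_) (Σ-cong {n} (λ y → *-identityʳ ⟦ does (weight y ℕ.≟ k) ⟧))))

    1≤cN : 1ℚ ≤ ι (suc n) * b * N
    1≤cN = subst (1ℚ ≤_) (trans (cong (ι (suc n) *_) W≡bN) (sym (*-assoc (ι (suc n)) b N)))
      (1≤[1+n]*W n k p pn≡k 0≤p p<1)

    0≤c : 0ℚ ≤ ι (suc n) * b
    0≤c = 0≤* (ι-nonneg (suc n)) 0≤b

  -- No string is exhibited: an event of probability at least 1 / (n + 1) cannot be empty.
  slice-pos : 0ℚ < N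
  slice-pos = ≰⇒> λ N≤0 → <-irrefl refl (<-≤-trans (positive⁻¹ 1ℚ)
    (≤-trans 1≤cN (subst (ι (suc n) * b * N ≤_) (*-zeroʳ (ι (suc n) * b))
      (*-monoˡ-≤-nonNeg (ι (suc n) * b) {{nonNegative 0≤c}} N≤0))))

  -- The uniform law on the slice is the product law conditioned on weight `k`. That event has
  -- probability at least 1 / (n + 1), so conditioning raises the expectation of a nonnegative
  -- function at most by the factor n + 1.
  𝒟-≤-𝔼 : ∀ {Ψ : Bits n → ℚ} → (∀ y → 0ℚ ≤ Ψ y) →
    Σ[ (λ y → 𝒟 n k y * Ψ y) ] ≤ ι (suc n) * 𝔼 p Ψ
  𝒟-≤-𝔼 {Ψ} 0≤Ψ = begin
    Σ[ (λ y → 𝒟 n k y * Ψ y) ]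
      ≡⟨ Σ-cong (λ y → trans (cong (_* Ψ y) (if-* (does (weight y ℕ.≟ k)) r))
           (*-assoc r ⟦ does (weight y ℕ.≟ k) ⟧ (Ψ y))) ⟩
    Σ[ (λ y → r * G y) ]
      ≡⟨ Σ-*ˡ r G ⟩
    r * Σ[ G ]
      ≤⟨ *-monoʳ-≤-nonNeg Σ[ G ] {{nonNegative 0≤ΣG}} r≤c ⟩
    ι (suc n) * b * Σ[ G ]
      ≡⟨ *-assoc (ι (suc n)) b Σ[ G ] ⟩
    ι (suc n) * (b * Σ[ G ])
      ≡⟨ cong (ι (suc n) *_) (sym (𝔼-slice p k Ψ)) ⟩
    ι (suc n) * 𝔼 p G
      ≤⟨ *-monoˡ-≤-nonNeg (ι (suc n)) {{nonNegative (ι-nonneg (suc n))}}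
           (𝔼-mono 0≤p (<⇒≤ p<1) G≤Ψ) ⟩
    ι (suc n) * 𝔼 p Ψ ∎
    where
    open ≤-Reasoning
    G : Bits n → ℚ
    G y = ⟦ does (weight y ℕ.≟ k) ⟧ * Ψ y
    G≤Ψ : ∀ y → G y ≤ Ψ y
    G≤Ψ y = subst (G y ≤_) (*-identityˡ (Ψ y))
      (*-monoʳ-≤-nonNeg (Ψ y) {{nonNegative (0≤Ψ y)}} ⟦ does (weight y ℕ.≟ k) ⟧≤1)
    0≤ΣG : 0ℚ ≤ Σ[ G ]
    0≤ΣG = subst (_≤ Σ[ G ]) (Σ-zero {n} (λ _ → 0ℚ) (λ _ → refl))
      (Σ-mono (λ y → 0≤* 0≤⟦ does (weight y ℕ.≟ k) ⟧ (0≤Ψ y)))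
    0≤r : 0ℚ ≤ r
    0≤r = recip-nonneg (length (filter (λ x → weight x ℕ.≟ k) (cube n)))
    r≤c : r ≤ ι (suc n) * b
    r≤c = subst₂ _≤_ (*-identityʳ r)
      (trans (solve 3 (λ r c N → r :* (c :* N) := r :* N :* c) refl r (ι (suc n) * b) N)
        (trans (cong (_* (ι (suc n) * b))
          (recip-* (length (filter (λ x → weight x ℕ.≟ k) (cube n))) N (ι-count {n} (λ x → weight x ℕ.≟ k)) slice-pos))
          (*-identityˡ (ι (suc n) * b))))
      (*-monoˡ-≤-nonNeg r {{nonNegative 0≤r}} 1≤cN)

-- Conditioning on the bits in a set

merge : ∀ {m} → Subset m → Bits m → Bits m → Bits m
merge []      []      []      = []
merge (s ∷ S) (a ∷ ρ) (b ∷ x) = (if s then a else b) ∷ merge S ρ x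

-- The bits outside S are set to false, which is immaterial since merge S ignores them.
Σ⟨_⟩ : ∀ {m} → Subset m → (Bits m → ℚ) → ℚ
Σ⟨ []        ⟩ h = h []
Σ⟨ true ∷ S  ⟩ h = Σ⟨ S ⟩ (h ∘ (true ∷_)) + Σ⟨ S ⟩ (h ∘ (false ∷_))
Σ⟨ false ∷ S ⟩ h = Σ⟨ S ⟩ (h ∘ (false ∷_))

Σ⟨⟩-cong : ∀ {m} (S : Subset m) {g h : Bits m → ℚ} → (∀ ρ → g ρ ≡ h ρ) → Σ⟨ S ⟩ g ≡ Σ⟨ S ⟩ h
Σ⟨⟩-cong []          e = e []
Σ⟨⟩-cong (true ∷ S)  e = cong₂ _+_ (Σ⟨⟩-cong S (λ ρ → e (true ∷ ρ))) (Σ⟨⟩-cong S (λ ρ → e (false ∷ ρ)))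
Σ⟨⟩-cong (false ∷ S) e = Σ⟨⟩-cong S (λ ρ → e (false ∷ ρ))

Σ⟨⟩-+ : ∀ {m} (S : Subset m) (g h : Bits m → ℚ) → Σ⟨ S ⟩ (λ ρ → g ρ + h ρ) ≡ Σ⟨ S ⟩ g + Σ⟨ S ⟩ h
Σ⟨⟩-+ []          g h = refl
Σ⟨⟩-+ (true ∷ S)  g h = trans
  (cong₂ _+_ (Σ⟨⟩-+ S (g ∘ (true ∷_)) (h ∘ (true ∷_))) (Σ⟨⟩-+ S (g ∘ (false ∷_)) (h ∘ (false ∷_))))
  (solve 4 (λ a b c d → a :+ b :+ (c :+ d) := a :+ c :+ (b :+ d)) refl
    (Σ⟨ S ⟩ (g ∘ (true ∷_))) (Σ⟨ S ⟩ (h ∘ (true ∷_))) (Σ⟨ S ⟩ (g ∘ (false ∷_))) (Σ⟨ S ⟩ (h ∘ (false ∷_))))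
Σ⟨⟩-+ (false ∷ S) g h = Σ⟨⟩-+ S (g ∘ (false ∷_)) (h ∘ (false ∷_))

Σ⟨⟩-*ˡ : ∀ {m} (S : Subset m) c (g : Bits m → ℚ) → Σ⟨ S ⟩ (λ ρ → c * g ρ) ≡ c * Σ⟨ S ⟩ g
Σ⟨⟩-*ˡ []          c g = refl
Σ⟨⟩-*ˡ (true ∷ S)  c g = trans
  (cong₂ _+_ (Σ⟨⟩-*ˡ S c (g ∘ (true ∷_))) (Σ⟨⟩-*ˡ S c (g ∘ (false ∷_))))
  (sym (*-distribˡ-+ c (Σ⟨ S ⟩ (g ∘ (true ∷_))) (Σ⟨ S ⟩ (g ∘ (false ∷_)))))
Σ⟨⟩-*ˡ (false ∷ S) c g = Σ⟨⟩-*ˡ S c (g ∘ (false ∷_))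

Σ⟨⟩-nonneg : ∀ {m} (S : Subset m) {g : Bits m → ℚ} → (∀ ρ → 0ℚ ≤ g ρ) → 0ℚ ≤ Σ⟨ S ⟩ g
Σ⟨⟩-nonneg []          h = h []
Σ⟨⟩-nonneg (true ∷ S)  h = 0≤+ (Σ⟨⟩-nonneg S (λ ρ → h (true ∷ ρ))) (Σ⟨⟩-nonneg S (λ ρ → h (false ∷ ρ)))
Σ⟨⟩-nonneg (false ∷ S) h = Σ⟨⟩-nonneg S (λ ρ → h (false ∷ ρ))

Σ⟨⟩-≤ : ∀ {m} (S : Subset m) {g : Bits m → ℚ} {T} → (∀ ρ → g ρ ≤ T) → Σ⟨ S ⟩ g ≤ ι 2 ^ Subset.∣ S ∣ * T
Σ⟨⟩-≤ []          {T = T} h = ≤-trans (h []) (≤-reflexive (sym (*-identityˡ T)))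
Σ⟨⟩-≤ (true ∷ S)  {T = T} h = ≤-trans
  (+-mono-≤ (Σ⟨⟩-≤ S (λ ρ → h (true ∷ ρ))) (Σ⟨⟩-≤ S (λ ρ → h (false ∷ ρ))))
  (≤-reflexive (solve 2 (λ a t → a :* t :+ a :* t := con (ι 2) :* a :* t) refl (ι 2 ^ Subset.∣ S ∣) T))
Σ⟨⟩-≤ (false ∷ S) h = Σ⟨⟩-≤ S (λ ρ → h (false ∷ ρ))

Σ⟨⟩-Σ : ∀ {m n} (S : Subset m) (G : Bits m → Bits n → ℚ) →
  Σ[ (λ y → Σ⟨ S ⟩ (λ ρ → G ρ y)) ] ≡ Σ⟨ S ⟩ (λ ρ → Σ[ G ρ ])
Σ⟨⟩-Σ []          G = refl
Σ⟨⟩-Σ (true ∷ S)  G = trans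
  (Σ-+ (λ y → Σ⟨ S ⟩ (λ ρ → G (true ∷ ρ) y)) (λ y → Σ⟨ S ⟩ (λ ρ → G (false ∷ ρ) y)))
  (cong₂ _+_ (Σ⟨⟩-Σ S (λ ρ → G (true ∷ ρ))) (Σ⟨⟩-Σ S (λ ρ → G (false ∷ ρ))))
Σ⟨⟩-Σ (false ∷ S) G = Σ⟨⟩-Σ S (λ ρ → G (false ∷ ρ))

⊓-subadditive : ∀ {a b q} → 0ℚ ≤ a → 0ℚ ≤ b → 0ℚ ≤ q → (a + b) ⊓ q ≤ a ⊓ q + b ⊓ q
⊓-subadditive {a} {b} {q} 0≤a 0≤b 0≤q with ⊓-sel a q | ⊓-sel b q
... | inj₁ ea | inj₁ eb rewrite ea | eb = p⊓q≤p (a + b) q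
... | inj₂ ea | _       rewrite ea      = ≤-trans (p⊓q≤q (a + b) q) (p≤p+q (⊓-glb 0≤b 0≤q))
... | inj₁ _  | inj₂ eb rewrite eb      = ≤-trans (p⊓q≤q (a + b) q) (p≤q+p (⊓-glb 0≤a 0≤q))

-- All of `q`, rather than a share of it, is set against each assignment. This counts `q` up to
-- 2^|S| times, which is the factor that the packing has to beat.
Σ⟨⟩-⊓ : ∀ {m} (S : Subset m) {q} {g h : Bits m → ℚ} → 0ℚ ≤ q → (∀ ρ → 0ℚ ≤ g ρ) →
  (∀ ρ → g ρ ⊓ q ≤ h ρ) → Σ⟨ S ⟩ g ⊓ q ≤ Σ⟨ S ⟩ h
Σ⟨⟩-⊓ []          0≤q 0≤g le = le []
Σ⟨⟩-⊓ (true ∷ S)  0≤q 0≤g le = ≤-trans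
  (⊓-subadditive (Σ⟨⟩-nonneg S (λ ρ → 0≤g (true ∷ ρ))) (Σ⟨⟩-nonneg S (λ ρ → 0≤g (false ∷ ρ))) 0≤q)
  (+-mono-≤ (Σ⟨⟩-⊓ S 0≤q (λ ρ → 0≤g (true ∷ ρ)) (λ ρ → le (true ∷ ρ)))
            (Σ⟨⟩-⊓ S 0≤q (λ ρ → 0≤g (false ∷ ρ)) (λ ρ → le (false ∷ ρ))))
Σ⟨⟩-⊓ (false ∷ S) 0≤q 0≤g le = Σ⟨⟩-⊓ S 0≤q (λ ρ → 0≤g (false ∷ ρ)) (λ ρ → le (false ∷ ρ))

𝔼-condition : ∀ {m} (S : Subset m) (g : Bits m → ℚ) →
  𝔼 ½ g ≡ Σ⟨ S ⟩ (λ ρ → ½ ^ Subset.∣ S ∣ * 𝔼 ½ (g ∘ merge S ρ))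
𝔼-condition []          g = sym (*-identityˡ (g []))
𝔼-condition (true ∷ S)  g = begin
  ½ * 𝔼 ½ (g ∘ (true ∷_)) + (1ℚ - ½) * 𝔼 ½ (g ∘ (false ∷_))
    ≡⟨ cong₂ (λ a b → ½ * a + (1ℚ - ½) * b) (𝔼-condition S (g ∘ (true ∷_))) (𝔼-condition S (g ∘ (false ∷_))) ⟩
  ½ * Σ⟨ S ⟩ (λ ρ → h * e true ρ) + (1ℚ - ½) * Σ⟨ S ⟩ (λ ρ → h * e false ρ)
    ≡⟨ cong₂ _+_ (sym (Σ⟨⟩-*ˡ S ½ _)) (sym (Σ⟨⟩-*ˡ S (1ℚ - ½) _)) ⟩
  Σ⟨ S ⟩ (λ ρ → ½ * (h * e true ρ)) + Σ⟨ S ⟩ (λ ρ → (1ℚ - ½) * (h * e false ρ))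
    ≡⟨ cong₂ _+_ (Σ⟨⟩-cong S (λ ρ → fixed (e true ρ))) (Σ⟨⟩-cong S (λ ρ → fixed (e false ρ))) ⟩
  Σ⟨ S ⟩ (λ ρ → ½ * h * (½ * e true ρ + (1ℚ - ½) * e true ρ)) +
    Σ⟨ S ⟩ (λ ρ → ½ * h * (½ * e false ρ + (1ℚ - ½) * e false ρ)) ∎
  where
  open ≡-Reasoning
  h = ½ ^ Subset.∣ S ∣
  e : Bool → Bits _ → ℚ
  e b ρ = 𝔼 ½ (λ x → g (b ∷ merge S ρ x))
  -- `merge` overwrites this bit of the input, so averaging over it changes nothing, while fixing it
  -- contributes the factor ½.
  fixed : ∀ a → ½ * (h * a) ≡ ½ * h * (½ * a + (1ℚ - ½) * a)
  fixed = solve 2 (λ h a → con ½ :* (h :* a) :=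
    con ½ :* h :* (con ½ :* a :+ (con 1ℚ :- con ½) :* a)) refl h
𝔼-condition (false ∷ S) g = begin
  ½ * 𝔼 ½ (g ∘ (true ∷_)) + (1ℚ - ½) * 𝔼 ½ (g ∘ (false ∷_))
    ≡⟨ cong₂ (λ a b → ½ * a + (1ℚ - ½) * b) (𝔼-condition S (g ∘ (true ∷_))) (𝔼-condition S (g ∘ (false ∷_))) ⟩
  ½ * Σ⟨ S ⟩ (λ ρ → h * e true ρ) + (1ℚ - ½) * Σ⟨ S ⟩ (λ ρ → h * e false ρ)
    ≡⟨ cong₂ _+_ (sym (Σ⟨⟩-*ˡ S ½ _)) (sym (Σ⟨⟩-*ˡ S (1ℚ - ½) _)) ⟩
  Σ⟨ S ⟩ (λ ρ → ½ * (h * e true ρ)) + Σ⟨ S ⟩ (λ ρ → (1ℚ - ½) * (h * e false ρ))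
    ≡⟨ sym (Σ⟨⟩-+ S _ _) ⟩
  Σ⟨ S ⟩ (λ ρ → ½ * (h * e true ρ) + (1ℚ - ½) * (h * e false ρ))
    ≡⟨ Σ⟨⟩-cong S (λ ρ → solve 3 (λ h a b → con ½ :* (h :* a) :+ (con 1ℚ :- con ½) :* (h :* b) :=
         h :* (con ½ :* a :+ (con 1ℚ :- con ½) :* b)) refl h (e true ρ) (e false ρ)) ⟩
  Σ⟨ S ⟩ (λ ρ → h * (½ * e true ρ + (1ℚ - ½) * e false ρ)) ∎
  where
  open ≡-Reasoning
  h = ½ ^ Subset.∣ S ∣
  e : Bool → Bits _ → ℚ
  e b ρ = 𝔼 ½ (λ x → g (b ∷ merge S ρ x))

merge-agree : ∀ {m} (S I : Subset m) ρ x y →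
  (∀ j → j ∈ I ─ S → lookup x j ≡ lookup y j) →
  ∀ j → j ∈ I → lookup (merge S ρ x) j ≡ lookup (merge S ρ y) j
merge-agree (true ∷ S)  (_ ∷ I) (a ∷ ρ) (b ∷ x) (c ∷ y) e zero    h         = refl
merge-agree (false ∷ S) (_ ∷ I) (a ∷ ρ) (b ∷ x) (c ∷ y) e zero    here      = e zero here
merge-agree (s ∷ S)     (_ ∷ I) (a ∷ ρ) (b ∷ x) (c ∷ y) e (suc j) (there h) =
  merge-agree S I ρ x y (λ i hi → e (suc i) (there′ s hi)) j h
  where
  there′ : ∀ {i} s {t} → i ∈ I ─ S → suc i ∈ (t ∷ I) ─ (s ∷ S)
  there′ true  hi = there hi
  there′ false hi = there hi

dependsOn-merge : ∀ {m} {A : Set} {I} {g : Bits m → A} → DependsOn I g →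
  ∀ S ρ → DependsOn (I ─ S) (g ∘ merge S ρ)
dependsOn-merge {I = I} dep S ρ x y e = dep _ _ (merge-agree S I ρ x y e)

-- Bernoulli bits

-- A function of one bit is affine in the indicator of that bit, so only the mean matters.
𝔼-bool : ∀ {m} p (b : Bits m → Bool) (u : Bool → ℚ) →
  𝔼 p (λ x → u (b x)) ≡ 𝔼 p (λ x → ⟦ b x ⟧) * u true + (1ℚ - 𝔼 p (λ x → ⟦ b x ⟧)) * u false
𝔼-bool {m} p b u = begin
  𝔼 p (λ x → u (b x))
    ≡⟨ 𝔼-cong p (λ x → interpolate (b x)) ⟩
  𝔼 p (λ x → (u true - u false) * ⟦ b x ⟧ + u false)
    ≡⟨ 𝔼-+ p (λ x → (u true - u false) * ⟦ b x ⟧) (λ _ → u false) ⟩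
  𝔼 p (λ x → (u true - u false) * ⟦ b x ⟧) + 𝔼 {m} p (λ _ → u false)
    ≡⟨ cong₂ _+_ (𝔼-*ˡ p (u true - u false) (λ x → ⟦ b x ⟧)) (𝔼-const {m} p (u false)) ⟩
  (u true - u false) * E + u false
    ≡⟨ solve 3 (λ E t f → (t :- f) :* E :+ f := E :* t :+ (con 1ℚ :- E) :* f) refl E (u true) (u false) ⟩
  E * u true + (1ℚ - E) * u false ∎
  where
  open ≡-Reasoning
  E = 𝔼 p (λ x → ⟦ b x ⟧)
  interpolate : ∀ b → u b ≡ (u true - u false) * ⟦ b ⟧ + u false
  interpolate true  = solve 2 (λ t f → t := (t :- f) :* con 1ℚ :+ f) refl (u true) (u false)
  interpolate false = solve 2 (λ t f → f := (t :- f) :* con 0ℚ :+ f) refl (u true) (u false)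

𝔼-lookup : ∀ {n} p (i : Fin n) → 𝔼 p (λ y → ⟦ lookup y i ⟧) ≡ p
𝔼-lookup {suc n} p zero    = trans
  (cong₂ (λ a b → p * a + (1ℚ - p) * b) (𝔼-const {n} p 1ℚ) (𝔼-const {n} p 0ℚ))
  (solve 1 (λ p → p :* con 1ℚ :+ (con 1ℚ :- p) :* con 0ℚ := p) refl p)
𝔼-lookup {suc n} p (suc i) = trans
  (cong₂ (λ a b → p * a + (1ℚ - p) * b) (𝔼-lookup p i) (𝔼-lookup p i))
  (solve 1 (λ p → p :* p :+ (con 1ℚ :- p) :* p := p) refl p)

-- Each bit that is read halves the granularity of the possible means; a bit that is not read
-- averages away. Exponents left over when `d` exceeds |I| are absorbed by the numerator 2^d in the
-- base case.
𝔼-dyadic : ∀ {m} (b : Bits m → Bool) {I} → DependsOn I b → ∀ d → Subset.∣ I ∣ ℕ.≤ d →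
  ∃ λ z → 𝔼 ½ (λ x → ⟦ b x ⟧) ≡ (z / 1) * ½ ^ d
𝔼-dyadic {zero} b dep d h with b []
... | true  = + (2 ℕ.^ d) , sym (trans (cong (_* ½ ^ d) (ι-^ 2 d))
                (trans (sym (^-distrib-* (ι 2) ½ d)) (1^n≡1 d)))
... | false = + 0 , sym (*-zeroˡ (½ ^ d))
𝔼-dyadic {suc m} b {false ∷ I} dep d h with 𝔼-dyadic (b ∘ (true ∷_)) (dependsOn-tail dep true) d h
... | z , e = z , trans (cong (λ a → ½ * 𝔼 ½ (λ x → ⟦ b (true ∷ x) ⟧) + (1ℚ - ½) * a)
                    (𝔼-cong ½ (λ x → cong ⟦_⟧ (dependsOn-head dep false true x))))
                  (trans (solve 1 (λ a → con ½ :* a :+ (con 1ℚ :- con ½) :* a := a) refl _) e)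
𝔼-dyadic {suc m} b {true ∷ I} dep (suc d) (s≤s h)
  with 𝔼-dyadic (b ∘ (true ∷_)) (dependsOn-tail dep true) d h
     | 𝔼-dyadic (b ∘ (false ∷_)) (dependsOn-tail dep false) d h
... | z , e | w , e′ = z ℤ.+ w , trans (cong₂ (λ a b → ½ * a + (1ℚ - ½) * b) e e′)
  (trans (solve 3 (λ z w h → con ½ :* (z :* h) :+ (con 1ℚ :- con ½) :* (w :* h) :=
      (z :+ w) :* (con ½ :* h)) refl (z / 1) (w / 1) (½ ^ d))
    (cong (_* ½ ^ suc d) (sym (/1-+ z w))))

-- Products over outputs with disjoint supports

Πout : ∀ {n} → (Fin n → Bool → ℚ) → List (Fin n) → Bits n → ℚ
Πout u R y = foldr (λ i c → u i (lookup y i) * c) 1ℚ R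

Πout-nonneg : ∀ {n u} → (∀ i b → 0ℚ ≤ u i b) → ∀ R (y : Bits n) → 0ℚ ≤ Πout u R y
Πout-nonneg h []      y = 0≤1
Πout-nonneg h (i ∷ R) y = 0≤* (h i (lookup y i)) (Πout-nonneg h R y)

1≤Πout*Πout : ∀ {n} (u v : Fin n → Bool → ℚ) → (∀ i b → 1ℚ ≤ u i b * v i b) →
  ∀ R (y : Bits n) → 1ℚ ≤ Πout u R y * Πout v R y
1≤Πout*Πout u v h []      y = ≤-refl
1≤Πout*Πout u v h (i ∷ R) y = ≤-trans
  (*-mono-≤₀ 0≤1 (≤-trans 0≤1 ih) (h i (lookup y i)) ih)
  (≤-reflexive (solve 4 (λ a b c d → a :* b :* (c :* d) := a :* c :* (b :* d)) refl
    (u i (lookup y i)) (v i (lookup y i)) (Πout u R y) (Πout v R y)))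
  where ih = 1≤Πout*Πout u v h R y

module _ {m n : ℕ} (F : Bits m → Bits n) (A : Fin n → Subset m)
  (dep : ∀ i → DependsOn (A i) (λ x → lookup (F x) i)) where

  dependsOn-Πout : ∀ u R → DependsOn (⋃ A R) (Πout u R ∘ F)
  dependsOn-Πout u []      x y e = refl
  dependsOn-Πout u (i ∷ R) x y e = cong₂ _*_
    (cong (u i) (dep i x y (λ j h → e j (Subset.x∈p∪q⁺ (inj₁ h)))))
    (dependsOn-Πout u R x y (λ j h → e j (Subset.x∈p∪q⁺ (inj₂ h))))

  disjoint-⋃ : ∀ {i} R → All (λ r → ∀ j → j ∈ A i → j ∉ A r) R → ∀ j → j ∈ A i → j ∉ ⋃ A R
  disjoint-⋃ []      []       j hi h = Subset.∉⊥ h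
  disjoint-⋃ (r ∷ R) (d ∷ ds) j hi h with Subset.x∈p∪q⁻ (A r) (⋃ A R) h
  ... | inj₁ hr = d j hi hr
  ... | inj₂ hR = disjoint-⋃ R ds j hi hR

  -- Used for both laws: for `f` under an assignment to `S`, with supports `I i ─ S`, and for the
  -- identity under mean γ, with singletons as supports.
  𝔼-Πout : ∀ {p β u} → 0ℚ ≤ p → p ≤ 1ℚ → 0ℚ ≤ β → (∀ i b → 0ℚ ≤ u i b) →
    (∀ i → 𝔼 p (λ x → u i (lookup (F x) i)) ≤ β) →
    ∀ R → AllPairs (λ i r → ∀ j → j ∈ A i → j ∉ A r) R → 𝔼 p (Πout u R ∘ F) ≤ β ^ length R
  𝔼-Πout {p} 0≤p p≤1 0≤β 0≤u le []      []       = ≤-reflexive (𝔼-const {m} p 1ℚ)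
  𝔼-Πout {p} {β} {u} 0≤p p≤1 0≤β 0≤u le (i ∷ R) (d ∷ ds) = begin
    𝔼 p (λ x → u i (lookup (F x) i) * Πout u R (F x))
      ≡⟨ 𝔼-indep p (λ x y e → cong (u i) (dep i x y e)) (dependsOn-Πout u R) (disjoint-⋃ R d) ⟩
    𝔼 p (λ x → u i (lookup (F x) i)) * 𝔼 p (Πout u R ∘ F)
      ≤⟨ *-mono-≤₀ 0≤E (^-nonneg 0≤β (length R)) (le i) (𝔼-Πout 0≤p p≤1 0≤β 0≤u le R ds) ⟩
    β * β ^ length R ∎
    where
    open ≤-Reasoning
    0≤E : 0ℚ ≤ 𝔼 p (λ x → u i (lookup (F x) i))
    0≤E = subst (_≤ 𝔼 p (λ x → u i (lookup (F x) i))) (𝔼-const {m} p 0ℚ)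
      (𝔼-mono 0≤p p≤1 (λ x → 0≤u i (lookup (F x) i)))

-- Tests separating two Bernoulli laws

¼ 1/16 : ℚ
¼ = + 1 / 4
1/16 = + 1 / 16

-- Since φ t φ (- t) = 1 + t² + t⁴, the weights φ t and φ (- t) are a rational substitute for
-- the square root of a likelihood ratio and its inverse.
φ : ℚ → ℚ
φ t = 1ℚ - t + t * t

φ-nonneg : ∀ t → 0ℚ ≤ φ t
φ-nonneg t = subst (0ℚ ≤_)
  (solve 1 (λ t → (t :- con ½) :* (t :- con ½) :+ con (+ 3 / 4) := con 1ℚ :- t :+ t :* t) refl t)
  (0≤+ (0≤p² (t - ½)) (nonNegative⁻¹ (+ 3 / 4)))

1≤φ*φ- : ∀ t → 1ℚ ≤ φ t * φ (- t)
1≤φ*φ- t = subst (1ℚ ≤_)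
  (solve 1 (λ t → con 1ℚ :+ (t :* t :+ t :* t :* (t :* t)) :=
    (con 1ℚ :- t :+ t :* t) :* (con 1ℚ :- (:- t) :+ (:- t) :* (:- t))) refl t)
  (p≤p+q {1ℚ} (0≤+ (0≤p² t) (0≤p² (t * t))))

mean : ℚ → (Bool → ℚ) → ℚ
mean p u = p * u true + (1ℚ - p) * u false

p²≤1 : ∀ {p} → 0ℚ ≤ p → p ≤ 1ℚ → p * p ≤ 1ℚ
p²≤1 0≤p p≤1 = *-mono-≤₀ 0≤p 0≤1 p≤1 p≤1

-- The linear term of φ contributes - η (p - c). The quadratic one contributes η² times the second
-- moment about `c`, which is at most 1 because `c` and the bits lie in [0, 1].
mean-φ : ∀ {p c} η → 0ℚ ≤ p → p ≤ 1ℚ → 0ℚ ≤ c → c ≤ 1ℚ →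
  mean p (λ b → φ (η * (⟦ b ⟧ - c))) ≤ 1ℚ - η * (p - c) + η * η
mean-φ {p} {c} η 0≤p p≤1 0≤c c≤1 = begin
  mean p (λ b → φ (η * (⟦ b ⟧ - c)))
    ≡⟨ solve 3 (λ p c η → let t = η :* (con 1ℚ :- c) ; s = η :* (con 0ℚ :- c) in
         p :* (con 1ℚ :- t :+ t :* t) :+ (con 1ℚ :- p) :* (con 1ℚ :- s :+ s :* s) :=
         con 1ℚ :- η :* (p :- c) :+ η :* η :* (p :* ((con 1ℚ :- c) :* (con 1ℚ :- c)) :+ (con 1ℚ :- p) :* (c :* c)))
         refl p c η ⟩
  1ℚ - η * (p - c) + η * η * (p * ((1ℚ - c) * (1ℚ - c)) + (1ℚ - p) * (c * c))
    ≤⟨ +-monoʳ-≤ (1ℚ - η * (p - c)) (*-monoˡ-≤-nonNeg (η * η) {{nonNegative (0≤p² η)}} var≤1) ⟩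
  1ℚ - η * (p - c) + η * η * 1ℚ
    ≡⟨ cong (λ z → 1ℚ - η * (p - c) + z) (*-identityʳ (η * η)) ⟩
  1ℚ - η * (p - c) + η * η ∎
  where
  open ≤-Reasoning
  var≤1 : p * ((1ℚ - c) * (1ℚ - c)) + (1ℚ - p) * (c * c) ≤ 1ℚ
  var≤1 = ≤-trans (+-mono-≤
      (*-monoˡ-≤-nonNeg p {{nonNegative 0≤p}} (p²≤1 (p≤q⇒0≤q-p c≤1)
        (0≤q-p⇒p≤q (subst (0ℚ ≤_) (solve 1 (λ c → c := con 1ℚ :- (con 1ℚ :- c)) refl c) 0≤c))))
      (*-monoˡ-≤-nonNeg (1ℚ - p) {{nonNegative (p≤q⇒0≤q-p p≤1)}} (p²≤1 0≤c c≤1)))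
    (≤-reflexive (solve 1 (λ p → p :* con 1ℚ :+ (con 1ℚ :- p) :* con 1ℚ := con 1ℚ) refl p))

-- A certificate of small overlap: min (P, Q) ≤ P u + Q v wherever u v ≥ 1, and this condition
-- survives products. The ideal choice u = √(Q / P) = 1 / v would make both means the Hellinger
-- affinity.
record Test (p γ β : ℚ) : Set where
  field
    u v   : Bool → ℚ
    0≤u   : ∀ b → 0ℚ ≤ u b
    0≤v   : ∀ b → 0ℚ ≤ v b
    1≤u*v : ∀ b → 1ℚ ≤ u b * v b
    u≤β   : mean p u ≤ β
    v≤β   : mean γ v ≤ β

β : ℚ → ℚ
β e = 1ℚ - 1/16 * (e * e)

-- With `c` the midpoint of p and γ, both means are at most 1 - ½ η (p - γ) + η². For |p - γ| = e
-- this is smallest at |η| = e / 4 with the sign of p - γ, where it is 1 - e² / 8 + e² / 16; hence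
-- the 16 in `β`.
test : ∀ {p γ e} → 0ℚ ≤ p → p ≤ 1ℚ → 0ℚ ≤ γ → γ ≤ 1ℚ → 0ℚ ≤ e → e ≤ ∣ p - γ ∣ → Test p γ (β e)
test {p} {γ} {e} 0≤p p≤1 0≤γ γ≤1 0≤e e≤ = record
  { u = λ b → φ (η * (⟦ b ⟧ - c))
  ; v = λ b → φ (- (η * (⟦ b ⟧ - c)))
  ; 0≤u = λ b → φ-nonneg (η * (⟦ b ⟧ - c))
  ; 0≤v = λ b → φ-nonneg (- (η * (⟦ b ⟧ - c)))
  ; 1≤u*v = λ b → 1≤φ*φ- (η * (⟦ b ⟧ - c))
  ; u≤β = ≤-trans (mean-φ η 0≤p p≤1 0≤c c≤1) (≤-trans (≤-reflexive
      (solve 3 (λ η p g → con 1ℚ :- η :* (p :- con ½ :* (p :+ g)) :+ η :* η :=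
        con 1ℚ :- con ½ :* (η :* (p :- g)) :+ η :* η) refl η p γ)) exponent)
  ; v≤β = ≤-trans (≤-reflexive (cong₂ (λ a b → γ * φ a + (1ℚ - γ) * φ b)
        (neg-distribˡ-* η (1ℚ - c)) (neg-distribˡ-* η (0ℚ - c))))
      (≤-trans (mean-φ (- η) 0≤γ γ≤1 0≤c c≤1) (≤-trans (≤-reflexive
      (solve 3 (λ η p g → con 1ℚ :- (:- η) :* (g :- con ½ :* (p :+ g)) :+ (:- η) :* (:- η) :=
        con 1ℚ :- con ½ :* (η :* (p :- g)) :+ η :* η) refl η p γ)) exponent))
  }
  where
  open ≤-Reasoning
  c = ½ * (p + γ)
  0≤c : 0ℚ ≤ c
  0≤c = 0≤* 0≤½ (0≤+ 0≤p 0≤γ)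
  c≤1 : c ≤ 1ℚ
  c≤1 = *-monoˡ-≤-nonNeg ½ (+-mono-≤ p≤1 γ≤1)
  signed : ∃ λ η → η * (p - γ) ≡ ¼ * e * ∣ p - γ ∣ × η * η ≡ 1/16 * (e * e)
  signed with ∣p∣≡p∨∣p∣≡-p (p - γ)
  ... | inj₁ eq = ¼ * e , cong (¼ * e *_) (sym eq) ,
          solve 1 (λ e → con ¼ :* e :* (con ¼ :* e) := con 1/16 :* (e :* e)) refl e
  ... | inj₂ eq = - (¼ * e) , trans
          (solve 2 (λ a d → (:- a) :* d := a :* (:- d)) refl (¼ * e) (p - γ)) (cong (¼ * e *_) (sym eq)) ,
          solve 1 (λ e → (:- (con ¼ :* e)) :* (:- (con ¼ :* e)) := con 1/16 :* (e :* e)) refl e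
  η = proj₁ signed
  exponent : 1ℚ - ½ * (η * (p - γ)) + η * η ≤ β e
  exponent = begin
    1ℚ - ½ * (η * (p - γ)) + η * η
      ≡⟨ cong₂ (λ a b → 1ℚ - ½ * a + b) (proj₁ (proj₂ signed)) (proj₂ (proj₂ signed)) ⟩
    1ℚ - ½ * (¼ * e * ∣ p - γ ∣) + 1/16 * (e * e)
      ≤⟨ +-monoˡ-≤ (1/16 * (e * e)) (+-monoʳ-≤ 1ℚ (neg-antimono-≤ (*-monoˡ-≤-nonNeg ½
           (*-monoˡ-≤-nonNeg (¼ * e) {{nonNegative (0≤* {¼} (nonNegative⁻¹ ¼) 0≤e)}} e≤)))) ⟩
    1ℚ - ½ * (¼ * e * e) + 1/16 * (e * e)
      ≡⟨ solve 1 (λ e → con 1ℚ :- con ½ :* (con ¼ :* e :* e) :+ con 1/16 :* (e :* e) :=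
           con 1ℚ :- con 1/16 :* (e :* e)) refl e ⟩
    β e ∎

-- If u ≥ 1 then a ≤ a u. Otherwise u v ≥ 1 forces v ≥ 1, and q ≤ q v.
⊓-≤ : ∀ {a q u v} → 0ℚ ≤ a → 0ℚ ≤ q → 0ℚ ≤ u → 0ℚ ≤ v → 1ℚ ≤ u * v → a ⊓ q ≤ a * u + q * v
⊓-≤ {a} {q} {u} {v} 0≤a 0≤q 0≤u 0≤v 1≤uv with ≤-total 1ℚ u
... | inj₁ 1≤u = ≤-trans (p⊓q≤p a q) (≤-trans
        (subst (_≤ a * u) (*-identityʳ a) (*-monoˡ-≤-nonNeg a {{nonNegative 0≤a}} 1≤u)) (p≤p+q (0≤* 0≤q 0≤v)))
... | inj₂ u≤1 = ≤-trans (p⊓q≤q a q) (≤-trans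
        (subst (_≤ q * v) (*-identityʳ q) (*-monoˡ-≤-nonNeg q {{nonNegative 0≤q}}
          (≤-trans 1≤uv (subst (u * v ≤_) (*-identityˡ v) (*-monoʳ-≤-nonNeg v {{nonNegative 0≤v}} u≤1)))))
        (p≤q+p (0≤* 0≤a 0≤u)))

-- |a - b| = a + b - 2 (a ⊓ b)
tv-⊓ : ∀ {n} {P Q : Dist n} → Σ[ P ] ≡ 1ℚ → Σ[ Q ] ≡ 1ℚ → 1ℚ ≤ tv P Q + Σ[ (λ y → P y ⊓ Q y) ]
tv-⊓ {n} {P} {Q} ΣP ΣQ = begin
  1ℚ                                           ≡⟨⟩
  ½ * (1ℚ + 1ℚ)                                ≡⟨ cong₂ (λ a b → ½ * (a + b)) (sym ΣP) (sym ΣQ) ⟩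
  ½ * (Σ[ P ] + Σ[ Q ])                        ≡⟨ cong (½ *_) (sym (Σ-+ P Q)) ⟩
  ½ * Σ[ (λ y → P y + Q y) ]                   ≤⟨ *-monoˡ-≤-nonNeg ½ (Σ-mono pointwise) ⟩
  ½ * Σ[ (λ y → ∣ P y - Q y ∣ + (P y ⊓ Q y + P y ⊓ Q y)) ]
    ≡⟨ cong (½ *_) (trans (Σ-+ D (λ y → M y + M y)) (cong (λ z → Σ[ D ] + z) (Σ-+ M M))) ⟩
  ½ * (Σ[ D ] + (Σ[ M ] + Σ[ M ]))             ≡⟨ solve 2 (λ d m → con ½ :* (d :+ (m :+ m)) := con ½ :* d :+ m) refl Σ[ D ] Σ[ M ] ⟩
  ½ * Σ[ D ] + Σ[ M ] ∎
  where
  open ≤-Reasoning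
  D M : Bits n → ℚ
  D y = ∣ P y - Q y ∣
  M y = P y ⊓ Q y
  pointwise : ∀ y → P y + Q y ≤ D y + (M y + M y)
  pointwise y with ⊓-sel (P y) (Q y)
  ... | inj₁ e rewrite e = ≤-trans
    (≤-reflexive (solve 2 (λ p q → p :+ q := (:- (p :- q)) :+ (p :+ p)) refl (P y) (Q y)))
    (+-monoˡ-≤ (P y + P y) (-p≤∣p∣ (P y - Q y)))
  ... | inj₂ e rewrite e = ≤-trans
    (≤-reflexive (solve 2 (λ p q → p :+ q := (p :- q) :+ (q :+ q)) refl (P y) (Q y)))
    (+-monoˡ-≤ (Q y + Q y) (p≤∣p∣ (P y - Q y)))

-- Overlap of the image of `f` with the slice

module _ {m n k : ℕ} {γ : ℚ} (γn≡k : γ * ι n ≡ ι k) (0≤γ : 0ℚ ≤ γ) (γ<1 : γ < 1ℚ)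
  (f : Bits m → Bits n) (I : Fin n → Subset m) (dep : ∀ i → DependsOn (I i) (λ x → lookup (f x) i))
  {e : ℚ} (0≤e : 0ℚ ≤ e) (0≤β : 0ℚ ≤ β e)
  (far : ∀ i S ρ → e ≤ ∣ 𝔼 ½ (λ x → ⟦ lookup (f (merge S ρ x)) i ⟧) - γ ∣)
  where

  -- The tests depend on the assignment ρ, since it may decide on which side of γ the mean of an
  -- output lies. Each of the 2^|S| assignments contributes β^|R| once for the image of `f` and n +
  -- 1 times for `𝒟`.
  overlap-≤ : ∀ S R → AllPairs (λ i r → ¬ Meet I S i r) R →
    Σ[ (λ y → pushforward f (𝒰 m) y ⊓ 𝒟 n k y) ] ≤
    ι 2 ^ Subset.∣ S ∣ * ((1ℚ + ι (suc n)) * β e ^ length R)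
  overlap-≤ S R free = begin
    Σ[ (λ y → pushforward f (𝒰 m) y ⊓ 𝒟 n k y) ]
      ≡⟨ Σ-cong (λ y → cong (_⊓ 𝒟 n k y) (trans (pushforward-𝒰 f y) (𝔼-condition S _))) ⟩
    Σ[ (λ y → Σ⟨ S ⟩ (λ ρ → h * P ρ y) ⊓ 𝒟 n k y) ]
      ≤⟨ Σ-mono (λ y → Σ⟨⟩-⊓ S (0≤𝒟 y) (λ ρ → 0≤* 0≤h (0≤P ρ y))
           (λ ρ → ⊓-≤ (0≤* 0≤h (0≤P ρ y)) (0≤𝒟 y) (Πout-nonneg (0≤u ρ) R y) (Πout-nonneg (0≤v ρ) R y)
             (1≤Πout*Πout (u ρ) (v ρ) (1≤uv ρ) R y))) ⟩
    Σ[ (λ y → Σ⟨ S ⟩ (λ ρ → h * P ρ y * U ρ y + 𝒟 n k y * V ρ y)) ]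
      ≡⟨ Σ⟨⟩-Σ S (λ ρ y → h * P ρ y * U ρ y + 𝒟 n k y * V ρ y) ⟩
    Σ⟨ S ⟩ (λ ρ → Σ[ (λ y → h * P ρ y * U ρ y + 𝒟 n k y * V ρ y) ])
      ≤⟨ Σ⟨⟩-≤ S each ⟩
    ι 2 ^ Subset.∣ S ∣ * ((1ℚ + ι (suc n)) * β e ^ length R) ∎
    where
    open ≤-Reasoning
    h = ½ ^ Subset.∣ S ∣
    0≤h : 0ℚ ≤ h
    0≤h = ^-nonneg 0≤½ Subset.∣ S ∣
    ½≤1 : ½ ≤ 1ℚ
    ½≤1 = p≤p+q {½} 0≤½
    B = β e ^ length R
    0≤B : 0ℚ ≤ B
    0≤B = ^-nonneg 0≤β (length R)
    p : Bits m → Fin n → ℚ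
    p ρ i = 𝔼 ½ (λ x → ⟦ lookup (f (merge S ρ x)) i ⟧)
    P : Bits m → Bits n → ℚ
    P ρ y = 𝔼 ½ (λ x → ⟦ does (f (merge S ρ x) ≟ᵇ y) ⟧)
    𝔼½-nonneg : ∀ (g : Bits m → ℚ) → (∀ x → 0ℚ ≤ g x) → 0ℚ ≤ 𝔼 ½ g
    𝔼½-nonneg g 0≤g = subst (_≤ 𝔼 ½ g) (𝔼-const {m} ½ 0ℚ) (𝔼-mono 0≤½ ½≤1 0≤g)
    0≤P : ∀ ρ y → 0ℚ ≤ P ρ y
    0≤P ρ y = 𝔼½-nonneg _ (λ x → 0≤⟦ does (f (merge S ρ x) ≟ᵇ y) ⟧)
    0≤𝒟 : ∀ y → 0ℚ ≤ 𝒟 n k y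
    0≤𝒟 y with does (weight y ℕ.≟ k)
    ... | true  = recip-nonneg (length (filter (λ x → weight x ℕ.≟ k) (cube n)))
    ... | false = ≤-refl
    tests : ∀ ρ i → Test (p ρ i) γ (β e)
    tests ρ i = test (𝔼½-nonneg _ (λ x → 0≤⟦ lookup (f (merge S ρ x)) i ⟧))
      (subst (p ρ i ≤_) (𝔼-const {m} ½ 1ℚ) (𝔼-mono 0≤½ ½≤1 (λ x → ⟦ lookup (f (merge S ρ x)) i ⟧≤1)))
      0≤γ (<⇒≤ γ<1) 0≤e (far i S ρ)
    u v : Bits m → Fin n → Bool → ℚ
    u ρ i = Test.u (tests ρ i)
    v ρ i = Test.v (tests ρ i)
    0≤u : ∀ ρ i b → 0ℚ ≤ u ρ i b
    0≤u ρ i = Test.0≤u (tests ρ i)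
    0≤v : ∀ ρ i b → 0ℚ ≤ v ρ i b
    0≤v ρ i = Test.0≤v (tests ρ i)
    1≤uv : ∀ ρ i b → 1ℚ ≤ u ρ i b * v ρ i b
    1≤uv ρ i = Test.1≤u*v (tests ρ i)
    U V : Bits m → Bits n → ℚ
    U ρ = Πout (u ρ) R
    V ρ = Πout (v ρ) R
    U≤B : ∀ ρ → 𝔼 ½ (U ρ ∘ f ∘ merge S ρ) ≤ B
    U≤B ρ = 𝔼-Πout (f ∘ merge S ρ) (λ i → I i ─ S) (λ i → dependsOn-merge (dep i) S ρ) 0≤½ ½≤1 0≤β (0≤u ρ)
      (λ i → ≤-trans (≤-reflexive (𝔼-bool ½ (λ x → lookup (f (merge S ρ x)) i) (u ρ i))) (Test.u≤β (tests ρ i)))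
      R (AllPairs.map (λ ¬meet j hi hr → ¬meet (inj₂ (j , Subset.x∈p∩q⁺ (hi , hr)))) free)
    V≤B : ∀ ρ → 𝔼 γ (V ρ) ≤ B
    V≤B ρ = 𝔼-Πout (λ y → y) ⁅_⁆ (λ i x y e → e i (Subset.x∈⁅x⁆ i)) 0≤γ (<⇒≤ γ<1) 0≤β (0≤v ρ)
      (λ i → ≤-trans (≤-reflexive (trans (𝔼-bool γ (λ y → lookup y i) (v ρ i))
        (cong (λ z → z * v ρ i true + (1ℚ - z) * v ρ i false) (𝔼-lookup γ i)))) (Test.v≤β (tests ρ i)))
      R (AllPairs.map (λ {i} {r} ¬meet j hi hr → ¬meet (inj₁
        (trans (sym (Subset.x∈⁅y⁆⇒x≡y i hi)) (Subset.x∈⁅y⁆⇒x≡y r hr)))) free)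
    each : ∀ ρ → Σ[ (λ y → h * P ρ y * U ρ y + 𝒟 n k y * V ρ y) ] ≤ (1ℚ + ι (suc n)) * B
    each ρ = begin
      Σ[ (λ y → h * P ρ y * U ρ y + 𝒟 n k y * V ρ y) ]
        ≡⟨ Σ-+ (λ y → h * P ρ y * U ρ y) (λ y → 𝒟 n k y * V ρ y) ⟩
      Σ[ (λ y → h * P ρ y * U ρ y) ] + Σ[ (λ y → 𝒟 n k y * V ρ y) ]
        ≡⟨ cong (_+ Σ[ (λ y → 𝒟 n k y * V ρ y) ]) (trans
             (trans (Σ-cong (λ y → *-assoc h (P ρ y) (U ρ y))) (Σ-*ˡ h (λ y → P ρ y * U ρ y)))
             (cong (h *_) (Σ-law ½ (f ∘ merge S ρ) (U ρ)))) ⟩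
      h * 𝔼 ½ (U ρ ∘ f ∘ merge S ρ) + Σ[ (λ y → 𝒟 n k y * V ρ y) ]
        -- The weight 2^-|S| of the assignment is given away: the part from `𝒟` carries no such
        -- weight, and its bound is larger anyway.
        ≤⟨ +-mono-≤ (*-mono-≤₀ 0≤h 0≤B (^-≤1 0≤½ ½≤1 Subset.∣ S ∣) (U≤B ρ))
             (≤-trans (𝒟-≤-𝔼 γn≡k 0≤γ γ<1 (Πout-nonneg (0≤v ρ) R))
               (*-monoˡ-≤-nonNeg (ι (suc n)) {{nonNegative (ι-nonneg (suc n))}} (V≤B ρ))) ⟩
      1ℚ * B + ι (suc n) * B
        ≡⟨ sym (*-distribʳ-+ B 1ℚ (ι (suc n))) ⟩
      (1ℚ + ι (suc n)) * B ∎

-- Numerical estimates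

m≤[1+m/n]*n : ∀ m n .{{_ : ℕ.NonZero n}} → m ℕ.≤ suc (m ℕ./ n) ℕ.* n
m≤[1+m/n]*n m n = subst (ℕ._≤ suc (m ℕ./ n) ℕ.* n) (sym (ℕ.m≡m%n+[m/n]*n m n))
  (ℕ.+-monoˡ-≤ (m ℕ./ n ℕ.* n) (ℕ.<⇒≤ (ℕ.m%n<n m n)))

2^n*½^n : ∀ n → ι 2 ^ n * ½ ^ n ≡ 1ℚ
2^n*½^n n = trans (sym (^-distrib-* (ι 2) ½ n)) (1^n≡1 n)

/2^-½^ : ∀ z d → z /2^ d ≡ (z / 1) * ½ ^ d
/2^-½^ z d = begin
  z /2^ d                                  ≡⟨ sym (*-identityʳ (z /2^ d)) ⟩
  z /2^ d * 1ℚ                             ≡⟨ cong (z /2^ d *_) (sym (2^n*½^n d)) ⟩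
  z /2^ d * (ι 2 ^ d * ½ ^ d)              ≡⟨ sym (*-assoc (z /2^ d) (ι 2 ^ d) (½ ^ d)) ⟩
  z /2^ d * ι 2 ^ d * ½ ^ d                ≡⟨ cong (λ x → z /2^ d * x * ½ ^ d) (sym (ι-^ 2 d)) ⟩
  z /2^ d * ι (2 ℕ.^ d) * ½ ^ d            ≡⟨ cong (_* ½ ^ d) (/-*-cancel z (2 ℕ.^ d) {{ℕ.m^n≢0 2 d}}) ⟩
  (z / 1) * ½ ^ d ∎
  where open ≡-Reasoning

module _ (k n d : ℕ) .{{_ : ℕ.NonZero n}} where

  private
    γ e : ℚ
    γ = + k / n
    e = err γ d
    q = k ℕ.* 2 ℕ.^ d ℕ./ n

    scaled : γ * (ι n * ι 2 ^ d) ≡ ι (k ℕ.* 2 ℕ.^ d)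
    scaled = trans (sym (*-assoc γ (ι n) (ι 2 ^ d)))
      (trans (cong (_* ι 2 ^ d) (/-*-cancel (+ k) n))
        (trans (cong (ι k *_) (sym (ι-^ 2 d))) (sym (ι-* k (2 ℕ.^ d)))))

    scaled′ : ∀ j → ι j * ½ ^ d * (ι n * ι 2 ^ d) ≡ ι (j ℕ.* n)
    scaled′ j = trans
      (solve 4 (λ j h n t → j :* h :* (n :* t) := j :* n :* (t :* h)) refl (ι j) (½ ^ d) (ι n) (ι 2 ^ d))
      (trans (cong (ι j * ι n *_) (2^n*½^n d)) (trans (*-identityʳ (ι j * ι n)) (sym (ι-* j n))))

    scale-pos : Positive (ι n * ι 2 ^ d)
    scale-pos = pos*pos⇒pos (ι n) {{positive (ι-pos n)}} (ι 2 ^ d) {{positive (2^n-pos d)}}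

    lower : ι q * ½ ^ d ≤ γ
    lower = *-cancelʳ-≤-pos (ι n * ι 2 ^ d) {{scale-pos}} (subst₂ _≤_ (sym (scaled′ q)) (sym scaled)
      (ι-mono (ℕ.m/n*n≤m (k ℕ.* 2 ℕ.^ d) n)))

    upper : γ ≤ ι (suc q) * ½ ^ d
    upper = *-cancelʳ-≤-pos (ι n * ι 2 ^ d) {{scale-pos}} (subst₂ _≤_ (sym scaled) (sym (scaled′ (suc q)))
      (ι-mono (m≤[1+m/n]*n (k ℕ.* 2 ℕ.^ d) n)))

  -- γ lies between two neighbouring multiples of 2^-d, and its distances from them add up to 2^-d.
  err+err≤½^d : e + e ≤ ½ ^ d
  err+err≤½^d = ≤-trans
    (+-mono-≤ (≤-trans (err-least γ d (+ q)) (≤-reflexive (trans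
                (cong (λ x → ∣ γ - x ∣) (/2^-½^ (+ q) d)) (0≤p⇒∣p∣≡p (p≤q⇒0≤q-p lower)))))
              (≤-trans (err-least γ d (+ suc q)) (≤-reflexive (trans
                (cong (λ x → ∣ γ - x ∣) (/2^-½^ (+ suc q) d)) (∣γ-u∣ upper)))))
    (≤-reflexive (trans (cong (λ x → γ - ι q * ½ ^ d + (x * ½ ^ d - γ)) (ι-suc q))
      (solve 3 (λ g q h → g :- q :* h :+ ((con 1ℚ :+ q) :* h :- g) := h) refl γ (ι q) (½ ^ d))))
    where
    ∣γ-u∣ : ∀ {u} → γ ≤ u → ∣ γ - u ∣ ≡ u - γ
    ∣γ-u∣ {u} h = trans (sym (∣-p∣≡∣p∣ (γ - u)))
      (trans (cong ∣_∣ (solve 2 (λ g u → :- (g :- u) := u :- g) refl γ u)) (0≤p⇒∣p∣≡p (p≤q⇒0≤q-p h)))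

-- Bernoulli's inequality for powers of 1 / (1 - u), stated without division; the induction rests on
-- (1 - u) (1 + (K + 1) u) ≤ 1 + K u. Once K u ≥ 1, it gives (1 - u)^K ≤ ½.
bernoulli-inverse : ∀ {u} → 0ℚ ≤ u → u ≤ 1ℚ → ∀ K → (1ℚ - u) ^ K * (1ℚ + ι K * u) ≤ 1ℚ
bernoulli-inverse {u} 0≤u u≤1 zero = ≤-reflexive (solve 1 (λ u → con 1ℚ :* (con 1ℚ :+ con 0ℚ :* u) := con 1ℚ) refl u)
bernoulli-inverse {u} 0≤u u≤1 (suc K) = begin
  (1ℚ - u) * b * (1ℚ + ι (suc K) * u)
    ≡⟨ cong (λ x → (1ℚ - u) * b * (1ℚ + x * u)) (ι-suc K) ⟩
  (1ℚ - u) * b * (1ℚ + (1ℚ + ι K) * u)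
    ≡⟨ solve 3 (λ u b k → (con 1ℚ :- u) :* b :* (con 1ℚ :+ (con 1ℚ :+ k) :* u) :=
         b :* (con 1ℚ :+ k :* u :- (con 1ℚ :+ k) :* (u :* u))) refl u b (ι K) ⟩
  b * (1ℚ + ι K * u - (1ℚ + ι K) * (u * u))
    ≤⟨ *-monoˡ-≤-nonNeg b {{nonNegative (^-nonneg (p≤q⇒0≤q-p u≤1) K)}}
         (0≤q-p⇒p≤q (subst (0ℚ ≤_)
           (solve 2 (λ a b → b := a :- (a :- b)) refl (1ℚ + ι K * u) ((1ℚ + ι K) * (u * u)))
           (0≤* (0≤+ 0≤1 (ι-nonneg K)) (0≤p² u)))) ⟩
  b * (1ℚ + ι K * u)
    ≤⟨ bernoulli-inverse 0≤u u≤1 K ⟩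
  1ℚ ∎
  where
  open ≤-Reasoning
  b = (1ℚ - u) ^ K

-- For e = A / b the witness is M = 1 + ⌊b / A⌋, and then M e ≤ e + 1 ≤ 2.
reciprocal-approx : ∀ {e} → 0ℚ < e → e ≤ 1ℚ → ∃ λ M → 1ℚ ≤ ι M * e × ι M * e ≤ ι 2
reciprocal-approx {e@(mkℚ (+ suc a) b-1 c)} 0<e e≤1 = M , low , high
  where
  A = suc a
  b = suc b-1
  q = b ℕ./ A
  M = suc q
  e*b : e * ι b ≡ ι A
  e*b = trans (cong (_* ι b) (sym (↥p/↧p≡p e))) (/-*-cancel (+ A) b)
  M*e*b : ι M * e * ι b ≡ ι (M ℕ.* A)
  M*e*b = trans (*-assoc (ι M) e (ι b)) (trans (cong (ι M *_) e*b) (sym (ι-* M A)))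
  low : 1ℚ ≤ ι M * e
  low = *-cancelʳ-≤-pos (ι b) {{positive (ι-pos b)}} (subst₂ _≤_ (sym (*-identityˡ (ι b))) (sym M*e*b)
    (ι-mono {b} {M ℕ.* A} (m≤[1+m/n]*n b A)))
  high : ι M * e ≤ ι 2
  high = *-cancelʳ-≤-pos (ι b) {{positive (ι-pos b)}} (begin
    ι M * e * ι b        ≡⟨ M*e*b ⟩
    ι (A ℕ.+ q ℕ.* A)    ≡⟨ ι-+ A (q ℕ.* A) ⟩
    ι A + ι (q ℕ.* A)    ≤⟨ +-mono-≤ (≤-trans (≤-reflexive (sym e*b))
                              (*-monoʳ-≤-nonNeg (ι b) {{nonNegative (ι-nonneg b)}} e≤1))
                            (ι-mono (ℕ.m/n*n≤m b A)) ⟩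
    1ℚ * ι b + ι b       ≡⟨ solve 1 (λ b → con 1ℚ :* b :+ b := con (ι 2) :* b) refl (ι b) ⟩
    ι 2 * ι b ∎)
    where open ≤-Reasoning
reciprocal-approx {mkℚ (+ zero)    _ _} (*<* (ℤ.+<+ ())) _
reciprocal-approx {mkℚ ℤ.-[1+ _ ] _ _} (*<* ())         _

d≤2^d : ∀ d → d ℕ.≤ 2 ℕ.^ d
d≤2^d zero    = z≤n
d≤2^d (suc d) = ℕ.+-mono-≤ {1} (ℕ.m^n>0 2 d) (ℕ.≤-trans (d≤2^d d) (ℕ.≤-reflexive (sym (ℕ.+-identityʳ (2 ℕ.^ d)))))

-- The parameters of the packing for a gap e. Since 1 ≤ M e ≤ 2 and 2 e ≤ ½ ^ d, they are
-- bounded by a power of 1 / e whose exponent is linear in d.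
module Parameters {e : ℚ} {d : ℕ} (0<e : 0ℚ < e) (1≤d : 1 ℕ.≤ d) (2e≤½^d : e + e ≤ ½ ^ d) where

  0≤e : 0ℚ ≤ e
  0≤e = <⇒≤ 0<e

  ½≤1 : ½ ≤ 1ℚ
  ½≤1 = p≤p+q {½} 0≤½

  e≤¼ : e ≤ ¼
  e≤¼ = subst (_≤ ¼) (solve 1 (λ e → con ½ :* (e :+ e) := e) refl e)
    (*-monoˡ-≤-nonNeg ½ (≤-trans 2e≤½^d (^-anti-≤ 0≤½ ½≤1 1≤d)))

  e≤1 : e ≤ 1ℚ
  e≤1 = ≤-trans e≤¼ (p≤p+q {¼} {+ 3 / 4} (nonNegative⁻¹ (+ 3 / 4)))

  private
    approx = reciprocal-approx 0<e e≤1
  M K C : ℕ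
  M = proj₁ approx
  -- K e² / 16 = (M e)² ≥ 1 brings β^K down to ½. `C` is the number of outputs that `packing`
  -- demands per unit of w when it starts from the empty set at width d.
  K = 16 ℕ.* (M ℕ.* M)
  C = K ℕ.* (1 ℕ.+ d ℕ.* K) ℕ.^ d

  ιK : ι K ≡ ι 16 * (ι M * ι M)
  ιK = trans (ι-* 16 (M ℕ.* M)) (cong (ι 16 *_) (ι-* M M))

  0≤Me : 0ℚ ≤ ι M * e
  0≤Me = 0≤* (ι-nonneg M) 0≤e

  e²≤1 : e * e ≤ 1ℚ
  e²≤1 = p²≤1 0≤e e≤1

  0≤e²/16 : 0ℚ ≤ 1/16 * (e * e)
  0≤e²/16 = 0≤* {1/16} (nonNegative⁻¹ 1/16) (0≤p² e)

  e²/16≤1 : 1/16 * (e * e) ≤ 1ℚ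
  e²/16≤1 = ≤-trans (*-monoˡ-≤-nonNeg 1/16 e²≤1) (p≤p+q {1/16} {+ 15 / 16} (nonNegative⁻¹ (+ 15 / 16)))

  0≤β : 0ℚ ≤ β e
  0≤β = p≤q⇒0≤q-p e²/16≤1

  β≤1 : β e ≤ 1ℚ
  β≤1 = 0≤q-p⇒p≤q (subst (0ℚ ≤_) (solve 1 (λ u → u := con 1ℚ :- (con 1ℚ :- u)) refl (1/16 * (e * e))) 0≤e²/16)

  β^K≤½ : β e ^ K ≤ ½
  β^K≤½ = *-cancelʳ-≤-pos (ι 2) (≤-trans
    (*-monoˡ-≤-nonNeg (β e ^ K) {{nonNegative (^-nonneg 0≤β K)}} (+-monoʳ-≤ 1ℚ 1≤Ke²/16))
    (bernoulli-inverse 0≤e²/16 e²/16≤1 K))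
    where
    1≤Ke²/16 : 1ℚ ≤ ι K * (1/16 * (e * e))
    1≤Ke²/16 = ≤-trans
      (*-mono-≤₀ 0≤1 0≤Me (proj₁ (proj₂ approx)) (proj₁ (proj₂ approx)))
      (≤-reflexive (trans
        (solve 2 (λ m e → m :* e :* (m :* e) := con (ι 16) :* (m :* m) :* (con 1/16 :* (e :* e))) refl (ι M) e)
        (cong (_* (1/16 * (e * e))) (sym ιK))))

  β^-≤ : ∀ {r s} → K ℕ.* s ℕ.≤ r → β e ^ r ≤ ½ ^ s
  β^-≤ {r} {s} h = ≤-trans (^-anti-≤ 0≤β β≤1 h)
    (≤-trans (≤-reflexive (sym (^-assocʳ (β e) K s))) (^-mono-≤ (^-nonneg 0≤β K) β^K≤½ s))

  -- Two powers of e cancel M² up to a factor 4; the other three, at most 1 / 64, cancel 16 times 4.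
  K*e^5≤1 : ι K * e ^ 5 ≤ 1ℚ
  K*e^5≤1 = begin
    ι K * e ^ 5
      ≡⟨ cong (_* e ^ 5) ιK ⟩
    ι 16 * (ι M * ι M) * e ^ 5
      ≡⟨ solve 2 (λ m e → con (ι 16) :* (m :* m) :* (e :* (e :* (e :* (e :* (e :* con 1ℚ))))) :=
           con (ι 16) :* (m :* e :* (m :* e)) :* (e :* (e :* e))) refl (ι M) e ⟩
    ι 16 * (ι M * e * (ι M * e)) * (e * (e * e))
      ≤⟨ *-mono-≤₀ (0≤* {ι 16} (nonNegative⁻¹ (ι 16)) (0≤* 0≤Me 0≤Me)) (nonNegative⁻¹ (¼ * (¼ * ¼)))
           (*-monoˡ-≤-nonNeg (ι 16) (*-mono-≤₀ 0≤Me (nonNegative⁻¹ (ι 2)) (proj₂ (proj₂ approx)) (proj₂ (proj₂ approx))))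
           (*-mono-≤₀ 0≤e (nonNegative⁻¹ (¼ * ¼)) e≤¼ (*-mono-≤₀ 0≤e (nonNegative⁻¹ ¼) e≤¼ e≤¼)) ⟩
    ι 16 * (ι 2 * ι 2) * (¼ * (¼ * ¼))
      ≡⟨⟩
    1ℚ ∎
    where open ≤-Reasoning

  d*e≤½ : ι d * e ≤ ½
  d*e≤½ = begin
    ι d * e                  ≤⟨ *-monoʳ-≤-nonNeg e {{nonNegative 0≤e}} (ι-mono (d≤2^d d)) ⟩
    ι (2 ℕ.^ d) * e          ≡⟨ cong (_* e) (ι-^ 2 d) ⟩
    ι 2 ^ d * e              ≡⟨ solve 2 (λ t e → t :* e := con ½ :* (t :* (e :+ e))) refl (ι 2 ^ d) e ⟩
    ½ * (ι 2 ^ d * (e + e))  ≤⟨ *-monoˡ-≤-nonNeg ½ (*-monoˡ-≤-nonNeg (ι 2 ^ d)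
                                  {{nonNegative (<⇒≤ (2^n-pos d))}} 2e≤½^d) ⟩
    ½ * (ι 2 ^ d * ½ ^ d)    ≡⟨ cong (½ *_) (2^n*½^n d) ⟩
    ½ * 1ℚ ∎
    where open ≤-Reasoning

  [1+dK]*e^6≤1 : ι (1 ℕ.+ d ℕ.* K) * e ^ 6 ≤ 1ℚ
  [1+dK]*e^6≤1 = begin
    ι (1 ℕ.+ d ℕ.* K) * e ^ 6
      ≡⟨ cong (_* e ^ 6) (trans (ι-suc (d ℕ.* K)) (cong (λ x → 1ℚ + x) (ι-* d K))) ⟩
    (1ℚ + ι d * ι K) * (e * e ^ 5)
      ≡⟨ solve 4 (λ d k e x → (con 1ℚ :+ d :* k) :* (e :* x) := e :* x :+ d :* e :* (k :* x)) refl (ι d) (ι K) e (e ^ 5) ⟩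
    e * e ^ 5 + ι d * e * (ι K * e ^ 5)
      ≤⟨ +-mono-≤ (*-mono-≤₀ 0≤e 0≤1 (≤-trans e≤¼ (p≤p+q {¼} {¼} (nonNegative⁻¹ ¼))) (^-≤1 0≤e e≤1 5))
                  (*-mono-≤₀ (0≤* (ι-nonneg d) 0≤e) 0≤1 d*e≤½ K*e^5≤1) ⟩
    ½ * 1ℚ + ½ * 1ℚ
      ≡⟨⟩
    1ℚ ∎
    where open ≤-Reasoning

  C*e^≤1 : ι C * e ^ (5 ℕ.+ 6 ℕ.* d) ≤ 1ℚ
  C*e^≤1 = begin
    ι C * e ^ (5 ℕ.+ 6 ℕ.* d)
      ≡⟨ cong₂ _*_ (trans (ι-* K ((1 ℕ.+ d ℕ.* K) ℕ.^ d)) (cong (ι K *_) (ι-^ (1 ℕ.+ d ℕ.* K) d)))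
           (trans (^-homo-* e 5 (6 ℕ.* d)) (cong (e ^ 5 *_) (sym (^-assocʳ e 6 d)))) ⟩
    ι K * D ^ d * (e ^ 5 * (e ^ 6) ^ d)
      ≡⟨ solve 4 (λ k x y z → k :* x :* (y :* z) := k :* y :* (x :* z)) refl (ι K) (D ^ d) (e ^ 5) ((e ^ 6) ^ d) ⟩
    ι K * e ^ 5 * (D ^ d * (e ^ 6) ^ d)
      ≡⟨ cong (ι K * e ^ 5 *_) (sym (^-distrib-* D (e ^ 6) d)) ⟩
    ι K * e ^ 5 * (D * e ^ 6) ^ d
      ≤⟨ *-mono-≤₀ (0≤* (ι-nonneg K) (^-nonneg 0≤e 5)) 0≤1 K*e^5≤1
           (^-≤1 (0≤* (ι-nonneg (1 ℕ.+ d ℕ.* K)) (^-nonneg 0≤e 6)) [1+dK]*e^6≤1 d) ⟩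
    1ℚ ∎
    where
    open ≤-Reasoning
    D = ι (1 ℕ.+ d ℕ.* K)

  -- Since e ≤ ¼, (2 e)² ≤ e, so 20 d powers of e are available. As d ≥ 1, they cover the 5 + 6 d
  -- powers absorbed by `C` and one more, which supplies the ¼.
  C*[2e]^40d≤¼ : ι C * (e + e) ^ (40 ℕ.* d) ≤ ¼
  C*[2e]^40d≤¼ = begin
    ι C * (e + e) ^ (40 ℕ.* d)
      ≡⟨ cong (λ j → ι C * (e + e) ^ j) (ℕ.*-assoc 2 20 d) ⟩
    ι C * (e + e) ^ (2 ℕ.* (20 ℕ.* d))
      ≡⟨ cong (ι C *_) (sym (^-assocʳ (e + e) 2 (20 ℕ.* d))) ⟩
    ι C * ((e + e) ^ 2) ^ (20 ℕ.* d)
      ≤⟨ *-monoˡ-≤-nonNeg (ι C) {{nonNegative (ι-nonneg C)}}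
           (≤-trans (^-mono-≤ (0≤* (0≤+ 0≤e 0≤e) (0≤* (0≤+ 0≤e 0≤e) 0≤1)) 4e²≤e (20 ℕ.* d))
             (^-anti-≤ 0≤e e≤1 exponents)) ⟩
    ι C * (e * e ^ (5 ℕ.+ 6 ℕ.* d))
      ≡⟨ solve 3 (λ c e x → c :* (e :* x) := e :* (c :* x)) refl (ι C) e (e ^ (5 ℕ.+ 6 ℕ.* d)) ⟩
    e * (ι C * e ^ (5 ℕ.+ 6 ℕ.* d))
      ≤⟨ *-mono-≤₀ 0≤e 0≤1 e≤¼ C*e^≤1 ⟩
    ¼ * 1ℚ
      ≡⟨⟩
    ¼ ∎
    where
    open ≤-Reasoning
    4e²≤e : (e + e) ^ 2 ≤ e
    4e²≤e = ≤-trans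
      (≤-reflexive (solve 1 (λ e → (e :+ e) :* ((e :+ e) :* con 1ℚ) := con (ι 4) :* e :* e) refl e))
      (≤-trans (*-monoʳ-≤-nonNeg e {{nonNegative 0≤e}} (*-monoˡ-≤-nonNeg (ι 4) e≤¼))
        (≤-reflexive (*-identityˡ e)))
    exponents : 6 ℕ.+ 6 ℕ.* d ℕ.≤ 20 ℕ.* d
    exponents = ℕ.≤-trans (ℕ.+-monoˡ-≤ (6 ℕ.* d) (ℕ.*-monoʳ-≤ 6 1≤d))
      (ℕ.≤-trans (ℕ.≤-reflexive (sym (ℕ.*-distribʳ-+ d 6 6))) (ℕ.*-monoˡ-≤ d (ℕ.m≤m+n 12 8)))

  instance
    C≢0 : ℕ.NonZero C
    C≢0 = ℕ.m*n≢0 K ((1 ℕ.+ d ℕ.* K) ℕ.^ d) {{ℕ.m*n≢0 16 (M ℕ.* M) {{_}} {{M*M≢0}}}} {{ℕ.m^n≢0 (1 ℕ.+ d ℕ.* K) d}}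
      where
      M≢0 : ∀ M → 1ℚ ≤ ι M * e → ℕ.NonZero M
      M≢0 zero    h with () ← <-irrefl refl (<-≤-trans (positive⁻¹ 1ℚ) (≤-trans h (≤-reflexive (*-zeroˡ e))))
      M≢0 (suc M) h = _
      M*M≢0 : ℕ.NonZero (M ℕ.* M)
      M*M≢0 = ℕ.m*n≢0 M M {{M≢0 M (proj₁ (proj₂ approx))}} {{M≢0 M (proj₁ (proj₂ approx))}}

  n*[2e]^40d≤ : ∀ n → ι n * (e + e) ^ (40 ℕ.* d) ≤ ¼ * ι (suc (n ℕ./ C))
  n*[2e]^40d≤ n = begin
    ι n * x                ≤⟨ *-monoʳ-≤-nonNeg x {{nonNegative (^-nonneg (0≤+ 0≤e 0≤e) (40 ℕ.* d))}}
                                (ι-mono (m≤[1+m/n]*n n C)) ⟩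
    ι (w′ ℕ.* C) * x       ≡⟨ trans (cong (_* x) (ι-* w′ C)) (*-assoc (ι w′) (ι C) x) ⟩
    ι w′ * (ι C * x)       ≤⟨ *-monoˡ-≤-nonNeg (ι w′) {{nonNegative (ι-nonneg w′)}} C*[2e]^40d≤¼ ⟩
    ι w′ * ¼               ≡⟨ *-comm (ι w′) ¼ ⟩
    ¼ * ι w′ ∎
    where
    open ≤-Reasoning
    x = (e + e) ^ (40 ℕ.* d)
    w′ = suc (n ℕ./ C)

-- The distance bound for a rational gap

module _ {m n d k : ℕ} {γ e : ℚ} (γn≡k : γ * ι n ≡ ι k) (0≤γ : 0ℚ ≤ γ) (γ<1 : γ < 1ℚ)
  (f : Bits m → Bits n) (1≤d : 1 ℕ.≤ d) (local : IsLocal d f)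
  (0<e : 0ℚ < e) (2e≤½^d : e + e ≤ ½ ^ d) (e-least : ∀ z → e ≤ distTo γ d z) where

  private
    I = λ i → proj₁ (local i)

    dep : ∀ i → DependsOn (I i) (λ x → lookup (f x) i)
    dep i = proj₂ (proj₂ (local i))

    far : ∀ i S ρ → e ≤ ∣ 𝔼 ½ (λ x → ⟦ lookup (f (merge S ρ x)) i ⟧) - γ ∣
    far i S ρ with 𝔼-dyadic (λ x → lookup (f (merge S ρ x)) i) (dependsOn-merge (dep i) S ρ) d
                     (ℕ.≤-trans (Subset.∣p─q∣≤∣p∣ (I i) S) (proj₁ (proj₂ (local i))))
    ... | z , eq = ≤-trans (e-least z) (≤-reflexive (begin
      ∣ γ - z /2^ d ∣     ≡⟨ sym (∣-p∣≡∣p∣ (γ - z /2^ d)) ⟩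
      ∣ - (γ - z /2^ d) ∣ ≡⟨ cong ∣_∣ (solve 2 (λ g z → :- (g :- z) := z :- g) refl γ (z /2^ d)) ⟩
      ∣ z /2^ d - γ ∣     ≡⟨ cong (λ p → ∣ p - γ ∣) (trans (/2^-½^ z d) (sym eq)) ⟩
      ∣ 𝔼 ½ (λ x → ⟦ lookup (f (merge S ρ x)) i ⟧) - γ ∣ ∎))
      where open ≡-Reasoning

    open Parameters {e} {d} 0<e 1≤d 2e≤½^d

    w = n ℕ./ C

    Packing : Set
    Packing = ∃ λ S → ∃ λ R → AllPairs (λ i r → ¬ Meet I S i r) R × K ℕ.* (Subset.∣ S ∣ ℕ.+ w) ℕ.≤ length R

    fits : K ℕ.* ((1 ℕ.+ d ℕ.* K) ℕ.^ d ℕ.* (Subset.∣ ⊥ {m} ∣ ℕ.+ w)) ℕ.≤ n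
    fits = ℕ.≤-trans (ℕ.≤-reflexive (trans
        (cong (λ s → K ℕ.* ((1 ℕ.+ d ℕ.* K) ℕ.^ d ℕ.* (s ℕ.+ w))) (Subset.∣⊥∣≡0 m))
        (trans (sym (ℕ.*-assoc K ((1 ℕ.+ d ℕ.* K) ℕ.^ d) w)) (ℕ.*-comm C w))))
      (ℕ.m/n*n≤m n C)

    packed : Packing
    packed = packing I K w (λ i → proj₁ (proj₂ (local i))) d ⊥
      (λ i → ℕ.≤-trans (Subset.∣p─q∣≤∣p∣ (I i) ⊥) (proj₁ (proj₂ (local i)))) fits

    P Q : Dist n
    P = pushforward f (𝒰 m)
    Q = 𝒟 n k

    overlap-packed : Packing → Σ[ (λ y → P y ⊓ Q y) ] ≤ ι (2 ℕ.+ n) * ½ ^ w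
    overlap-packed (S , R , free , big) = begin
      Σ[ (λ y → P y ⊓ Q y) ]
        ≤⟨ overlap-≤ γn≡k 0≤γ γ<1 f I dep 0≤e 0≤β far S R free ⟩
      ι 2 ^ s * ((1ℚ + ι (suc n)) * β e ^ length R)
        ≤⟨ *-monoˡ-≤-nonNeg (ι 2 ^ s) {{nonNegative (<⇒≤ (2^n-pos s))}}
             (*-monoˡ-≤-nonNeg (1ℚ + ι (suc n)) {{nonNegative (0≤+ 0≤1 (ι-nonneg (suc n)))}}
               (β^-≤ {length R} {s ℕ.+ w} big)) ⟩
      ι 2 ^ s * ((1ℚ + ι (suc n)) * ½ ^ (s ℕ.+ w))
        ≡⟨ cong₂ (λ a b → ι 2 ^ s * (a * b)) (sym (ι-suc (suc n))) (^-homo-* ½ s w) ⟩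
      ι 2 ^ s * (ι (2 ℕ.+ n) * (½ ^ s * ½ ^ w))
        ≡⟨ solve 4 (λ t n h w → t :* (n :* (h :* w)) := t :* h :* (n :* w)) refl
             (ι 2 ^ s) (ι (2 ℕ.+ n)) (½ ^ s) (½ ^ w) ⟩
      ι 2 ^ s * ½ ^ s * (ι (2 ℕ.+ n) * ½ ^ w)
        ≡⟨ trans (cong (_* (ι (2 ℕ.+ n) * ½ ^ w)) (2^n*½^n s)) (*-identityˡ (ι (2 ℕ.+ n) * ½ ^ w)) ⟩
      ι (2 ℕ.+ n) * ½ ^ w ∎
      where
      open ≤-Reasoning
      s = Subset.∣ S ∣

  local-tv : 1ℚ ≤ tv (pushforward f (𝒰 m)) (𝒟 n k) + ι (2 ℕ.+ n) * ½ ^ w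
  local-tv = ≤-trans
    (tv-⊓ {P = P} {Q} (pushforward-total f) (uniformOn-total {n} (λ x → weight x ℕ.≟ k) (slice-pos {n} {k} γn≡k 0≤γ γ<1)))
    (+-monoʳ-≤ (tv P Q) (overlap-packed packed))

  local-tv-bound : ∃ λ w → 1ℚ ≤ tv (pushforward f (𝒰 m)) (𝒟 n k) + ι (2 ℕ.+ n) * ½ ^ w ×
    ι n * (e + e) ^ (40 ℕ.* d) ≤ ¼ * ι (suc w)
  local-tv-bound = w , local-tv , n*[2e]^40d≤ n

-- Lower bounds for the exponential series

archimedean : ∀ p → ∃ λ J → p ≤ ι J
archimedean p@(mkℚ n d-1 _) = ℤ.∣ n ∣ , *-cancelʳ-≤-pos (ι d) {{positive (ι-pos d)}} (begin
  p * ι d             ≡⟨ trans (cong (_* ι d) (sym (↥p/↧p≡p p))) (/-*-cancel n d) ⟩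
  n / 1               ≤⟨ n≤∣n∣ n ⟩
  ι ℤ.∣ n ∣           ≤⟨ ι-mono (ℕ.m≤m*n ℤ.∣ n ∣ d) ⟩
  ι (ℤ.∣ n ∣ ℕ.* d)   ≡⟨ ι-* ℤ.∣ n ∣ d ⟩
  ι ℤ.∣ n ∣ * ι d ∎)
  where
  open ≤-Reasoning
  d : ℕ
  d = suc d-1
  n≤∣n∣ : ∀ n → n / 1 ≤ ι ℤ.∣ n ∣
  n≤∣n∣ (+ a)    = ≤-refl
  n≤∣n∣ -[1+ a ] = ≤-trans (neg-antimono-≤ (ι-nonneg (suc a))) (ι-nonneg (suc a))

recip*ι : ∀ c .{{_ : ℕ.NonZero c}} → recip c * ι c ≡ 1ℚ
recip*ι c = recip-* c (ι c) refl (ι-pos c)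

archimedean-recip : ∀ Y {ε} → 0ℚ < ε → ∃ λ l → Y * recip (suc l) ≤ ε
archimedean-recip Y {ε} 0<ε = j , *-cancelʳ-≤-pos (ι (suc j)) {{positive (ι-pos (suc j))}} (begin
  Y * recip (suc j) * ι (suc j)
    ≡⟨ trans (*-assoc Y (recip (suc j)) (ι (suc j))) (trans (cong (Y *_) (recip*ι (suc j))) (*-identityʳ Y)) ⟩
  Y
    ≡⟨ sym (trans (cong (ε *_) (*-comm Y 1/ε))
         (trans (sym (*-assoc ε 1/ε Y)) (trans (cong (_* Y) (*-inverseʳ ε {{ε≢0}})) (*-identityˡ Y)))) ⟩
  ε * (Y * 1/ε)
    ≤⟨ *-monoˡ-≤-nonNeg ε {{nonNegative (<⇒≤ 0<ε)}} (≤-trans (proj₂ bound) (ι-mono (ℕ.n≤1+n j))) ⟩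
  ε * ι (suc j) ∎)
  where
  open ≤-Reasoning
  ε≢0 = pos⇒nonZero ε {{positive 0<ε}}
  1/ε = (1/ ε) {{ε≢0}}
  bound = archimedean (Y * 1/ε)
  j = proj₁ bound

expTerm-step : ∀ a k → ι (suc k) * expTerm a (suc k) ≡ a * expTerm a k
expTerm-step a k = trans
  (solve 3 (λ s x r → s :* (x :* r) := r :* s :* x) refl (ι (suc k)) (a * expTerm a k) (recip (suc k)))
  (trans (cong (_* (a * expTerm a k)) (recip*ι (suc k))) (*-identityˡ (a * expTerm a k)))

expTerm-nonneg : ∀ {B} → 0ℚ ≤ B → ∀ k → 0ℚ ≤ expTerm B k
expTerm-nonneg 0≤B zero    = 0≤1
expTerm-nonneg 0≤B (suc k) = 0≤* (0≤* 0≤B (expTerm-nonneg 0≤B k)) (recip-nonneg (suc k))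

∣expTerm∣≤ : ∀ {a B} → ∣ a ∣ ≤ B → ∀ k → ∣ expTerm a k ∣ ≤ expTerm B k
∣expTerm∣≤ h zero = ≤-refl
∣expTerm∣≤ {a} {B} h (suc k) = ≤-trans
  (≤-reflexive (trans (∣p*q∣≡∣p∣*∣q∣ (a * expTerm a k) (recip (suc k)))
    (cong₂ _*_ (∣p*q∣≡∣p∣*∣q∣ a (expTerm a k)) (0≤p⇒∣p∣≡p (recip-nonneg (suc k))))))
  (*-monoʳ-≤-nonNeg (recip (suc k)) {{nonNegative (recip-nonneg (suc k))}}
    (*-mono-≤₀ (0≤∣p∣ a) (expTerm-nonneg (≤-trans (0≤∣p∣ a) h) k) h (∣expTerm∣≤ h k)))

expSum-mono : ∀ {B} → 0ℚ ≤ B → ∀ {i j} → i ℕ.≤ j → expSum B i ≤ expSum B j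
expSum-mono {B} 0≤B {i} {j} h with ℕ.m≤n⇒m<n∨m≡n h
... | inj₂ refl = ≤-refl
expSum-mono {B} 0≤B {i} {suc j} h | inj₁ (s≤s h′) =
  ≤-trans (expSum-mono 0≤B h′) (p≤p+q (expTerm-nonneg 0≤B (suc j)))

expSum-0 : ∀ n → expSum 0ℚ n ≡ 1ℚ
expSum-0 zero    = refl
expSum-0 (suc n) = trans (cong (λ z → expSum 0ℚ n + z)
    (trans (cong (_* recip (suc n)) (*-zeroˡ (expTerm 0ℚ n))) (*-zeroˡ (recip (suc n)))))
  (trans (+-identityʳ (expSum 0ℚ n)) (expSum-0 n))

module _ {a h B : ℚ} (∣a∣≤B : ∣ a ∣ ≤ B) (∣a+h∣≤B : ∣ a + h ∣ ≤ B) where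

  private
    b = a + h
    t = expTerm B
    0≤B : 0ℚ ≤ B
    0≤B = ≤-trans (0≤∣p∣ a) ∣a∣≤B

    -- The Taylor remainder of second order of the series term of degree k + 1, whose derivative is
    -- the term of degree k.
    D : ℕ → ℚ
    D k = expTerm b (suc k) - expTerm a (suc k) - h * expTerm a k

    D-step : ∀ k → ι (2 ℕ.+ k) * D (suc k) ≡ b * D k + h * h * expTerm a k
    D-step k = begin
      s * (x′ - y′ - h * y)
        ≡⟨ solve 5 (λ s x y h z → s :* (x :- y :- h :* z) := s :* x :- s :* y :- h :* (s :* z)) refl s x′ y′ h y ⟩
      s * x′ - s * y′ - h * (s * y)
        ≡⟨ cong₂ (λ u v → u - v - h * (s * y)) (expTerm-step b (suc k)) (expTerm-step a (suc k)) ⟩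
      b * x - a * y - h * (s * y)
        ≡⟨ cong (λ u → b * x - a * y - h * u) (trans (cong (_* y) (ι-suc (suc k)))
             (trans (*-distribʳ-+ y 1ℚ (ι (suc k))) (cong (λ u → 1ℚ * y + u) (expTerm-step a k)))) ⟩
      b * x - a * y - h * (1ℚ * y + a * z)
        ≡⟨ solve 5 (λ a h x y z → (a :+ h) :* x :- a :* y :- h :* (con 1ℚ :* y :+ a :* z) :=
             (a :+ h) :* (x :- y :- h :* z) :+ h :* h :* z) refl a h x y z ⟩
      b * (x - y - h * z) + h * h * z ∎
      where
      open ≡-Reasoning
      s = ι (2 ℕ.+ k)
      x = expTerm b (suc k)
      y = expTerm a (suc k)
      z = expTerm a k
      x′ = expTerm b (2 ℕ.+ k)
      y′ = expTerm a (2 ℕ.+ k)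

    D0 : D 0 ≡ 0ℚ
    D0 = solve 2 (λ a h → (a :+ h) :* con 1ℚ :* con 1ℚ :- a :* con 1ℚ :* con 1ℚ :- h :* con 1ℚ := con 0ℚ) refl a h

    0≤h² : 0ℚ ≤ h * h
    0≤h² = 0≤p² h

    -- The hypothesis is shaped to serve both cases: at `k = 0` both of its sides vanish, and later
    -- it follows from the bound one degree lower, because B t (k) = (k + 1) t (k + 1).
    D-suc-≤ : ∀ k → B * ∣ D k ∣ ≤ h * h * (ι k * t k) → ∣ D (suc k) ∣ ≤ h * h * t k
    D-suc-≤ k ih = *-cancelˡ-≤-pos s {{positive (ι-pos (2 ℕ.+ k))}} (begin
      s * ∣ D (suc k) ∣
        ≡⟨ sym (trans (∣p*q∣≡∣p∣*∣q∣ s (D (suc k))) (cong (_* ∣ D (suc k) ∣) (0≤p⇒∣p∣≡p (ι-nonneg (2 ℕ.+ k))))) ⟩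
      ∣ s * D (suc k) ∣
        ≡⟨ cong ∣_∣ (D-step k) ⟩
      ∣ b * D k + h * h * expTerm a k ∣
        ≤⟨ ∣p+q∣≤∣p∣+∣q∣ (b * D k) (h * h * expTerm a k) ⟩
      ∣ b * D k ∣ + ∣ h * h * expTerm a k ∣
        ≡⟨ cong₂ _+_ (∣p*q∣≡∣p∣*∣q∣ b (D k)) (trans (∣p*q∣≡∣p∣*∣q∣ (h * h) (expTerm a k))
             (cong (_* ∣ expTerm a k ∣) (0≤p⇒∣p∣≡p 0≤h²))) ⟩
      ∣ b ∣ * ∣ D k ∣ + h * h * ∣ expTerm a k ∣
        ≤⟨ +-mono-≤ (≤-trans (*-monoʳ-≤-nonNeg ∣ D k ∣ {{nonNegative (0≤∣p∣ (D k))}} ∣a+h∣≤B) ih)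
             (*-monoˡ-≤-nonNeg (h * h) {{nonNegative 0≤h²}} (∣expTerm∣≤ ∣a∣≤B k)) ⟩
      h * h * (ι k * t k) + h * h * t k
        ≤⟨ p≤p+q (0≤* 0≤h² (expTerm-nonneg 0≤B k)) ⟩
      h * h * (ι k * t k) + h * h * t k + h * h * t k
        ≡⟨ solve 3 (λ h k t → h :* (k :* t) :+ h :* t :+ h :* t :=
             (con 1ℚ :+ (con 1ℚ :+ k)) :* (h :* t)) refl (h * h) (ι k) (t k) ⟩
      (1ℚ + (1ℚ + ι k)) * (h * h * t k)
        ≡⟨ cong (_* (h * h * t k)) (trans (cong (λ u → 1ℚ + u) (sym (ι-suc k))) (sym (ι-suc (suc k)))) ⟩
      s * (h * h * t k) ∎)
      where
      open ≤-Reasoning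
      s = ι (2 ℕ.+ k)

    D-≤ : ∀ k → ∣ D (suc k) ∣ ≤ h * h * t k
    D-≤ zero = D-suc-≤ zero (≤-reflexive (trans (cong (λ u → B * ∣ u ∣) D0)
      (solve 2 (λ b h → b :* con 0ℚ := h :* (con 0ℚ :* con 1ℚ)) refl B (h * h))))
    D-≤ (suc k) = D-suc-≤ (suc k) (begin
      B * ∣ D (suc k) ∣             ≤⟨ *-monoˡ-≤-nonNeg B {{nonNegative 0≤B}} (D-≤ k) ⟩
      B * (h * h * t k)             ≡⟨ solve 3 (λ b h t → b :* (h :* t) := h :* (b :* t)) refl B (h * h) (t k) ⟩
      h * h * (B * t k)             ≡⟨ cong (h * h *_) (sym (expTerm-step B k)) ⟩
      h * h * (ι (suc k) * t (suc k)) ∎)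
      where open ≤-Reasoning

  -- The linear term stops one degree earlier because differentiation lowers the degree of a partial
  -- sum. The estimate is the sum of the bounds on `D`, in which `D 0` vanishes.
  expSum-taylor : ∀ n →
    ∣ expSum (a + h) (2 ℕ.+ n) - expSum a (2 ℕ.+ n) - h * expSum a (suc n) ∣ ≤ h * h * expSum B n
  expSum-taylor zero = ≤-trans (≤-reflexive (cong ∣_∣ (trans
      (solve 5 (λ x x′ y y′ h → con 1ℚ :+ x :+ x′ :- (con 1ℚ :+ y :+ y′) :- h :* (con 1ℚ :+ y) :=
          (x :- y :- h :* con 1ℚ) :+ (x′ :- y′ :- h :* y)) refl
        (expTerm b 1) (expTerm b 2) (expTerm a 1) (expTerm a 2) h)
      (trans (cong (_+ D 1) D0) (+-identityˡ (D 1))))))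
    (D-≤ 0)
  expSum-taylor (suc n) = begin
    ∣ expSum b (2 ℕ.+ n) + x - (expSum a (2 ℕ.+ n) + y) - h * (expSum a (suc n) + z) ∣
      ≡⟨ cong ∣_∣ (solve 7 (λ p x q y h r z → p :+ x :- (q :+ y) :- h :* (r :+ z) :=
           (p :- q :- h :* r) :+ (x :- y :- h :* z)) refl
           (expSum b (2 ℕ.+ n)) x (expSum a (2 ℕ.+ n)) y h (expSum a (suc n)) z) ⟩
    ∣ (expSum b (2 ℕ.+ n) - expSum a (2 ℕ.+ n) - h * expSum a (suc n)) + D (2 ℕ.+ n) ∣
      ≤⟨ ∣p+q∣≤∣p∣+∣q∣ (expSum b (2 ℕ.+ n) - expSum a (2 ℕ.+ n) - h * expSum a (suc n)) (D (2 ℕ.+ n)) ⟩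
    ∣ expSum b (2 ℕ.+ n) - expSum a (2 ℕ.+ n) - h * expSum a (suc n) ∣ + ∣ D (2 ℕ.+ n) ∣
      ≤⟨ +-mono-≤ (expSum-taylor n) (D-≤ (suc n)) ⟩
    h * h * expSum B n + h * h * t (suc n)
      ≡⟨ sym (*-distribˡ-+ (h * h) (expSum B n) (t (suc n))) ⟩
    h * h * (expSum B n + t (suc n)) ∎
    where
    open ≤-Reasoning
    x = expTerm b (3 ℕ.+ n)
    y = expTerm a (3 ℕ.+ n)
    z = expTerm a (2 ℕ.+ n)

∣-p∣≤ : ∀ {p B} → 0ℚ ≤ p → p ≤ B → ∣ - p ∣ ≤ B
∣-p∣≤ {p} {B} 0≤p p≤B = subst (_≤ B) (sym (trans (∣-p∣≡∣p∣ p) (0≤p⇒∣p∣≡p 0≤p))) p≤B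

module _ {B : ℚ} (n : ℕ) where

  private
    N = 2 ℕ.+ n
    stepError : ℚ → ℚ
    stepError η = η * expTerm B N + η * η * expSum B N

  -- Taylor's estimate at - x with increment - η. The derivative lacks the term of degree N, which
  -- accounts for the first part of `stepError`; the second part is the remainder.
  expSum-step : ∀ {x η} → 0ℚ ≤ x → 0ℚ ≤ η → x + η ≤ B →
    (1ℚ - η) * expSum (- x) N ≤ expSum (- (x + η)) N + stepError η
  expSum-step {x} {η} 0≤x 0≤η x+η≤B = begin
    (1ℚ - η) * (r + τ)
      ≡⟨ solve 4 (λ η r τ b → (con 1ℚ :- η) :* (r :+ τ) :=
           b :+ (η :* (:- τ) :+ (:- (b :- (r :+ τ) :- (:- η) :* r)))) refl η r τ b ⟩
    b + (η * - τ + - (b - (r + τ) - (- η) * r))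
      ≤⟨ +-monoʳ-≤ b (+-mono-≤
           (*-monoˡ-≤-nonNeg η {{nonNegative 0≤η}} (≤-trans (-p≤∣p∣ τ) (∣expTerm∣≤ ∣-x∣≤B N)))
           (≤-trans (-p≤∣p∣ (b - (r + τ) - (- η) * r)) taylor)) ⟩
    b + (η * expTerm B N + η * η * expSum B N) ∎
    where
    open ≤-Reasoning
    r = expSum (- x) (suc n)
    τ = expTerm (- x) N
    b = expSum (- (x + η)) N
    0≤B : 0ℚ ≤ B
    0≤B = ≤-trans (0≤+ 0≤x 0≤η) x+η≤B
    ∣-x∣≤B : ∣ - x ∣ ≤ B
    ∣-x∣≤B = ∣-p∣≤ 0≤x (≤-trans (p≤p+q 0≤η) x+η≤B)
    negs : - x + - η ≡ - (x + η)
    negs = solve 2 (λ x η → (:- x) :+ (:- η) := :- (x :+ η)) refl x η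
    taylor : ∣ b - (r + τ) - (- η) * r ∣ ≤ η * η * expSum B N
    taylor = ≤-trans
      (subst (λ z → ∣ expSum z N - (r + τ) - (- η) * r ∣ ≤ (- η) * (- η) * expSum B n) negs
        (expSum-taylor { - x} { - η} {B} ∣-x∣≤B
          (subst (λ z → ∣ z ∣ ≤ B) (sym negs) (∣-p∣≤ (0≤+ 0≤x 0≤η) x+η≤B)) n))
      (≤-trans (≤-reflexive (cong (_* expSum B n) (solve 1 (λ η → (:- η) :* (:- η) := η :* η) refl η)))
        (*-monoˡ-≤-nonNeg (η * η) {{nonNegative (0≤p² η)}} (expSum-mono 0≤B (ℕ.m≤n+m n 2))))

  -- Euler's product approximates exp (- j η) through j steps from 0. Each step adds one
  -- `stepError`, and the factor 1 - η ≤ 1 keeps the earlier errors from growing.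
  expSum-iterate : ∀ {η} → 0ℚ ≤ B → 0ℚ ≤ η → η ≤ 1ℚ → ∀ j → ι j * η ≤ B →
    (1ℚ - η) ^ j ≤ expSum (- (ι j * η)) N + ι j * stepError η
  expSum-iterate {η} 0≤B 0≤η η≤1 zero    h = ≤-reflexive (sym (trans
    (cong₂ _+_ (trans (cong (λ z → expSum (- z) N) (*-zeroˡ η)) (expSum-0 N)) (*-zeroˡ (stepError η))) (+-identityʳ 1ℚ)))
  expSum-iterate {η} 0≤B 0≤η η≤1 (suc j) h = begin
    q * q ^ j
      ≤⟨ *-monoˡ-≤-nonNeg q {{nonNegative 0≤q}} (expSum-iterate 0≤B 0≤η η≤1 j (≤-trans (p≤p+q 0≤η) h′)) ⟩
    q * (E j + ι j * s)
      ≡⟨ *-distribˡ-+ q (E j) (ι j * s) ⟩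
    q * E j + q * (ι j * s)
      ≤⟨ +-mono-≤ (expSum-step (0≤* (ι-nonneg j) 0≤η) 0≤η h′)
           (*-monoʳ-≤-nonNeg (ι j * s) {{nonNegative (0≤* (ι-nonneg j) 0≤s)}} q≤1) ⟩
    expSum (- (ι j * η + η)) N + s + 1ℚ * (ι j * s)
      ≡⟨ solve 3 (λ e s j → e :+ s :+ con 1ℚ :* (j :* s) := e :+ (con 1ℚ :+ j) :* s) refl
           (expSum (- (ι j * η + η)) N) s (ι j) ⟩
    expSum (- (ι j * η + η)) N + (1ℚ + ι j) * s
      ≡⟨ cong₂ (λ x y → expSum (- x) N + y * s) (sym next) (sym (ι-suc j)) ⟩
    E (suc j) + ι (suc j) * s ∎
    where
    open ≤-Reasoning
    q = 1ℚ - η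
    s = stepError η
    E : ℕ → ℚ
    E j = expSum (- (ι j * η)) N
    0≤q : 0ℚ ≤ q
    0≤q = p≤q⇒0≤q-p η≤1
    q≤1 : q ≤ 1ℚ
    q≤1 = p≤r+q⇒p-q≤r {1ℚ} {η} {1ℚ} (p≤p+q {1ℚ} 0≤η)
    0≤s : 0ℚ ≤ s
    0≤s = 0≤+ (0≤* 0≤η (expTerm-nonneg 0≤B N))
      (0≤* (0≤p² η) (≤-trans 0≤1 (expSum-mono 0≤B {0} {N} z≤n)))
    next : ι (suc j) * η ≡ ι j * η + η
    next = trans (cong (_* η) (ι-suc j)) (solve 2 (λ j η → (con 1ℚ :+ j) :* η := j :* η :+ η) refl (ι j) η)
    h′ : ι j * η + η ≤ B
    h′ = subst (_≤ B) next h

bernoulli-≤ : ∀ {θ} → 0ℚ ≤ θ → θ ≤ 1ℚ → ∀ l → 1ℚ - ι l * θ ≤ (1ℚ - θ) ^ l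
bernoulli-≤ {θ} 0≤θ θ≤1 zero = ≤-reflexive (solve 1 (λ θ → con 1ℚ :- con 0ℚ :* θ := con 1ℚ) refl θ)
bernoulli-≤ {θ} 0≤θ θ≤1 (suc l) = begin
  1ℚ - ι (suc l) * θ
    ≡⟨ cong (λ x → 1ℚ - x * θ) (ι-suc l) ⟩
  1ℚ - (1ℚ + ι l) * θ
    ≤⟨ p≤p+q {1ℚ - (1ℚ + ι l) * θ} (0≤* (ι-nonneg l) (0≤p² θ)) ⟩
  1ℚ - (1ℚ + ι l) * θ + ι l * (θ * θ)
    ≡⟨ solve 2 (λ l θ → con 1ℚ :- (con 1ℚ :+ l) :* θ :+ l :* (θ :* θ) :=
         (con 1ℚ :- θ) :* (con 1ℚ :- l :* θ)) refl (ι l) θ ⟩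
  (1ℚ - θ) * (1ℚ - ι l * θ)
    ≤⟨ *-monoˡ-≤-nonNeg (1ℚ - θ) {{nonNegative (p≤q⇒0≤q-p θ≤1)}} (bernoulli-≤ 0≤θ θ≤1 l) ⟩
  (1ℚ - θ) * (1ℚ - θ) ^ l ∎
  where open ≤-Reasoning

¾ : ℚ
¾ = + 3 / 4

module _ (w : ℕ) where

  private
    w′ : ℕ
    w′ = suc w
    X c T : ℚ
    X = ¼ * ι w′
    c = ¾ ^ w′
    0≤X : 0ℚ ≤ X
    0≤X = 0≤* {¼} (nonNegative⁻¹ ¼) (ι-nonneg w′)
    0≤c : 0ℚ ≤ c
    0≤c = ^-nonneg {¾} (nonNegative⁻¹ ¾) w′
    ⅛ = + 1 / 8

    ^-pos : ∀ {p} → 0ℚ < p → ∀ n → 0ℚ < p ^ n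
    ^-pos 0<p zero    = positive⁻¹ 1ℚ
    ^-pos {p} 0<p (suc n) = positive⁻¹ (p * p ^ n)
      {{pos*pos⇒pos p {{positive 0<p}} (p ^ n) {{positive (^-pos 0<p n)}}}}

    0<⅛c : 0ℚ < ⅛ * c
    0<⅛c = positive⁻¹ (⅛ * c) {{pos*pos⇒pos ⅛ c {{positive (^-pos (positive⁻¹ ¾) w′)}}}}

    eˣ = exp (fromℚ X)

    bounded = cauchy eˣ 1ℚ (positive⁻¹ 1ℚ)
    -- The Cauchy modulus of `exp` at tolerance 1 bounds all late partial sums at `X` by `T`.
    T = expSum X (proj₁ bounded) + 1ℚ

    expSum≤T : ∀ i → proj₁ bounded ℕ.≤ i → expSum X i ≤ T
    expSum≤T i h = subst (expSum X i ≤_) (+-comm 1ℚ (expSum X (proj₁ bounded)))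
      (p-q≤r⇒p≤r+q {expSum X i} {expSum X (proj₁ bounded)} {1ℚ}
        (≤-trans (p≤∣p∣ (expSum X i - expSum X (proj₁ bounded))) (proj₂ bounded i (proj₁ bounded) h ℕ.≤-refl)))

    0≤T : 0ℚ ≤ T
    0≤T = 0≤+ (≤-trans 0≤1 (expSum-mono 0≤X {0} {proj₁ bounded} z≤n)) 0≤1

    -- `l` is chosen so large that the quadratic error X θ T, where θ = ¼ / l, is at most c / 8.
    fine = archimedean-recip (X * (¼ * T)) 0<⅛c
    l : ℕ
    l = suc (proj₁ fine)

    0<X : 0ℚ < X
    0<X = positive⁻¹ X {{pos*pos⇒pos ¼ (ι w′) {{positive (ι-pos w′)}}}}
    X≢0 = pos⇒nonZero X {{positive 0<X}}
    1/X = (1/ X) {{X≢0}}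
    κ = 1/X * (⅛ * c)
    0<κ : 0ℚ < κ
    0<κ = positive⁻¹ κ {{pos*pos⇒pos 1/X {{1/pos⇒pos X {{positive 0<X}}}} (⅛ * c) {{positive 0<⅛c}}}}
    Xκ : X * κ ≡ ⅛ * c
    Xκ = trans (sym (*-assoc X 1/X (⅛ * c))) (trans (cong (_* (⅛ * c)) (*-inverseʳ X {{X≢0}})) (*-identityˡ (⅛ * c)))

    small = cauchy eˣ κ 0<κ

    -- A term is the difference of consecutive partial sums, so the Cauchy modulus at κ = c / (8 X)
    -- controls it. This makes the linear error at most c / 8.
    expTerm≤κ : ∀ i → proj₁ small ℕ.≤ i → expTerm X (suc i) ≤ κ
    expTerm≤κ i h = ≤-trans
      (≤-reflexive (solve 2 (λ s t → t := s :+ t :- s) refl (expSum X i) (expTerm X (suc i))))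
      (≤-trans (p≤∣p∣ (expSum X (suc i) - expSum X i)) (proj₂ small (suc i) i (ℕ.m≤n⇒m≤1+n h) h))

    θ : ℚ
    θ = ¼ * recip l

    lθ : ι l * θ ≡ ¼
    lθ = trans (solve 2 (λ l r → l :* (con ¼ :* r) := con ¼ :* (r :* l)) refl (ι l) (recip l))
      (trans (cong (¼ *_) (recip*ι l)) (*-identityʳ ¼))

    0≤θ : 0ℚ ≤ θ
    0≤θ = 0≤* {¼} (nonNegative⁻¹ ¼) (recip-nonneg l)

    θ≤1 : θ ≤ 1ℚ
    θ≤1 = ≤-trans (subst (_≤ ι l * θ) (*-identityˡ θ) (*-monoʳ-≤-nonNeg θ {{nonNegative 0≤θ}} (ι-mono {1} {l} (s≤s z≤n))))
      (≤-trans (≤-reflexive lθ) (p≤p+q {¼} {¾} (nonNegative⁻¹ ¾)))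

    L = l ℕ.* w′

    c≤ : ∀ {η} → η ≤ θ → c ≤ (1ℚ - η) ^ L
    c≤ {η} η≤θ = begin
      ¾ ^ w′                 ≡⟨ cong (λ x → (1ℚ - x) ^ w′) (sym lθ) ⟩
      (1ℚ - ι l * θ) ^ w′    ≤⟨ ^-mono-≤ (subst (λ x → 0ℚ ≤ 1ℚ - x) (sym lθ) (nonNegative⁻¹ (1ℚ - ¼)))
                                  (bernoulli-≤ 0≤θ θ≤1 l) w′ ⟩
      ((1ℚ - θ) ^ l) ^ w′    ≡⟨ ^-assocʳ (1ℚ - θ) l w′ ⟩
      (1ℚ - θ) ^ L           ≤⟨ ^-mono-≤ (p≤q⇒0≤q-p θ≤1) (+-monoʳ-≤ 1ℚ (neg-antimono-≤ η≤θ)) L ⟩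
      (1ℚ - η) ^ L ∎
      where open ≤-Reasoning

    N₀ = 2 ℕ.+ (proj₁ bounded ℕ.+ proj₁ small)

    bound : ∀ n → proj₁ bounded ℕ.≤ 2 ℕ.+ n → proj₁ small ℕ.≤ suc n → ∀ {x} → 0ℚ ≤ x → x ≤ X →
      ¾ * c ≤ expSum (- x) (2 ℕ.+ n)
    bound n hT ht {x} 0≤x x≤X = subst (_≤ expSum (- x) N)
      (solve 1 (λ c → c :- (con ⅛ :* c :+ con ⅛ :* c) := con ¾ :* c) refl c)
      (p≤r+q⇒p-q≤r {c} {⅛ * c + ⅛ * c} {expSum (- x) N} (begin
        c
          ≤⟨ c≤ η≤θ ⟩
        (1ℚ - η) ^ L
          ≤⟨ expSum-iterate n 0≤X 0≤η (≤-trans η≤θ θ≤1) L (≤-trans (≤-reflexive Lη) x≤X) ⟩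
        expSum (- (ι L * η)) N + ι L * (η * t + η * η * expSum X N)
          ≡⟨ cong₂ (λ y z → expSum (- y) N + z) Lη (trans
               (solve 4 (λ L η t s → L :* (η :* t :+ η :* η :* s) := L :* η :* t :+ L :* η :* (η :* s)) refl
                 (ι L) η t (expSum X N))
               (cong (λ y → y * t + y * (η * expSum X N)) Lη)) ⟩
        expSum (- x) N + (x * t + x * (η * expSum X N))
          ≤⟨ +-monoʳ-≤ (expSum (- x) N) (+-mono-≤
               (*-mono-≤₀ 0≤x (<⇒≤ 0<κ) x≤X (expTerm≤κ (suc n) ht))
               (*-mono-≤₀ 0≤x (0≤* 0≤θ 0≤T) x≤X (*-mono-≤₀ 0≤η 0≤T η≤θ (expSum≤T N hT)))) ⟩
        expSum (- x) N + (X * κ + X * (θ * T))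
          ≡⟨ cong₂ (λ y z → expSum (- x) N + (y + z)) Xκ
               (solve 3 (λ x r t → x :* (con ¼ :* r :* t) := x :* (con ¼ :* t) :* r) refl X (recip l) T) ⟩
        expSum (- x) N + (⅛ * c + X * (¼ * T) * recip l)
          ≤⟨ +-monoʳ-≤ (expSum (- x) N) (+-monoʳ-≤ (⅛ * c) (proj₂ fine)) ⟩
        expSum (- x) N + (⅛ * c + ⅛ * c) ∎))
      where
      open ≤-Reasoning
      N = 2 ℕ.+ n
      t = expTerm X N
      η = x * recip w′ * recip l
      0≤η : 0ℚ ≤ η
      0≤η = 0≤* (0≤* 0≤x (recip-nonneg w′)) (recip-nonneg l)
      η≤θ : η ≤ θ
      η≤θ = *-monoʳ-≤-nonNeg (recip l) {{nonNegative (recip-nonneg l)}} (≤-trans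
        (*-monoʳ-≤-nonNeg (recip w′) {{nonNegative (recip-nonneg w′)}} x≤X)
        (≤-reflexive (trans (solve 2 (λ w r → con ¼ :* w :* r := con ¼ :* (r :* w)) refl (ι w′) (recip w′))
          (trans (cong (¼ *_) (recip*ι w′)) (*-identityʳ ¼)))))
      Lη : ι L * η ≡ x
      Lη = trans (cong (_* η) (ι-* l w′))
        (trans (solve 5 (λ l w x r s → l :* w :* (x :* r :* s) := x :* ((r :* w) :* (s :* l))) refl
            (ι l) (ι w′) x (recip w′) (recip l))
          (trans (cong₂ (λ a b → x * (a * b)) (recip*ι w′) (recip*ι l)) (*-identityʳ x)))

  -- The threshold must not depend on x, which will move with the index. Cut x into l (w + 1) steps
  -- of length at most θ. Bernoulli's inequality gives (1 - θ)^l ≥ 1 - l θ = ¾ whatever `l` is, so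
  -- Euler's product is at least c = ¾^(w + 1). The two errors take away at most c / 8 each, which
  -- leaves ¾ c.
  exp-lower : ∃ λ N → ∀ i → N ℕ.≤ i → ∀ {x} → 0ℚ ≤ x → x ≤ ¼ * ι (suc w) →
    ¾ * ¾ ^ suc w ≤ expSum (- x) i
  exp-lower = N₀ , λ where
    (suc (suc n)) (s≤s (s≤s h)) → bound n
      (ℕ.≤-trans (ℕ.m+n≤o⇒m≤o (proj₁ bounded) h) (ℕ.m≤n+m n 2))
      (ℕ.m≤n⇒m≤1+n (ℕ.m+n≤o⇒n≤o (proj₁ bounded) h))

-- Square roots and the final estimate

isqrt-bounds : ∀ a .{{_ : ℕ.NonZero a}} → 1 ℕ.≤ isqrt a × a ℕ.≤ 4 ℕ.* (isqrt a ℕ.* isqrt a)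
isqrt-bounds a@(suc _) = 1≤p , (begin
  a                                      ≤⟨ ℕ.<⇒≤ (proj₂ (isqrt-spec a)) ⟩
  suc p ℕ.* suc p                        ≤⟨ ℕ.*-mono-≤ suc-p≤ suc-p≤ ⟩
  (p ℕ.+ p) ℕ.* (p ℕ.+ p)                ≡⟨ ℕ-Solver.solve 1 (λ p → (p ℕ-Solver.:+ p) ℕ-Solver.:* (p ℕ-Solver.:+ p)
                                              ℕ-Solver.:= ℕ-Solver.con 4 ℕ-Solver.:* (p ℕ-Solver.:* p)) refl p ⟩
  4 ℕ.* (p ℕ.* p) ∎)
  where
  open ℕ.≤-Reasoning
  p = isqrt a
  1≤p : 1 ℕ.≤ p
  1≤p with isqrt a | isqrt-spec a
  ... | zero  | _ , s≤s ()
  ... | suc _ | _ = s≤s z≤n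
  suc-p≤ : suc p ℕ.≤ p ℕ.+ p
  suc-p≤ = ℕ.+-monoˡ-≤ p 1≤p

sqrtApprox-nonneg : ∀ a i → 0ℚ ≤ sqrtApprox a i
sqrtApprox-nonneg a i = nonNegative⁻¹ _ {{normalize-nonNeg (isqrt (a ℕ.* (suc i ℕ.* suc i))) (suc i)}}

-- The factor 4 is crude but makes the bound true at every index, without a limit: a rounded root p
-- ≥ 1 satisfies p + 1 ≤ 2 p.
≤4*sqrtApprox² : ∀ a .{{_ : ℕ.NonZero a}} i → ι a ≤ ι 4 * (sqrtApprox a i * sqrtApprox a i)
≤4*sqrtApprox² a i = *-cancelʳ-≤-pos (ι I * ι I)
  {{pos*pos⇒pos (ι I) {{positive (ι-pos I)}} (ι I) {{positive (ι-pos I)}}}} (begin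
  ι a * (ι I * ι I)              ≡⟨ trans (cong (ι a *_) (sym (ι-* I I))) (sym (ι-* a (I ℕ.* I))) ⟩
  ι (a ℕ.* (I ℕ.* I))            ≤⟨ ι-mono (proj₂ (isqrt-bounds (a ℕ.* (I ℕ.* I)) {{ℕ.m*n≢0 a (I ℕ.* I)}})) ⟩
  ι (4 ℕ.* (p ℕ.* p))            ≡⟨ trans (ι-* 4 (p ℕ.* p)) (cong (ι 4 *_) (ι-* p p)) ⟩
  ι 4 * (ι p * ι p)              ≡⟨ cong (λ x → ι 4 * (x * x)) (sym (/-*-cancel (+ p) I)) ⟩
  ι 4 * (s * ι I * (s * ι I))    ≡⟨ solve 3 (λ c s i → c :* (s :* i :* (s :* i)) := c :* (s :* s) :* (i :* i)) refl (ι 4) s (ι I) ⟩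
  ι 4 * (s * s) * (ι I * ι I) ∎)
  where
  open ≤-Reasoning
  I : ℕ
  I = suc i
  p = isqrt (a ℕ.* (I ℕ.* I))
  s = sqrtApprox a i

seq-^ : ∀ x j i → seq (x ^ᴿ j) i ≡ seq x i ^ j
seq-^ x zero    i = refl
seq-^ x (suc j) i = cong (seq x i *_) (seq-^ x j i)

tv-nonneg : ∀ {n} (P Q : Dist n) → 0ℚ ≤ tv P Q
tv-nonneg {n} P Q = 0≤* 0≤½ (subst (_≤ Σ[ (λ y → ∣ P y - Q y ∣) ]) (Σ-zero {n} (λ _ → 0ℚ) (λ _ → refl))
  (Σ-mono (λ y → 0≤∣p∣ (P y - Q y))))

-- ½ ≤ ¾², and the factor 4 outweighs the two extra factors ¾ below u: 4 (¾ ¾)² = 81 / 64 = 1 + 17 /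
-- 64.
½^w≤4u² : ∀ w {u} → ¾ * ¾ ^ suc w ≤ u → ½ ^ w ≤ ι 4 * (u * u)
½^w≤4u² w {u} h = begin
  ½ ^ w                                        ≤⟨ ^-mono-≤ 0≤½ (p≤p+q {½} {+ 1 / 16} (nonNegative⁻¹ (+ 1 / 16))) w ⟩
  (¾ * ¾) ^ w                                  ≡⟨ ^-distrib-* ¾ ¾ w ⟩
  ¾ ^ w * ¾ ^ w                                ≤⟨ p≤p+q (0≤* {+ 17 / 64} (nonNegative⁻¹ (+ 17 / 64)) (0≤p² (¾ ^ w))) ⟩
  ¾ ^ w * ¾ ^ w + (+ 17 / 64) * (¾ ^ w * ¾ ^ w)
    ≡⟨ solve 1 (λ x → x :* x :+ con (+ 17 / 64) :* (x :* x) :=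
         con (ι 4) :* (con ¾ :* (con ¾ :* x) :* (con ¾ :* (con ¾ :* x)))) refl (¾ ^ w) ⟩
  ι 4 * (¾ * ¾ ^ suc w * (¾ * ¾ ^ suc w))      ≤⟨ *-monoˡ-≤-nonNeg (ι 4) (*-mono-≤₀ 0≤x (≤-trans 0≤x h) h h) ⟩
  ι 4 * (u * u) ∎
  where
  open ≤-Reasoning
  0≤x : 0ℚ ≤ ¾ * ¾ ^ suc w
  0≤x = 0≤* {¾} (nonNegative⁻¹ ¾) (^-nonneg {¾} (nonNegative⁻¹ ¾) (suc w))

-- If 4 s u ≤ 1 then A h ≤ (4 s u)² ≤ 4 s u.
combine : ∀ {t A h s u} → 0ℚ ≤ t → 0ℚ ≤ s → 0ℚ ≤ u → 0ℚ ≤ h → 1ℚ ≤ t + A * h →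
  A ≤ ι 4 * (s * s) → h ≤ ι 4 * (u * u) → 1ℚ ≤ t + ι 4 * s * u
combine {t} {A} {h} {s} {u} 0≤t 0≤s 0≤u 0≤h 1≤t+Ah A≤ h≤ with ≤-total 1ℚ (ι 4 * s * u)
... | inj₁ 1≤ = ≤-trans 1≤ (p≤q+p 0≤t)
... | inj₂ ≤1 = ≤-trans 1≤t+Ah (+-monoʳ-≤ t (begin
  A * h                              ≤⟨ Ah≤ ⟩
  ι 4 * (s * s) * (ι 4 * (u * u))    ≡⟨ solve 3 (λ c s u → c :* (s :* s) :* (c :* (u :* u)) :=
                                          c :* s :* u :* (c :* s :* u)) refl (ι 4) s u ⟩
  ι 4 * s * u * (ι 4 * s * u)        ≤⟨ *-monoʳ-≤-nonNeg (ι 4 * s * u) {{nonNegative 0≤4su}} ≤1 ⟩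
  1ℚ * (ι 4 * s * u)                 ≡⟨ *-identityˡ (ι 4 * s * u) ⟩
  ι 4 * s * u ∎))
  where
  open ≤-Reasoning
  0≤4su : 0ℚ ≤ ι 4 * s * u
  0≤4su = 0≤* (0≤* {ι 4} (nonNegative⁻¹ (ι 4)) 0≤s) 0≤u
  Ah≤ : A * h ≤ ι 4 * (s * s) * (ι 4 * (u * u))
  Ah≤ = ≤-trans (*-monoʳ-≤-nonNeg h {{nonNegative 0≤h}} A≤)
    (*-monoˡ-≤-nonNeg (ι 4 * (s * s)) {{nonNegative (0≤* {ι 4} (nonNegative⁻¹ (ι 4)) (0≤p² s))}} h≤)

module _ {n d : ℕ} {e t : ℚ} (w : ℕ) (2≤n : 2 ℕ.≤ n) (0≤t : 0ℚ ≤ t)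
  (1≤t+ : 1ℚ ≤ t + ι (2 ℕ.+ n) * ½ ^ w) (x≤ : ι n * (e + e) ^ (40 ℕ.* d) ≤ ¼ * ι (suc w))
  (δ : ℝ) (0<δ : fromℚ 0ℚ <ᴿ δ) (δ≤2e : ∃ λ N → ∀ i → N ℕ.≤ i → seq δ i ≤ e + e) where

  1-4√2n*exp≤ : fromℕ 1 -ᴿ fromℕ 4 *ᴿ √ (2 ℕ.* n) *ᴿ exp (-ᴿ (fromℕ n *ᴿ δ ^ᴿ (40 ℕ.* d))) ≤ᴿ fromℚ t
  1-4√2n*exp≤ ε 0<ε = N₁ ℕ.+ (N₂ ℕ.+ N₃) , λ i N≤i →
    let s = sqrtApprox (2 ℕ.* n) i
        x = ι n * seq δ i ^ (40 ℕ.* d)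
        N₂₃≤i = ℕ.m+n≤o⇒n≤o N₁ N≤i
        0≤δᵢ = δ-nonneg i (ℕ.m+n≤o⇒m≤o N₁ N≤i)
        0≤x = 0≤* (ι-nonneg n) (^-nonneg 0≤δᵢ (40 ℕ.* d))
        x≤X = ≤-trans (*-monoˡ-≤-nonNeg (ι n) {{nonNegative (ι-nonneg n)}}
                (^-mono-≤ 0≤δᵢ (proj₂ δ≤2e i (ℕ.m+n≤o⇒m≤o N₂ N₂₃≤i)) (40 ℕ.* d))) x≤
        lower = proj₂ (exp-lower w) i (ℕ.m+n≤o⇒n≤o N₂ N₂₃≤i) 0≤x x≤X
    in subst (λ y → 1ℚ - ι 4 * s * expSum (- (ι n * y)) i ≤ t + ε) (sym (seq-^ δ (40 ℕ.* d) i))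
         (≤-trans (p≤r+q⇒p-q≤r {1ℚ} {ι 4 * s * expSum (- x) i} {t}
           (combine {t} {ι (2 ℕ.+ n)} {½ ^ w} {s} {expSum (- x) i} 0≤t (sqrtApprox-nonneg (2 ℕ.* n) i)
             (≤-trans 0≤low lower) (^-nonneg 0≤½ w) 1≤t+ (2+n≤ i) (½^w≤4u² w lower)))
           (p≤p+q (<⇒≤ 0<ε)))
    where
    N₁ = proj₁ (proj₂ (proj₂ 0<δ))
    N₂ = proj₁ δ≤2e
    N₃ = proj₁ (exp-lower w)
    δ-nonneg : ∀ i → N₁ ℕ.≤ i → 0ℚ ≤ seq δ i
    δ-nonneg i h = ≤-trans (≤-trans (<⇒≤ (proj₁ (proj₂ 0<δ))) (≤-reflexive (sym (+-identityˡ (proj₁ 0<δ)))))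
      (proj₂ (proj₂ (proj₂ 0<δ)) i h)
    0≤low : 0ℚ ≤ ¾ * ¾ ^ suc w
    0≤low = 0≤* {¾} (nonNegative⁻¹ ¾) (^-nonneg {¾} (nonNegative⁻¹ ¾) (suc w))
    -- For n ≥ 2 the factor n + 2 is at most 2 n, the number under the root.
    2+n≤ : ∀ i → ι (2 ℕ.+ n) ≤ ι 4 * (sqrtApprox (2 ℕ.* n) i * sqrtApprox (2 ℕ.* n) i)
    2+n≤ i = ≤-trans (ι-mono (ℕ.≤-trans (ℕ.+-monoˡ-≤ n 2≤n) (ℕ.+-monoʳ-≤ n (ℕ.m≤m+n n 0))))
      (≤4*sqrtApprox² (2 ℕ.* n) {{2n≢0}} i)
      where
      2n≢0 : ℕ.NonZero (2 ℕ.* n)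
      2n≢0 = ℕ.m*n≢0 2 n {{_}} {{ℕ.>-nonZero (ℕ.≤-trans (s≤s z≤n) 2≤n)}}

≤ᴿ-pos : ∀ {δ e} → fromℚ 0ℚ <ᴿ δ → δ ≤ᴿ fromℚ e → 0ℚ < e
≤ᴿ-pos {e = e} (ε , 0<ε , N , h) δ≤e = <-≤-trans 0<½ε
  (≤-trans (≤-reflexive (solve 1 (λ ε → con ½ :* ε := con 0ℚ :+ ε :- con ½ :* ε) refl ε))
    (p≤r+q⇒p-q≤r {0ℚ + ε} {½ * ε} {e}
      (≤-trans (h (N ℕ.+ N′) (ℕ.m≤m+n N N′)) (h′ (N ℕ.+ N′) (ℕ.m≤n+m N′ N)))))
  where
  0<½ε = positive⁻¹ (½ * ε) {{pos*pos⇒pos ½ ε {{positive 0<ε}}}}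
  N′ = proj₁ (δ≤e (½ * ε) 0<½ε)
  h′ = proj₂ (δ≤e (½ * ε) 0<½ε)

mainTheorem5 : ∀ (m n d k : ℕ) .{{_ : ℕ.NonZero n}} (f : Bits m → Bits n) →
    1 ℕ.≤ d → IsLocal d f →
    1 ℕ.≤ k → k ℕ.≤ n ℕ.∸ 1 →
    let γ = + k / n in
    ∀ (δ : ℝ) → fromℚ 0ℚ <ᴿ δ → δ ≤ᴿ fromℚ (err γ d) →
    fromℕ 1 -ᴿ fromℕ 4 *ᴿ √ (2 ℕ.* n) *ᴿ exp (-ᴿ (fromℕ n *ᴿ δ ^ᴿ (40 ℕ.* d)))
    ≤ᴿ fromℚ (tv (pushforward f (𝒰 m)) (𝒟 n k))
mainTheorem5 m n d k f 1≤d local 1≤k k≤n∸1 δ 0<δ δ≤e =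
  1-4√2n*exp≤ {n} {d} {e} w (ℕ.≤-trans (s≤s 1≤k) k<n) (tv-nonneg (pushforward f (𝒰 m)) (𝒟 n k))
    -- With the tolerance e itself, `δ≤e` bounds the approximations of δ by e + e from some index
    -- on.
    (proj₁ (proj₂ bound)) (proj₂ (proj₂ bound)) δ 0<δ (δ≤e e 0<e)
  where
  γ e : ℚ
  γ = + k / n
  e = err γ d
  k<n : k ℕ.< n
  k<n = ℕ.≤-trans (s≤s k≤n∸1) (ℕ.≤-reflexive (ℕ.suc-pred n))
  γn≡k : γ * ι n ≡ ι k
  γn≡k = /-*-cancel (+ k) n
  γ<1 : γ < 1ℚ
  γ<1 = *-cancelʳ-<-nonNeg (ι n) {{nonNegative (ι-nonneg n)}}
    (subst₂ _<_ (sym γn≡k) (sym (*-identityˡ (ι n))) (<-≤-trans k<1+k (ι-mono k<n)))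
    where
    k<1+k : ι k < ι (suc k)
    k<1+k = subst₂ _<_ (+-identityˡ (ι k)) (sym (ι-suc k)) (+-monoˡ-< (ι k) (positive⁻¹ 1ℚ))
  0<e : 0ℚ < e
  0<e = ≤ᴿ-pos {δ} 0<δ δ≤e
  bound = local-tv-bound {m} {n} {d} {k} {γ} {e} γn≡k (nonNegative⁻¹ γ {{normalize-nonNeg k n}}) γ<1
    f 1≤d local 0<e (err+err≤½^d k n d) (err-least γ d)
  w = proj₁ bound
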